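{- There exists a $12$-dimensional cubical polytope with approximately $3.770370722\cdot 10^{45}$ vertices whose face vector $(f_0,\ldots,f_{11})$ satisfies $f_4>f_5<f_6$. Consequently, the face vector of a cubical polytope need not be unimodal.
   Context: A $d$-polytope is cubical if every facet is combinatorially equivalent to the $(d-1)$-cube (equivalently, all proper faces are combinatorially cubes). Its face vector is $(f_0,\ldots,f_{d-1})$, where $f_i$ is the number of $i$-dimensional faces. A vector $(a_0,\ldots,a_{d-1})$ is unimodal if for some index $i$ the sequence $(a_0,\ldots,a_i)$ is non-decreasing and $(a_i,\ldots,a_{d-1})$ is non-increasing. -}

module Defs where

open import Data.Nat as ℕ using (ℕ; zero; suc; _∸_)
open import Data.Fin as Fin using (Fin; zero; suc; toℕ)
open import Data.Rational using (ℚ; 0ℚ; _+_; _*_; _≤_)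
open import Data.Fin.Subset using (Subset; _∈_; _⊆_)
open import Data.List using (List; length)
open import Data.List.Relation.Unary.Unique.Propositional using (Unique)
import Data.List.Membership.Propositional as LM
open import Data.Vec using (Vec; lookup)
open import Data.Product using (Σ; ∃; _×_; _,_)
open import Data.Sum using (_⊎_)
open import Relation.Binary.PropositionalEquality using (_≡_)
open import Relation.Nullary using (¬_)

_⇔_ : Set → Set → Set
A ⇔ B = (A → B) × (B → A)

Point : ℕ → Set
Point d = Fin d → ℚ

sumℚ : ∀ {n} → (Fin n → ℚ) → ℚ
sumℚ {zero} f = 0ℚ
sumℚ {suc n} f = f zero + sumℚ (λ i → f (suc i))

_·_ : ∀ {d} → Point d → Point d → ℚ
a · x = sumℚ (λ i → a i * x i)

-- A finite point configuration V = (v_0,…,v_{m-1}) in ℚ^d;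
-- the polytope in question is P = conv(V).
Config : ℕ → ℕ → Set
Config d m = Fin m → Point d

Nonempty : ∀ {m} → Subset m → Set
Nonempty S = ∃ λ j → j ∈ S

-- A nonempty face of conv(V), recorded by the set of points of V it contains:
-- S = { j | a·v_j = c } for a valid inequality a·x ≤ c of V
-- (a = 0, c = 0 gives the polytope itself).
IsFace : ∀ {d m} → Config d m → Subset m → Set
IsFace {d} V S =
  Σ (Point d) λ a → Σ ℚ λ c →
    (∀ j → a · V j ≤ c) × (∀ j → (j ∈ S) ⇔ (a · V j ≡ c)) × Nonempty S

AffIndep : ∀ {d k} → (Fin k → Point d) → Set
AffIndep {d} {k} p =
  (l : Fin k → ℚ) → sumℚ l ≡ 0ℚ →
  (∀ (i : Fin d) → sumℚ (λ j → l j * p j i) ≡ 0ℚ) →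
  ∀ j → l j ≡ 0ℚ

DimAtLeast : ∀ {d m} → Config d m → Subset m → ℕ → Set
DimAtLeast {d} {m} V S k =
  Σ (Fin (suc k) → Fin m) λ ι → (∀ j → ι j ∈ S) × AffIndep (λ j → V (ι j))

HasDim : ∀ {d m} → Config d m → Subset m → ℕ → Set
HasDim V S k = DimAtLeast V S k × ¬ DimAtLeast V S (suc k)

IsPolytopeOfDim : ∀ {d m} → Config d m → ℕ → Set
IsPolytopeOfDim V k = HasDim V Data.Fin.Subset.⊤ k

FaceCount : ∀ {d m} → Config d m → ℕ → ℕ → Set
FaceCount {d} {m} V k n =
  Σ (List (Subset m)) λ L →
    length L ≡ n × Unique L ×
    (∀ S → (S LM.∈ L) ⇔ (IsFace V S × HasDim V S k))

data Tri : Set where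
  fix0 fix1 free : Tri

CubeFace : ℕ → Set
CubeFace n = Vec Tri n

_≤c_ : ∀ {n} → CubeFace n → CubeFace n → Set
F ≤c G = ∀ i → (lookup F i ≡ lookup G i) ⊎ (lookup G i ≡ free)

-- The face F of conv(V) is combinatorially equivalent to the n-cube:
-- an order isomorphism between the (nonempty) faces of the n-cube and the
-- (nonempty) faces of conv(V) contained in F.
CubeEquiv : ∀ {d m} → Config d m → Subset m → ℕ → Set
CubeEquiv {d} {m} V F n =
  Σ (CubeFace n → Subset m) λ φ →
    (∀ c → IsFace V (φ c) × φ c ⊆ F) ×
    (∀ S → IsFace V S → S ⊆ F → ∃ λ c → φ c ≡ S) ×
    (∀ c c' → (c ≤c c') ⇔ (φ c ⊆ φ c'))

Cubical : ∀ {d m} → Config d m → ℕ → Set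
Cubical V d = ∀ F → IsFace V F → HasDim V F (d ∸ 1) → CubeEquiv V F (d ∸ 1)

Unimodal : ∀ {n} → (Fin n → ℕ) → Set
Unimodal {n} a =
  Σ (Fin n) λ i →
    (∀ j k → j Fin.≤ k → k Fin.≤ i → a j ℕ.≤ a k) ×
    (∀ j k → i Fin.≤ j → j Fin.≤ k → a k ℕ.≤ a j)

{-# OPTIONS --safe #-}
module Submission where

-- A neighbourly cubical 12-polytope with 2^131 vertices is a projection of a deformed 131-cube.  Dually, a functional
-- a ∈ ℚ^12 determines a sequence w of length 131 whose first 12 entries are a and whose later entries are
-- κ ∇¹¹|w|, with ∇ the backward difference and κ huge; the polytope is built such that the face maximizing a is the
-- cube face whose fixed coordinates carry the signs of w and whose free coordinates are the zeros of w.  Since κ is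
-- huge, |w| is nearly a nonnegative polynomial of degree ≤ 10 on the integers.  A nonzero w has at most 11 zeros, so
-- all proper faces are cubes; squares of polynomials show that every face of dimension ≤ 5 of the 131-cube survives,
-- and nonnegative polynomials with paired zeros (Gale's evenness condition) give enough 6-dimensional faces.
-- Gluing K 12-cubes on top of each other onto one facet, which is a box, adds K (f_i(C¹²) − f_i(C¹¹)) faces of
-- dimension i < 11.  This number is larger for i = 4 than for i = 5, whereas the neighbourly polytope has f₅ much
-- smaller than f₆, and for K ≈ 1.841 · 10^42 both effects survive in the sum.

-- One cap adds 84480, 71808 and 44352 faces of dimensions 4, 5 and 6. So K caps raise f₄ - f₅ by
-- 12672 K and lower f₆ - f₅ by 27456 K. As the 131-cube has f₅ = 12.7 f₄, both inequalities can
-- hold only if the neighbourly polytope has more than 2.99 f₅ faces of dimension 6. This decides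
-- how many 6-faces have to be found; a lower bound for f₆ is enough. A prescribed sign pattern
-- makes the nonlinear system linear. The linear solution is compared with a polynomial, and
-- closeness shows that it has the assumed signs. Further 6-faces come from sequences that leave the
-- polynomial regime: once an entry outweighs all older ones by the factor 2^(p+1), it alone decides
-- the next difference, the next entry is positive and outweighs all older ones in turn. Patterns of
-- shorter sequences are prolonged in this way. A face count has to present the complete list of
-- faces, although the surviving patterns of dimension above 5 are not determined. The list is
-- obtained by filtering candidates with a decision procedure for being a face.

module CappedPolytopes where

  open import Data.Nat as ℕ using (ℕ; zero; suc; z≤n; s≤s)
  import Data.Nat.Properties as ℕP
  open import Data.Rational using (ℚ; 0ℚ; 1ℚ; _+_; _*_; _-_; -_; _≤_; _<_; _<?_; _≤?_; _⊔_; _⊓_; ∣_∣; 1/_; positive; nonNegative; ≢-nonZero)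
  open import Data.Rational.Properties hiding (module ≤-Reasoning)
  open import Data.Rational.Solver using (module +-*-Solver)
  open +-*-Solver using (solve; _:+_; _:*_; _:-_; :-_; con; _:=_)
  open import Data.Bool using (Bool; true; false)
  open import Data.Fin as Fin using (Fin; zero; suc; toℕ; inject₁)
  import Data.Fin.Properties as FinP
  open import Data.Fin.Subset as Sub using (Subset; _∈_; _∉_; _⊆_)
  import Data.Fin.Subset.Properties as SubP
  open import Data.List as List using (List; []; _∷_; _++_; map; length; filter; cartesianProduct; allFin)
  import Data.List.Properties as ListP
  open import Data.List.Relation.Unary.All as LAll using ([]; _∷_)
  import Data.List.Relation.Unary.All.Properties as LAllP
  open import Data.List.Relation.Unary.AllPairs as AP using ([]; _∷_)
  open import Data.List.Relation.Unary.Any using (here; there)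
  open import Data.List.Relation.Unary.Unique.Propositional using (Unique)
  import Data.List.Relation.Unary.Unique.Propositional.Properties as Uniq
  open import Data.List.Membership.Propositional using () renaming (_∈_ to _∈ˡ_)
  import Data.List.Membership.Propositional.Properties as Mem
  open import Data.Vec as Vec using (Vec; []; _∷_; lookup; tabulate)
  import Data.Vec.Properties as VecP
  open import Data.Vec.Relation.Unary.All as All using (All; []; _∷_)
  open import Data.Vec.Relation.Binary.Pointwise.Inductive as PW using (Pointwise; []; _∷_)
  open import Data.Product using (Σ; _×_; _,_; proj₁; proj₂)
  open import Data.Sum using (_⊎_; inj₁; inj₂)
  open import Data.Empty using (⊥; ⊥-elim)
  open import Data.Unit using (⊤; tt)
  open import Relation.Nullary using (¬_; Dec; yes; no)
  open import Relation.Nullary.Decidable using (map′; _×-dec_; ⌊_⌋)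
  open import Relation.Binary using (tri<; tri≈; tri>)
  open import Relation.Binary.PropositionalEquality
  open import Function using (_∘_; _↔_; Inverse)
  open import Defs

  private variable m n k j : ℕ

  -- Linear algebra over ℚ

  -- Inequalities are proved by certificates: the difference `t` is exhibited as a sum of products
  -- of nonnegative terms, and the equation is left to the ring solver.
  le-cert : ∀ {x y} t → 0ℚ ≤ t → x + t ≡ y → x ≤ y
  le-cert {x} t h refl = subst (_≤ x + t) (+-identityʳ x) (+-monoʳ-≤ x h)

  lt-cert : ∀ {x y} t → 0ℚ < t → x + t ≡ y → x < y
  lt-cert {x} t h refl = subst (_< x + t) (+-identityʳ x) (+-monoʳ-< x h)

  diff≥0 : ∀ {x y} → x ≤ y → 0ℚ ≤ y - x
  diff≥0 {x} {y} h = subst (_≤ y - x) (+-inverseʳ x) (+-monoˡ-≤ (- x) h)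

  diff>0 : ∀ {x y} → x < y → 0ℚ < y - x
  diff>0 {x} {y} h = subst (_< y - x) (+-inverseʳ x) (+-monoˡ-< (- x) h)

  0≤+ : ∀ {x y} → 0ℚ ≤ x → 0ℚ ≤ y → 0ℚ ≤ x + y
  0≤+ = +-mono-≤

  0<+≤ : ∀ {x y} → 0ℚ < x → 0ℚ ≤ y → 0ℚ < x + y
  0<+≤ = +-mono-<-≤

  0≤+< : ∀ {x y} → 0ℚ ≤ x → 0ℚ < y → 0ℚ < x + y
  0≤+< = +-mono-≤-<

  0≤* : ∀ {x y} → 0ℚ ≤ x → 0ℚ ≤ y → 0ℚ ≤ x * y
  0≤* {x} {y} hx hy = subst (_≤ x * y) (*-zeroʳ x) (*-monoˡ-≤-nonNeg x ⦃ nonNegative hx ⦄ hy)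

  0<* : ∀ {x y} → 0ℚ < x → 0ℚ < y → 0ℚ < x * y
  0<* {x} {y} hx hy = subst (_< x * y) (*-zeroʳ x) (*-monoʳ-<-pos x ⦃ positive hx ⦄ hy)

  *-mono-≤ : ∀ {a b c d} → 0ℚ ≤ a → 0ℚ ≤ d → a ≤ b → c ≤ d → a * c ≤ b * d
  *-mono-≤ {a} {b} {c} {d} ha hd h k = ≤-trans (*-monoˡ-≤-nonNeg a ⦃ nonNegative ha ⦄ k) (*-monoʳ-≤-nonNeg d ⦃ nonNegative hd ⦄ h)

  0<1 : 0ℚ < 1ℚ
  0<1 = positive⁻¹ 1ℚ

  0≤1 : 0ℚ ≤ 1ℚ
  0≤1 = <⇒≤ 0<1

  ≢0⇒inv : ∀ x → x ≢ 0ℚ → Σ ℚ λ y → y * x ≡ 1ℚ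
  ≢0⇒inv x h = 1/_ x ⦃ ≢-nonZero h ⦄ , *-inverseˡ x ⦃ ≢-nonZero h ⦄

  >0⇒inv : ∀ x → 0ℚ < x → Σ ℚ λ y → (y * x ≡ 1ℚ) × (0ℚ < y)
  >0⇒inv x h = 1/_ x ⦃ nz ⦄ , *-inverseˡ x ⦃ nz ⦄ , positive⁻¹ _ ⦃ 1/pos⇒pos x ⦃ positive h ⦄ ⦄
    where nz = pos⇒nonZero x ⦃ positive h ⦄

  neg≥0 : ∀ {x} → x ≤ 0ℚ → 0ℚ ≤ - x
  neg≥0 {x} h = subst (0ℚ ≤_) (+-identityˡ (- x)) (diff≥0 h)

  neg>0 : ∀ {x} → x < 0ℚ → 0ℚ < - x
  neg>0 {x} h = subst (0ℚ <_) (+-identityˡ (- x)) (diff>0 h)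

  x≤∣x∣ : ∀ x → x ≤ ∣ x ∣
  x≤∣x∣ x with ≤-total 0ℚ x
  ... | inj₁ h = ≤-reflexive (sym (0≤p⇒∣p∣≡p h))
  ... | inj₂ h = ≤-trans h (0≤∣p∣ x)

  -x≤∣x∣ : ∀ x → - x ≤ ∣ x ∣
  -x≤∣x∣ x = subst (- x ≤_) (∣-p∣≡∣p∣ x) (x≤∣x∣ (- x))

  x≤0⇒∣x∣≡-x : ∀ {x} → x ≤ 0ℚ → ∣ x ∣ ≡ - x
  x≤0⇒∣x∣≡-x {x} h = trans (sym (∣-p∣≡∣p∣ x)) (0≤p⇒∣p∣≡p (neg≥0 h))

  ∣∣≤ : ∀ {x b} → x ≤ b → - x ≤ b → ∣ x ∣ ≤ b
  ∣∣≤ {x} h k with ∣p∣≡p∨∣p∣≡-p x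
  ... | inj₁ e = subst (_≤ _) (sym e) h
  ... | inj₂ e = subst (_≤ _) (sym e) k

  x-x : ∀ x → x - x ≡ 0ℚ
  x-x = +-inverseʳ


  infixl 6 _⊕_
  infixl 7 _⊙_

  _⊕_ : Vec ℚ n → Vec ℚ n → Vec ℚ n
  _⊕_ = Vec.zipWith _+_

  _⊙_ : ℚ → Vec ℚ n → Vec ℚ n
  t ⊙ v = Vec.map (t *_) v

  𝟎 : Vec ℚ n
  𝟎 = Vec.replicate _ 0ℚ

  dot : Vec ℚ n → Vec ℚ n → ℚ
  dot [] [] = 0ℚ
  dot (x ∷ u) (y ∷ v) = x * y + dot u v

  dot-+ʳ : ∀ (u v w : Vec ℚ n) → dot u (v ⊕ w) ≡ dot u v + dot u w
  dot-+ʳ [] [] [] = refl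
  dot-+ʳ (x ∷ u) (y ∷ v) (z ∷ w) rewrite dot-+ʳ u v w =
    solve 5 (λ x y z a b → x :* (y :+ z) :+ (a :+ b) := (x :* y :+ a) :+ (x :* z :+ b)) refl x y z (dot u v) (dot u w)

  dot-⊙ʳ : ∀ t (u v : Vec ℚ n) → dot u (t ⊙ v) ≡ t * dot u v
  dot-⊙ʳ t [] [] = sym (*-zeroʳ t)
  dot-⊙ʳ t (x ∷ u) (y ∷ v) rewrite dot-⊙ʳ t u v =
    solve 4 (λ t x y a → x :* (t :* y) :+ t :* a := t :* (x :* y :+ a)) refl t x y (dot u v)

  dot-comm : ∀ (u v : Vec ℚ n) → dot u v ≡ dot v u
  dot-comm [] [] = refl
  dot-comm (x ∷ u) (y ∷ v) = cong₂ _+_ (*-comm x y) (dot-comm u v)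

  dot-⊙ˡ : ∀ t (u v : Vec ℚ n) → dot (t ⊙ u) v ≡ t * dot u v
  dot-⊙ˡ t u v rewrite dot-comm (t ⊙ u) v | dot-comm u v = dot-⊙ʳ t v u

  dot-𝟎ʳ : ∀ (u : Vec ℚ n) → dot u 𝟎 ≡ 0ℚ
  dot-𝟎ʳ [] = refl
  dot-𝟎ʳ (x ∷ u) = trans (cong₂ _+_ (*-zeroʳ x) (dot-𝟎ʳ u)) refl

  dot-𝟎ˡ : ∀ (u : Vec ℚ n) → dot 𝟎 u ≡ 0ℚ
  dot-𝟎ˡ u = trans (dot-comm 𝟎 u) (dot-𝟎ʳ u)

  ⊕-𝟎ˡ : ∀ (u : Vec ℚ n) → 𝟎 ⊕ u ≡ u
  ⊕-𝟎ˡ [] = refl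
  ⊕-𝟎ˡ (x ∷ u) = cong₂ _∷_ (+-identityˡ x) (⊕-𝟎ˡ u)

  ⊕-𝟎ʳ : ∀ (u : Vec ℚ n) → u ⊕ 𝟎 ≡ u
  ⊕-𝟎ʳ [] = refl
  ⊕-𝟎ʳ (x ∷ u) = cong₂ _∷_ (+-identityʳ x) (⊕-𝟎ʳ u)

  ⊙-𝟎 : ∀ t → t ⊙ 𝟎 {n} ≡ 𝟎
  ⊙-𝟎 {zero} t = refl
  ⊙-𝟎 {suc n} t = cong₂ _∷_ (*-zeroʳ t) (⊙-𝟎 t)

  0⊙ : ∀ (u : Vec ℚ n) → 0ℚ ⊙ u ≡ 𝟎
  0⊙ [] = refl
  0⊙ (x ∷ u) = cong₂ _∷_ (*-zeroˡ x) (0⊙ u)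

  1⊙ : ∀ (u : Vec ℚ n) → 1ℚ ⊙ u ≡ u
  1⊙ [] = refl
  1⊙ (x ∷ u) = cong₂ _∷_ (*-identityˡ x) (1⊙ u)

  isZero? : (v : Vec ℚ n) → (v ≡ 𝟎) ⊎ (v ≢ 𝟎)
  isZero? [] = inj₁ refl
  isZero? (x ∷ v) with x ≟ 0ℚ | isZero? v
  ... | yes refl | inj₁ refl = inj₁ refl
  ... | yes refl | inj₂ h = inj₂ λ e → h (cong Vec.tail e)
  ... | no h | _ = inj₂ λ e → h (cong Vec.head e)

  head-tail-𝟎 : ∀ (v : Vec ℚ (suc n)) → Vec.head v ≡ 0ℚ → Vec.tail v ≡ 𝟎 → v ≡ 𝟎
  head-tail-𝟎 (_ ∷ _) refl refl = refl

  LinF : (Vec ℚ n → ℚ) → Set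
  LinF f = (∀ u v → f (u ⊕ v) ≡ f u + f v) × (∀ t u → f (t ⊙ u) ≡ t * f u)

  LinM : (Vec ℚ m → Vec ℚ n) → Set
  LinM φ = (∀ u v → φ (u ⊕ v) ≡ φ u ⊕ φ v) × (∀ t u → φ (t ⊙ u) ≡ t ⊙ φ u)

  LinF-∘ : ∀ {f : Vec ℚ n → ℚ} {φ : Vec ℚ m → Vec ℚ n} → LinF f → LinM φ → LinF (f ∘ φ)
  LinF-∘ {f = f} (f+ , f⊙) (φ+ , φ⊙) =
    (λ u v → trans (cong f (φ+ u v)) (f+ _ _)) , (λ t u → trans (cong f (φ⊙ t u)) (f⊙ t _))

  LinM-∘ : ∀ {ψ : Vec ℚ n → Vec ℚ k} {φ : Vec ℚ m → Vec ℚ n} → LinM ψ → LinM φ → LinM (ψ ∘ φ)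
  LinM-∘ {ψ = f} (f+ , f⊙) (φ+ , φ⊙) =
    (λ u v → trans (cong f (φ+ u v)) (f+ _ _)) , (λ t u → trans (cong f (φ⊙ t u)) (f⊙ t _))

  LinF-dot : (u : Vec ℚ n) → LinF (dot u)
  LinF-dot u = dot-+ʳ u , λ t → dot-⊙ʳ t u

  LinF-+ : ∀ {f g : Vec ℚ n → ℚ} → LinF f → LinF g → LinF (λ v → f v + g v)
  LinF-+ {f = f} {g} (f+ , f⊙) (g+ , g⊙) =
    (λ u v → trans (cong₂ _+_ (f+ u v) (g+ u v))
      (solve 4 (λ a b c d → (a :+ b) :+ (c :+ d) := (a :+ c) :+ (b :+ d)) refl (f u) (f v) (g u) (g v))) ,
    (λ t u → trans (cong₂ _+_ (f⊙ t u) (g⊙ t u)) (sym (*-distribˡ-+ t (f u) (g u))))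

  LinF-* : ∀ s {f : Vec ℚ n → ℚ} → LinF f → LinF (λ v → s * f v)
  LinF-* s {f} (f+ , f⊙) =
    (λ u v → trans (cong (s *_) (f+ u v)) (*-distribˡ-+ s _ _)) ,
    (λ t u → trans (cong (s *_) (f⊙ t u)) (solve 3 (λ s t a → s :* (t :* a) := t :* (s :* a)) refl s t (f u)))

  LinF-0 : ∀ {f : Vec ℚ n → ℚ} → LinF f → f 𝟎 ≡ 0ℚ
  LinF-0 {f = f} (_ , f⊙) = trans (cong f (sym (0⊙ 𝟎))) (trans (f⊙ 0ℚ 𝟎) (*-zeroˡ (f 𝟎)))

  LinF-lookup : (i : Fin n) → LinF (λ v → lookup v i)
  LinF-lookup zero = (λ { (_ ∷ _) (_ ∷ _) → refl }) , (λ { t (_ ∷ _) → refl })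
  LinF-lookup (suc i) = (λ { (_ ∷ u) (_ ∷ v) → proj₁ (LinF-lookup i) u v }) , (λ { t (_ ∷ u) → proj₂ (LinF-lookup i) t u })

  LinM-tail : LinM (Vec.tail {A = ℚ} {n = n})
  LinM-tail = (λ { (_ ∷ _) (_ ∷ _) → refl }) , (λ { t (_ ∷ _) → refl })

  LinM-0∷ : LinM (λ (v : Vec ℚ n) → 0ℚ ∷ v)
  LinM-0∷ = (λ u v → refl) , (λ t u → cong (_∷ (t ⊙ u)) (sym (*-zeroʳ t)))

  LinM-∷ : ∀ {f : Vec ℚ m → ℚ} {φ : Vec ℚ m → Vec ℚ n} → LinF f → LinM φ → LinM (λ v → f v ∷ φ v)
  LinM-∷ (f+ , f⊙) (φ+ , φ⊙) = (λ u v → cong₂ _∷_ (f+ u v) (φ+ u v)) , (λ t u → cong₂ _∷_ (f⊙ t u) (φ⊙ t u))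

  split-head : ∀ x (v : Vec ℚ n) → x ∷ v ≡ x ⊙ (1ℚ ∷ 𝟎) ⊕ (0ℚ ∷ v)
  split-head x v = cong₂ _∷_ (solve 1 (λ x → x := x :* con 1ℚ :+ con 0ℚ) refl x)
    (sym (trans (cong (_⊕ v) (⊙-𝟎 x)) (⊕-𝟎ˡ v)))

  LinF-head : ∀ {f : Vec ℚ (suc n) → ℚ} → LinF f → ∀ x v → f (x ∷ v) ≡ x * f (1ℚ ∷ 𝟎) + f (0ℚ ∷ v)
  LinF-head {f = f} (f+ , f⊙) x v = trans (cong f (split-head x v)) (trans (f+ _ _) (cong (_+ _) (f⊙ x _)))

  -- Elimination of one unknown: if the form does not vanish on the first unit vector, it is solved
  -- for the first coordinate; otherwise this coordinate stays free and the elimination takes place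
  -- among the others.
  kernel : ∀ (f : Vec ℚ (suc n) → ℚ) → LinF f →
    Σ (Vec ℚ n → Vec ℚ (suc n)) λ φ → LinM φ × (∀ v → φ v ≡ 𝟎 → v ≡ 𝟎) × (∀ v → f (φ v) ≡ 0ℚ)
  kernel {n} f lf with f (1ℚ ∷ 𝟎) ≟ 0ℚ
  kernel {n} f lf | no h = φ , LinM-∷ (LinF-* (- y) (LinF-∘ {φ = 0ℚ ∷_} lf LinM-0∷)) ((λ _ _ → refl) , (λ _ _ → refl)) ,
      (λ v e → cong Vec.tail e) , fφ
    where
    y = proj₁ (≢0⇒inv _ h)
    φ : Vec ℚ n → Vec ℚ (suc n)
    φ v = - y * f (0ℚ ∷ v) ∷ v
    fφ : ∀ v → f (φ v) ≡ 0ℚ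
    fφ v = trans (LinF-head lf (- y * f (0ℚ ∷ v)) v)
      (trans (solve 3 (λ y e a → (:- y :* a) :* e :+ a := a :* (con 1ℚ :- y :* e)) refl y (f (1ℚ ∷ 𝟎)) (f (0ℚ ∷ v)))
        (trans (cong (λ z → f (0ℚ ∷ v) * (1ℚ - z)) (proj₂ (≢0⇒inv _ h))) (*-zeroʳ (f (0ℚ ∷ v)))))
  kernel {zero} f lf | yes h = (λ _ → 0ℚ ∷ []) , ((λ _ _ → refl) , (λ t _ → cong (_∷ []) (sym (*-zeroʳ t)))) ,
    (λ { [] _ → refl }) , (λ _ → LinF-0 lf)
  kernel {suc n} f lf | yes h with kernel (λ v → f (0ℚ ∷ v)) (LinF-∘ {φ = 0ℚ ∷_} lf LinM-0∷)
  ... | φ , lφ , inj , fφ = (λ v → Vec.head v ∷ φ (Vec.tail v)) ,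
     LinM-∷ {f = Vec.head} ((λ { (_ ∷ _) (_ ∷ _) → refl }) , (λ { t (_ ∷ _) → refl })) (LinM-∘ {n = _} {ψ = φ} {φ = Vec.tail} lφ LinM-tail) ,
     (λ { (x ∷ v) e → cong₂ _∷_ (cong Vec.head e) (inj v (cong Vec.tail e)) }) ,
     (λ { (x ∷ v) → trans (LinF-head lf x (φ v)) (trans (cong₂ (λ a b → x * a + b) h (fφ v))
          (solve 1 (λ x → x :* con 0ℚ :+ con 0ℚ := con 0ℚ) refl x)) })

  -- One unknown more than equations. Inhomogeneous systems are reduced to this form by a
  -- homogenising unknown, and upper bounds for dimensions use it for affine relations.
  nullvec : ∀ (fs : Fin m → Vec ℚ (suc m) → ℚ) → (∀ i → LinF (fs i)) →
    Σ (Vec ℚ (suc m)) λ v → (v ≢ 𝟎) × (∀ i → fs i v ≡ 0ℚ)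
  nullvec {zero} fs lin = 1ℚ ∷ [] , (λ e → 1≢0 (cong Vec.head e)) , λ ()
  nullvec {suc m} fs lin with kernel (fs zero) (lin zero)
  ... | φ , lφ , inj , z with nullvec (λ i v → fs (suc i) (φ v)) (λ i → LinF-∘ (lin (suc i)) lφ)
  ... | v , v≢0 , zs = φ v , (λ e → v≢0 (inj v e)) , λ { zero → z v ; (suc i) → zs i }

  -- Polynomials and differences

  ι : ℕ → ℚ
  ι zero = 0ℚ
  ι (suc n) = 1ℚ + ι n

  ι≥0 : ∀ n → 0ℚ ≤ ι n
  ι≥0 zero = ≤-refl
  ι≥0 (suc n) = 0≤+ 0≤1 (ι≥0 n)

  ι-mono-≤ : ∀ {m n} → m ℕ.≤ n → ι m ≤ ι n
  ι-mono-≤ {n = n} z≤n = ι≥0 n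
  ι-mono-≤ (s≤s h) = +-monoʳ-≤ 1ℚ (ι-mono-≤ h)

  ι-gap : ∀ {m n} → m ℕ.< n → 1ℚ ≤ ι n - ι m
  ι-gap {m} {n} h = le-cert _ (diff≥0 (ι-mono-≤ h))
    (solve 2 (λ a b → con 1ℚ :+ (b :- (con 1ℚ :+ a)) := b :- a) refl (ι m) (ι n))

  two : ℚ
  two = 1ℚ + 1ℚ

  ev : Vec ℚ n → ℚ → ℚ
  ev [] x = 0ℚ
  ev (c ∷ q) x = c + x * ev q x

  vals : Vec ℚ j → ∀ n → Vec ℚ n
  vals q zero = []
  vals q (suc n) = ev q (ι n) ∷ vals q n

  mulx : Vec ℚ n → Vec ℚ n
  mulx [] = []
  mulx {suc n} (x ∷ v) = ι n * x ∷ mulx v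

  -- The j-th backward difference at the head of a vector; too short vectors are continued by zeros.
  dif : ℕ → Vec ℚ n → ℚ
  dif j [] = 0ℚ
  dif zero (x ∷ v) = x
  dif (suc j) (x ∷ v) = dif j (x ∷ v) - dif j v

  dif-lin : ∀ j → LinF (dif {n} j)
  dif-lin {zero} j = (λ { [] [] → refl }) , (λ { t [] → sym (*-zeroʳ t) })
  dif-lin {suc n} zero = (λ { (_ ∷ _) (_ ∷ _) → refl }) , (λ { t (_ ∷ _) → refl })
  dif-lin {suc n} (suc j) =
    (λ { (x ∷ u) (y ∷ v) → trans (cong₂ _-_ (proj₁ (dif-lin j) (x ∷ u) (y ∷ v)) (proj₁ (dif-lin j) u v))
       (solve 4 (λ a b c d → (a :+ b) :- (c :+ d) := (a :- c) :+ (b :- d)) refl (dif j (x ∷ u)) (dif j (y ∷ v)) (dif j u) (dif j v)) }) ,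
    (λ { t (x ∷ u) → trans (cong₂ _-_ (proj₂ (dif-lin j) t (x ∷ u)) (proj₂ (dif-lin j) t u))
       (solve 3 (λ t a b → t :* a :- t :* b := t :* (a :- b)) refl t (dif j (x ∷ u)) (dif j u)) })

  -- The discrete Leibniz rule ∇ʲ⁺¹(x f) = x ∇ʲ⁺¹f + (j + 1) ∇ʲf(x - 1); the position of the head is
  -- the length of its tail.
  dif-leibniz : ∀ j x (v : Vec ℚ n) →
    dif (suc j) (mulx (x ∷ v)) ≡ ι n * dif (suc j) (x ∷ v) + ι (suc j) * dif j v
  dif-leibniz zero x [] = solve 1 (λ x → con 0ℚ :* x :- con 0ℚ := con 0ℚ :* (x :- con 0ℚ) :+ (con 1ℚ :+ con 0ℚ) :* con 0ℚ) refl x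
  dif-leibniz {suc n} zero x (y ∷ v) = solve 3 (λ n x y → (con 1ℚ :+ n) :* x :- n :* y :=
     (con 1ℚ :+ n) :* (x :- y) :+ (con 1ℚ :+ con 0ℚ) :* y) refl (ι n) x y
  dif-leibniz (suc j) x [] = trans (cong (_- 0ℚ) (dif-leibniz j x []))
    (solve 3 (λ i x d → (con 0ℚ :* d :+ i :* con 0ℚ) :- con 0ℚ := con 0ℚ :* (d :- con 0ℚ) :+ (con 1ℚ :+ i) :* con 0ℚ)
      refl (ι (suc j)) x (dif (suc j) (x ∷ [])))
  dif-leibniz {suc n} (suc j) x (y ∷ v) = trans (cong₂ _-_ (dif-leibniz j x (y ∷ v)) (dif-leibniz j y v))
    (solve 5 (λ n i a b c → ((con 1ℚ :+ n) :* a :+ i :* b) :- (n :* (b :- c) :+ i :* c) :=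
        (con 1ℚ :+ n) :* (a :- (b :- c)) :+ (con 1ℚ :+ i) :* (b :- c)) refl
        (ι n) (ι (suc j)) (dif (suc j) (x ∷ y ∷ v)) (dif j (y ∷ v)) (dif j v))

  dif-const : ∀ j n c → j ℕ.< n → dif (suc j) (Vec.replicate (suc n) c) ≡ 0ℚ
  dif-const zero (suc n) c h = x-x c
  dif-const (suc j) (suc n) c (s≤s h) = trans (cong₂ _-_ (dif-const j (suc n) c (ℕP.m<n⇒m<1+n h)) (dif-const j n c h)) refl

  vals-∷ : ∀ c (q : Vec ℚ j) n → vals (c ∷ q) n ≡ Vec.replicate n c ⊕ mulx (vals q n)
  vals-∷ c q zero = refl
  vals-∷ c q (suc n) = cong (c + ι n * ev q (ι n) Vec.∷_) (vals-∷ c q n)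

  -- Induction on the degree by `dif-leibniz`. The hypothesis keeps the window of j + 1 entries
  -- inside the vector, away from the continuation by zeros.
  dif-poly : ∀ (q : Vec ℚ j) n → j ℕ.≤ n → dif j (vals q (suc n)) ≡ 0ℚ
  dif-poly [] n h = refl
  dif-poly {suc j} (c ∷ q) (suc n) (s≤s h) = trans (cong (dif (suc j)) (vals-∷ c q (suc (suc n))))
    (trans (proj₁ (dif-lin (suc j)) (Vec.replicate (suc (suc n)) c) (mulx (vals q (suc (suc n)))))
     (trans (cong₂ _+_ (dif-const j (suc n) c (s≤s h)) (dif-leibniz j (ev q (ι (suc n))) (vals q (suc n))))
      (trans (cong₂ (λ a b → 0ℚ + (ι (suc n) * (a - b) + ι (suc j) * b)) (dif-poly q (suc n) (ℕP.m≤n⇒m≤1+n h)) (dif-poly q n h))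
        (solve 2 (λ a b → con 0ℚ :+ (a :* (con 0ℚ :- con 0ℚ) :+ b :* con 0ℚ) := con 0ℚ) refl (ι (suc n)) (ι (suc j))))))

  Bd : ℚ → Vec ℚ n → Set
  Bd B = All (λ x → ∣ x ∣ ≤ B)

  pow2 : ℕ → ℚ
  pow2 zero = 1ℚ
  pow2 (suc j) = pow2 j + pow2 j

  pow2≥1 : ∀ j → 1ℚ ≤ pow2 j
  pow2≥1 zero = ≤-refl
  pow2≥1 (suc j) = le-cert _ (0≤+ (diff≥0 (pow2≥1 j)) (≤-trans 0≤1 (pow2≥1 j)))
    (solve 1 (λ a → con 1ℚ :+ (a :- con 1ℚ :+ a) := a :+ a) refl (pow2 j))

  pow2≥0 : ∀ j → 0ℚ ≤ pow2 j
  pow2≥0 j = ≤-trans 0≤1 (pow2≥1 j)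

  Bd-mono : ∀ {A B} {v : Vec ℚ n} → A ≤ B → Bd A v → Bd B v
  Bd-mono h = All.map (λ k → ≤-trans k h)

  dif-bound : ∀ {B} j (v : Vec ℚ n) → 0ℚ ≤ B → Bd B v → ∣ dif j v ∣ ≤ pow2 j * B
  dif-bound j [] h [] = 0≤* (pow2≥0 j) h
  dif-bound {B = B} zero (x ∷ v) h (k ∷ _) = subst (_ ≤_) (sym (*-identityˡ B)) k
  dif-bound {B = B} (suc j) (x ∷ v) h (k ∷ ks) = ≤-trans (∣p-q∣≤∣p∣+∣q∣ (dif j (x ∷ v)) (dif j v))
    (≤-trans (+-mono-≤ (dif-bound j (x ∷ v) h (k ∷ ks)) (dif-bound j v h ks)) (≤-reflexive (sym (*-distribʳ-+ B (pow2 j) (pow2 j)))))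

  -- In ∇ʲ the head has coefficient 1 and the other coefficients have absolute sum 2ʲ - 1. The
  -- difference therefore follows a head that is large compared with the tail.
  dif-head : ∀ {B} j x (v : Vec ℚ n) → 0ℚ ≤ B → Bd B v → ∣ dif j (x ∷ v) - x ∣ ≤ pow2 j * B
  dif-head {B = B} zero x v h ks = subst (λ z → ∣ z ∣ ≤ _) (sym (x-x x)) (0≤* 0≤1 h)
  dif-head {B = B} (suc j) x v h ks = subst (λ z → ∣ z ∣ ≤ _)
     (solve 3 (λ a b x → (a :- x) :- b := (a :- b) :- x) refl (dif j (x ∷ v)) (dif j v) x)
     (≤-trans (∣p-q∣≤∣p∣+∣q∣ (dif j (x ∷ v) - x) (dif j v))
      (≤-trans (+-mono-≤ (dif-head j x v h ks) (dif-bound j v h ks)) (≤-reflexive (sym (*-distribʳ-+ B (pow2 j) (pow2 j))))))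

  ev-⊕ : ∀ (u v : Vec ℚ n) x → ev (u ⊕ v) x ≡ ev u x + ev v x
  ev-⊕ [] [] x = refl
  ev-⊕ (a ∷ u) (b ∷ v) x rewrite ev-⊕ u v x =
    solve 5 (λ a b x c d → (a :+ b) :+ x :* (c :+ d) := (a :+ x :* c) :+ (b :+ x :* d)) refl a b x (ev u x) (ev v x)

  ev-⊙ : ∀ t (u : Vec ℚ n) x → ev (t ⊙ u) x ≡ t * ev u x
  ev-⊙ t [] x = sym (*-zeroʳ t)
  ev-⊙ t (a ∷ u) x rewrite ev-⊙ t u x =
    solve 4 (λ t a x c → t :* a :+ x :* (t :* c) := t :* (a :+ x :* c)) refl t a x (ev u x)

  ev-𝟎 : ∀ n x → ev (𝟎 {n}) x ≡ 0ℚ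
  ev-𝟎 zero x = refl
  ev-𝟎 (suc n) x = trans (+-identityˡ (x * ev (𝟎 {n}) x)) (trans (cong (x *_) (ev-𝟎 n x)) (*-zeroʳ x))

  pad : Vec ℚ n → Vec ℚ (suc n)
  pad [] = 0ℚ ∷ []
  pad (x ∷ v) = x ∷ pad v

  ev-pad : ∀ (u : Vec ℚ n) x → ev (pad u) x ≡ ev u x
  ev-pad [] x = trans (+-identityˡ _) (*-zeroʳ x)
  ev-pad (a ∷ u) x = cong (λ z → a + x * z) (ev-pad u x)

  mulLin : ℚ → Vec ℚ n → Vec ℚ (suc n)
  mulLin z q = (0ℚ ∷ q) ⊕ (- z) ⊙ pad q

  ev-mulLin : ∀ z (q : Vec ℚ n) x → ev (mulLin z q) x ≡ (x - z) * ev q x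
  ev-mulLin z q x = trans (ev-⊕ (0ℚ ∷ q) ((- z) ⊙ pad q) x)
    (trans (cong ((0ℚ + x * ev q x) +_) (trans (ev-⊙ (- z) (pad q) x) (cong (- z *_) (ev-pad q x))))
      (solve 3 (λ x z a → (con 0ℚ :+ x :* a) :+ (:- z) :* a := (x :- z) :* a) refl x z (ev q x)))

  -- Synthetic division: the quotient of q(x) - q(z) by x - z.
  divLin : ℚ → Vec ℚ (suc n) → Vec ℚ n
  divLin {zero} z _ = []
  divLin {suc n} z (c ∷ q) = q ⊕ z ⊙ pad (divLin z q)

  ev-divLin : ∀ z (q : Vec ℚ (suc n)) x → ev q x - ev q z ≡ (x - z) * ev (divLin z q) x
  ev-divLin {zero} z (c ∷ []) x = solve 3 (λ c x z → (c :+ x :* con 0ℚ) :- (c :+ z :* con 0ℚ) := (x :- z) :* con 0ℚ) refl c x z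
  ev-divLin {suc n} z (c ∷ q) x = trans
    (solve 5 (λ c x z a b → (c :+ x :* a) :- (c :+ z :* b) := (x :- z) :* a :+ z :* (a :- b)) refl c x z (ev q x) (ev q z))
    (trans (cong (λ w → (x - z) * ev q x + z * w) (ev-divLin z q x))
     (trans (solve 4 (λ x z a g → (x :- z) :* a :+ z :* ((x :- z) :* g) := (x :- z) :* (a :+ z :* g)) refl x z (ev q x) (ev (divLin z q) x))
       (cong ((x - z) *_) (sym (trans (ev-⊕ q (z ⊙ pad (divLin z q)) x)
          (cong (ev q x +_) (trans (ev-⊙ z (pad (divLin z q)) x) (cong (z *_) (ev-pad (divLin z q) x)))))))))

  rootBound : ℕ → ℕ → ℚ
  rootBound M zero = 0ℚ
  rootBound M (suc j) = 1ℚ + ι M * (rootBound M j * two)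

  0≤two : 0ℚ ≤ two
  0≤two = 0≤+ 0≤1 0≤1

  rootBound≥0 : ∀ M j → 0ℚ ≤ rootBound M j
  rootBound≥0 M zero = ≤-refl
  rootBound≥0 M (suc j) = 0≤+ 0≤1 (0≤* (ι≥0 M) (0≤* (rootBound≥0 M j) 0≤two))

  ι-dist : ∀ {M x y} → x ℕ.< M → y ℕ.< M → ∣ ι x - ι y ∣ ≤ ι M
  ι-dist {M} {x} {y} hx hy = ∣∣≤
    (le-cert _ (0≤+ (diff≥0 (ι-mono-≤ (ℕP.<⇒≤ hx))) (ι≥0 y)) (solve 3 (λ M x y → (x :- y) :+ ((M :- x) :+ y) := M) refl (ι M) (ι x) (ι y)))
    (le-cert _ (0≤+ (diff≥0 (ι-mono-≤ (ℕP.<⇒≤ hy))) (ι≥0 x)) (solve 3 (λ M x y → (:- (x :- y)) :+ ((M :- y) :+ x) := M) refl (ι M) (ι x) (ι y)))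

  ∣-∣-sym : ∀ x y → ∣ x - y ∣ ≡ ∣ y - x ∣
  ∣-∣-sym x y = trans (sym (∣-p∣≡∣p∣ (x - y))) (cong ∣_∣ (solve 2 (λ x y → :- (x :- y) := y :- x) refl x y))

  -- A quantitative form of the bound on the number of roots. Dividing by x - z leaves a quotient
  -- with one coefficient less, of size at most 2B at the remaining near-roots, because distinct
  -- integers differ by at least 1.
  root-bound : ∀ {B} M (q : Vec ℚ j) zs → 0ℚ ≤ B → AP.AllPairs ℕ._>_ zs → LAll.All (ℕ._< M) zs →
    LAll.All (λ z → ∣ ev q (ι z) ∣ ≤ B) zs → j ℕ.≤ length zs → ∀ x → x ℕ.< M → ∣ ev q (ι x) ∣ ≤ rootBound M j * B
  root-bound {B = B} M [] zs hB _ _ _ _ x hx = ≤-reflexive (sym (*-zeroˡ B))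
  root-bound {suc j} {B} M q (z ∷ zs) hB (zz ∷ ap) (hz ∷ hzs) (b ∷ bs) (s≤s l) x hx =
    subst (λ w → ∣ w ∣ ≤ _) (solve 2 (λ a b → b :+ (a :- b) := a) refl (ev q (ι x)) (ev q (ι z)))
    (≤-trans (∣p+q∣≤∣p∣+∣q∣ (ev q (ι z)) (ev q (ι x) - ev q (ι z)))
    (≤-trans (+-mono-≤ b (subst (λ w → ∣ w ∣ ≤ ι M * (rootBound M j * (two * B))) (sym (ev-divLin (ι z) q (ι x)))
       (≤-trans (≤-reflexive (∣p*q∣≡∣p∣*∣q∣ (ι x - ι z) (ev g (ι x))))
         (*-mono-≤ (0≤∣p∣ _) (0≤* (rootBound≥0 M j) (0≤* 0≤two hB)) (ι-dist hx hz)
           (root-bound M g zs (0≤* 0≤two hB) ap hzs (quot zs zz bs) l x hx)))))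
      (≤-reflexive (solve 4 (λ B m r t → B :+ m :* (r :* (t :* B)) := (con 1ℚ :+ m :* (r :* t)) :* B) refl B (ι M) (rootBound M j) two))))
    where
    g = divLin (ι z) q
    quot : ∀ ys → LAll.All (z ℕ.>_) ys → LAll.All (λ y → ∣ ev q (ι y) ∣ ≤ B) ys → LAll.All (λ y → ∣ ev g (ι y) ∣ ≤ two * B) ys
    quot [] [] [] = []
    quot (y ∷ ys) (h ∷ hs) (k ∷ ks) = ≤-trans step₁ step₂ ∷ quot ys hs ks
      where
      gap : 1ℚ ≤ ∣ ι y - ι z ∣
      gap = ≤-trans (ι-gap h) (≤-trans (x≤∣x∣ _) (≤-reflexive (∣-∣-sym (ι z) (ι y))))
      step₁ : ∣ ev g (ι y) ∣ ≤ ∣ (ι y - ι z) * ev g (ι y) ∣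
      step₁ = subst₂ _≤_ (*-identityˡ _) (sym (∣p*q∣≡∣p∣*∣q∣ (ι y - ι z) (ev g (ι y))))
        (*-monoʳ-≤-nonNeg ∣ ev g (ι y) ∣ ⦃ ∣-∣-nonNeg (ev g (ι y)) ⦄ gap)
      step₂ : ∣ (ι y - ι z) * ev g (ι y) ∣ ≤ two * B
      step₂ = subst (λ w → ∣ w ∣ ≤ two * B) (ev-divLin (ι z) q (ι y))
        (≤-trans (∣p-q∣≤∣p∣+∣q∣ (ev q (ι y)) (ev q (ι z))) (≤-trans (+-mono-≤ k b)
          (≤-reflexive (solve 1 (λ B → B :+ B := (con 1ℚ :+ con 1ℚ) :* B) refl B))))

  -- The falling factorial x(x - 1)⋯(x - j + 1), which serves as basis for Newton interpolation at
  -- 0, 1, 2, ....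
  falling : ∀ j → Vec ℚ (suc j)
  falling zero = 1ℚ ∷ []
  falling (suc j) = mulLin (ι j) (falling j)

  falling-zero : ∀ j i → i ℕ.< j → ev (falling j) (ι i) ≡ 0ℚ
  falling-zero (suc j) i (s≤s h) with ℕP.m≤n⇒m<n∨m≡n h
  ... | inj₁ k = trans (ev-mulLin (ι j) (falling j) (ι i)) (trans (cong ((ι i - ι j) *_) (falling-zero j i k)) (*-zeroʳ (ι i - ι j)))
  ... | inj₂ refl = trans (ev-mulLin (ι j) (falling j) (ι i)) (trans (cong (_* ev (falling j) (ι i)) (x-x (ι i))) (*-zeroˡ (ev (falling j) (ι i))))

  falling-pos : ∀ j i → j ℕ.≤ i → 0ℚ < ev (falling j) (ι i)
  falling-pos zero i h = subst (0ℚ <_) (sym (trans (cong (1ℚ +_) (*-zeroʳ (ι i))) (+-identityʳ 1ℚ))) 0<1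
  falling-pos (suc j) i h = subst (0ℚ <_) (sym (ev-mulLin (ι j) (falling j) (ι i)))
    (0<* (<-≤-trans 0<1 (ι-gap h)) (falling-pos j i (ℕP.<⇒≤ h)))

  vals-⊕ : ∀ (u v : Vec ℚ j) n → vals (u ⊕ v) n ≡ vals u n ⊕ vals v n
  vals-⊕ u v zero = refl
  vals-⊕ u v (suc n) = cong₂ _∷_ (ev-⊕ u v (ι n)) (vals-⊕ u v n)

  vals-⊙ : ∀ t (u : Vec ℚ j) n → vals (t ⊙ u) n ≡ t ⊙ vals u n
  vals-⊙ t u zero = refl
  vals-⊙ t u (suc n) = cong₂ _∷_ (ev-⊙ t u (ι n)) (vals-⊙ t u n)

  vals-pad : ∀ (u : Vec ℚ j) n → vals (pad u) n ≡ vals u n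
  vals-pad u zero = refl
  vals-pad u (suc n) = cong₂ _∷_ (ev-pad u (ι n)) (vals-pad u n)

  vals-zero : ∀ (q : Vec ℚ j) n → (∀ i → i ℕ.< n → ev q (ι i) ≡ 0ℚ) → vals q n ≡ 𝟎
  vals-zero q zero h = refl
  vals-zero q (suc n) h = cong₂ _∷_ (h n ℕP.≤-refl) (vals-zero q n (λ i k → h i (ℕP.m<n⇒m<1+n k)))

  interpolate : ∀ (v : Vec ℚ n) → Σ (Vec ℚ n) λ q → vals q n ≡ v
  interpolate [] = [] , refl
  interpolate {suc n} (x ∷ v) with interpolate v | >0⇒inv _ (falling-pos n n ℕP.≤-refl)
  ... | q , e | y , ye , _ = pad q ⊕ t ⊙ falling n , cong₂ _∷_ hd tl
    where
    w = ev (falling n) (ι n)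
    a = ev q (ι n)
    t = (x - a) * y
    hd : ev (pad q ⊕ t ⊙ falling n) (ι n) ≡ x
    hd = trans (ev-⊕ (pad q) (t ⊙ falling n) (ι n)) (trans (cong₂ _+_ (ev-pad q (ι n)) (ev-⊙ t (falling n) (ι n)))
      (trans (solve 4 (λ a x y w → a :+ (x :- a) :* y :* w := a :+ (x :- a) :* (y :* w)) refl a x y w)
        (trans (cong (λ z → a + (x - a) * z) ye) (solve 2 (λ a x → a :+ (x :- a) :* con 1ℚ := x) refl a x))))
    tl : vals (pad q ⊕ t ⊙ falling n) n ≡ v
    tl = trans (vals-⊕ (pad q) (t ⊙ falling n) n) (trans (cong₂ _⊕_ (trans (vals-pad q n) e)
      (trans (vals-⊙ t (falling n) n) (trans (cong (t ⊙_) (vals-zero (falling n) n (falling-zero n))) (⊙-𝟎 t)))) (⊕-𝟎ʳ v))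

  infixl 6 _⊖_

  _⊖_ : Vec ℚ n → Vec ℚ n → Vec ℚ n
  _⊖_ = Vec.zipWith _-_

  ⊖-self : ∀ (u : Vec ℚ n) → u ⊖ u ≡ 𝟎
  ⊖-self [] = refl
  ⊖-self (x ∷ u) = cong₂ _∷_ (x-x x) (⊖-self u)

  dif-⊖ : ∀ j (u v : Vec ℚ n) → dif j (u ⊖ v) ≡ dif j u - dif j v
  dif-⊖ j u v = trans (cong (dif j) (eq u v)) (trans (proj₁ (dif-lin j) u ((- 1ℚ) ⊙ v)) (trans (cong (dif j u +_) (proj₂ (dif-lin j) (- 1ℚ) v))
     (solve 2 (λ a b → a :+ con (- 1ℚ) :* b := a :- b) refl (dif j u) (dif j v))))
    where
    eq : ∀ {n} (u v : Vec ℚ n) → u ⊖ v ≡ u ⊕ (- 1ℚ) ⊙ v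
    eq [] [] = refl
    eq (x ∷ u) (y ∷ v) = cong₂ _∷_ (solve 2 (λ a b → a :- b := a :+ con (- 1ℚ) :* b) refl x y) (eq u v)

  Bd-𝟎 : ∀ {B} n → 0ℚ ≤ B → Bd B (𝟎 {n})
  Bd-𝟎 zero h = []
  Bd-𝟎 (suc n) h = h ∷ Bd-𝟎 n h

  rank : Vec Tri n → ℕ
  rank [] = 0
  rank (free ∷ c) = suc (rank c)
  rank (fix0 ∷ c) = rank c
  rank (fix1 ∷ c) = rank c

  ZeroAt : Vec Tri n → Vec ℚ n → Set
  ZeroAt = Pointwise (λ t x → t ≡ free → x ≡ 0ℚ)

  frees : Vec Tri n → List ℕ
  frees [] = []
  frees {suc n} (free ∷ c) = n ∷ frees c
  frees (fix0 ∷ c) = frees c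
  frees (fix1 ∷ c) = frees c

  frees-length : ∀ (c : Vec Tri n) → length (frees c) ≡ rank c
  frees-length [] = refl
  frees-length (free ∷ c) = cong suc (frees-length c)
  frees-length (fix0 ∷ c) = frees-length c
  frees-length (fix1 ∷ c) = frees-length c

  frees-< : ∀ (c : Vec Tri n) → LAll.All (ℕ._< n) (frees c)
  frees-< [] = []
  frees-< {suc n} (free ∷ c) = ℕP.≤-refl ∷ LAll.map ℕP.m<n⇒m<1+n (frees-< c)
  frees-< (fix0 ∷ c) = LAll.map ℕP.m<n⇒m<1+n (frees-< c)
  frees-< (fix1 ∷ c) = LAll.map ℕP.m<n⇒m<1+n (frees-< c)

  frees-desc : ∀ (c : Vec Tri n) → AP.AllPairs ℕ._>_ (frees c)
  frees-desc [] = []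
  frees-desc (free ∷ c) = frees-< c ∷ frees-desc c
  frees-desc (fix0 ∷ c) = frees-desc c
  frees-desc (fix1 ∷ c) = frees-desc c

  frees-bound : ∀ {B} (q : Vec ℚ j) (c : Vec Tri n) e → ZeroAt c e → Bd B (e ⊖ vals q n) → LAll.All (λ z → ∣ ev q (ι z) ∣ ≤ B) (frees c)
  frees-bound q [] [] [] [] = []
  frees-bound {n = suc n} {B = B} q (free ∷ c) (x ∷ e) (z ∷ zs) (b ∷ bs) = subst (_≤ B)
    (trans (cong (λ y → ∣ y - ev q (ι n) ∣) (z refl)) (trans (cong ∣_∣ (+-identityˡ _)) (∣-p∣≡∣p∣ (ev q (ι n))))) b ∷ frees-bound q c e zs bs
  frees-bound q (fix0 ∷ c) (x ∷ e) (z ∷ zs) (b ∷ bs) = frees-bound q c e zs bs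
  frees-bound q (fix1 ∷ c) (x ∷ e) (z ∷ zs) (b ∷ bs) = frees-bound q c e zs bs

  Bd-vals : ∀ {B} (q : Vec ℚ j) n → (∀ x → x ℕ.< n → ∣ ev q (ι x) ∣ ≤ B) → Bd B (vals q n)
  Bd-vals q zero h = []
  Bd-vals q (suc n) h = h n ℕP.≤-refl ∷ Bd-vals q n (λ x k → h x (ℕP.m<n⇒m<1+n k))

  Bd-split : ∀ {A B} (u v : Vec ℚ n) → Bd A (u ⊖ v) → Bd B v → Bd (A + B) u
  Bd-split [] [] [] [] = []
  Bd-split (x ∷ u) (y ∷ v) (a ∷ as) (b ∷ bs) = subst (λ z → ∣ z ∣ ≤ _) (solve 2 (λ x y → (x :- y) :+ y := x) refl x y)
    (≤-trans (∣p+q∣≤∣p∣+∣q∣ (x - y) y) (+-mono-≤ a b)) ∷ Bd-split u v as bs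

  module Difference (p : ℕ) where

    -- Only the r windows of p + 1 entries that fit into the vector are bounded; none of them
    -- reaches the continuation by zeros.
    Win : ℚ → ∀ r → Vec ℚ (r ℕ.+ p) → Set
    Win η zero e = ⊤
    Win η (suc r) (x ∷ e) = ∣ dif p (x ∷ e) ∣ ≤ η × Win η r e

    growth : ℕ → ℚ
    growth zero = 0ℚ
    growth (suc r) = growth r + (1ℚ + pow2 p * growth r)

    growth≥0 : ∀ r → 0ℚ ≤ growth r
    growth≥0 zero = ≤-refl
    growth≥0 (suc r) = 0≤+ (growth≥0 r) (0≤+ 0≤1 (0≤* (pow2≥0 p) (growth≥0 r)))

    growth-step : ∀ r → growth r ≤ growth (suc r)
    growth-step r = le-cert _ (0≤+ 0≤1 (0≤* (pow2≥0 p) (growth≥0 r))) refl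

    growth-mono : ∀ {r s} → r ℕ.≤ s → growth r ≤ growth s
    growth-mono {r} {s} h with ℕP.m≤n⇒m<n∨m≡n h
    growth-mono {r} {suc s} h | inj₁ (s≤s k) = ≤-trans (growth-mono k) (growth-step s)
    ... | inj₂ refl = ≤-refl

    -- The oldest p entries are interpolated. Since the p-th difference of the polynomial vanishes,
    -- each newer entry deviates from it by at most η plus 2ᵖ times the deviation of the older ones.
    near-poly : ∀ {η} r (e : Vec ℚ (r ℕ.+ p)) → 0ℚ ≤ η → Win η r e → Σ (Vec ℚ p) λ q → Bd (growth r * η) (e ⊖ vals q (r ℕ.+ p))
    near-poly {η} zero e h _ with interpolate e
    ... | q , refl = q , subst (Bd _) (sym (⊖-self (vals q p))) (Bd-𝟎 p (≤-reflexive (sym (*-zeroˡ η))))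
    near-poly {η} (suc r) (x ∷ e) h (w , ws) with near-poly r e h ws
    ... | q , bs = q , ≤-trans hd grow ∷ Bd-mono tlb bs
      where
      N = r ℕ.+ p
      y = ev q (ι N)
      tlb : growth r * η ≤ growth (suc r) * η
      tlb = *-monoʳ-≤-nonNeg η ⦃ nonNegative h ⦄ (growth-step r)
      d = dif p ((x - y) ∷ (e ⊖ vals q N))
      d≡ : d ≡ dif p (x ∷ e)
      d≡ = trans (dif-⊖ p (x ∷ e) (vals q (suc N))) (trans (cong (λ z → dif p (x ∷ e) - z) (dif-poly q N (ℕP.m≤n+m p r)))
         (solve 1 (λ a → a :- con 0ℚ := a) refl (dif p (x ∷ e))))
      hd : ∣ x - y ∣ ≤ η + pow2 p * (growth r * η)
      hd = subst (λ z → ∣ z ∣ ≤ _) (solve 2 (λ a b → a :- (a :- b) := b) refl d (x - y))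
        (≤-trans (∣p-q∣≤∣p∣+∣q∣ d (d - (x - y))) (+-mono-≤ (subst (λ z → ∣ z ∣ ≤ η) (sym d≡) w)
           (dif-head p (x - y) _ (0≤* (growth≥0 r) h) bs)))
      grow : η + pow2 p * (growth r * η) ≤ growth (suc r) * η
      grow = le-cert _ (0≤* (growth≥0 r) h) (solve 3 (λ η t g → (η :+ t :* (g :* η)) :+ g :* η := (g :+ (con 1ℚ :+ t :* g)) :* η) refl η (pow2 p) (growth r))

    stability : ℕ → ℚ
    stability R = growth R + rootBound (R ℕ.+ p) p * growth R

    stability≥0 : ∀ R → 0ℚ ≤ stability R
    stability≥0 R = 0≤+ (growth≥0 R) (0≤* (rootBound≥0 (R ℕ.+ p) p) (growth≥0 R))

    -- Such a sequence is close to a polynomial of degree < p with p near-zeros.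
    stable : ∀ {η} R r (e : Vec ℚ (r ℕ.+ p)) c → r ℕ.≤ R → 0ℚ ≤ η → Win η r e → ZeroAt c e → p ℕ.≤ rank c → Bd (stability R * η) e
    stable {η} R r e c hr h w z pr with near-poly r e h w
    ... | q , bs = Bd-mono (≤-reflexive (sym (trans (*-distribʳ-+ η (growth R) (rootBound M p * growth R))
              (cong (growth R * η +_) (*-assoc (rootBound M p) (growth R) η)))))
          (Bd-split e (vals q (r ℕ.+ p)) bs′ (Bd-vals q (r ℕ.+ p) λ x hx →
             root-bound M q (frees c) (0≤* (growth≥0 R) h) (frees-desc c) (LAll.map (λ k → ℕP.<-≤-trans k hM) (frees-< c))
               (frees-bound q c e z bs′) (subst (p ℕ.≤_) (sym (frees-length c)) pr) x (ℕP.<-≤-trans hx hM)))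
      where
      M = R ℕ.+ p
      hM : r ℕ.+ p ℕ.≤ M
      hM = ℕP.+-monoˡ-≤ p hr
      bs′ : Bd (growth R * η) (e ⊖ vals q (r ℕ.+ p))
      bs′ = Bd-mono (*-monoʳ-≤-nonNeg η ⦃ nonNegative h ⦄ (growth-mono hr)) bs

  -- The difference equation

  -- The maximum of s x over the signs s that the pattern entry admits.
  ab : Tri → ℚ → ℚ
  ab fix0 x = - x
  ab fix1 x = x
  ab free x = ∣ x ∣

  ∣ab∣ : ∀ t x → ∣ ab t x ∣ ≡ ∣ x ∣
  ∣ab∣ fix0 x = ∣-p∣≡∣p∣ x
  ∣ab∣ fix1 x = refl
  ∣ab∣ free x = ∣∣p∣∣≡∣p∣ x

  ab-0 : ∀ t → ab t 0ℚ ≡ 0ℚ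
  ab-0 fix0 = refl
  ab-0 fix1 = refl
  ab-0 free = refl

  ab≡0 : ∀ t x → ab t x ≡ 0ℚ → x ≡ 0ℚ
  ab≡0 t x e = ∣p∣≡0⇒p≡0 x (trans (sym (∣ab∣ t x)) (cong ∣_∣ e))

  lam : Vec Tri n → Vec ℚ n → Vec ℚ n
  lam = Vec.zipWith ab

  NoFree : Vec Tri n → Set
  NoFree = All (_≢ free)

  lam-𝟎 : ∀ (c : Vec Tri n) → lam c 𝟎 ≡ 𝟎
  lam-𝟎 [] = refl
  lam-𝟎 (t ∷ c) = cong₂ _∷_ (ab-0 t) (lam-𝟎 c)

  lam≡𝟎 : ∀ (c : Vec Tri n) w → lam c w ≡ 𝟎 → w ≡ 𝟎
  lam≡𝟎 [] [] e = refl
  lam≡𝟎 (t ∷ c) (x ∷ w) e = cong₂ _∷_ (ab≡0 t x (cong Vec.head e)) (lam≡𝟎 c w (cong Vec.tail e))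

  lam-lin : ∀ {c : Vec Tri n} → NoFree c → LinM (lam c)
  lam-lin {c = []} [] = (λ { [] [] → refl }) , (λ { t [] → refl })
  lam-lin {c = free ∷ c} (f ∷ nf) = ⊥-elim (f refl)
  lam-lin {c = fix0 ∷ c} (_ ∷ nf) =
    (λ { (x ∷ u) (y ∷ v) → cong₂ _∷_ (neg-distrib-+ x y) (proj₁ (lam-lin nf) u v) }) ,
    (λ { t (x ∷ u) → cong₂ _∷_ (neg-distribʳ-* t x) (proj₂ (lam-lin nf) t u) })
  lam-lin {c = fix1 ∷ c} (_ ∷ nf) =
    (λ { (x ∷ u) (y ∷ v) → cong (x + y ∷_) (proj₁ (lam-lin nf) u v) }) ,
    (λ { t (x ∷ u) → cong (t * x ∷_) (proj₂ (lam-lin nf) t u) })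

  norm : Vec ℚ n → ℚ
  norm [] = 0ℚ
  norm (x ∷ v) = ∣ x ∣ ⊔ norm v

  norm≥0 : ∀ (v : Vec ℚ n) → 0ℚ ≤ norm v
  norm≥0 [] = ≤-refl
  norm≥0 (x ∷ v) = ≤-trans (norm≥0 v) (p≤q⊔p ∣ x ∣ (norm v))

  Bd-norm : ∀ (v : Vec ℚ n) → Bd (norm v) v
  Bd-norm [] = []
  Bd-norm (x ∷ v) = p≤p⊔q ∣ x ∣ (norm v) ∷ Bd-mono (p≤q⊔p ∣ x ∣ (norm v)) (Bd-norm v)

  norm-least : ∀ {B} (v : Vec ℚ n) → 0ℚ ≤ B → Bd B v → norm v ≤ B
  norm-least [] h [] = h
  norm-least (x ∷ v) h (k ∷ ks) = ⊔-lub k (norm-least v h ks)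

  Bd0 : ∀ (v : Vec ℚ n) → Bd 0ℚ v → v ≡ 𝟎
  Bd0 [] [] = refl
  Bd0 (x ∷ v) (b ∷ bs) = cong₂ _∷_ (∣p∣≡0⇒p≡0 x (≤-antisym b (0≤∣p∣ x))) (Bd0 v bs)

  ⊖-𝟎 : ∀ (u : Vec ℚ n) → u ⊖ 𝟎 ≡ u
  ⊖-𝟎 [] = refl
  ⊖-𝟎 (x ∷ u) = cong₂ _∷_ (+-identityʳ x) (⊖-𝟎 u)

  rank≤ : ∀ (c : Vec Tri n) → rank c ℕ.≤ n
  rank≤ [] = z≤n
  rank≤ (free ∷ c) = s≤s (rank≤ c)
  rank≤ (fix0 ∷ c) = ℕP.m≤n⇒m≤1+n (rank≤ c)
  rank≤ (fix1 ∷ c) = ℕP.m≤n⇒m≤1+n (rank≤ c)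

  zero-full : ∀ (c : Vec Tri n) w → ZeroAt c w → n ℕ.≤ rank c → w ≡ 𝟎
  zero-full [] [] [] h = refl
  zero-full (free ∷ c) (x ∷ w) (z ∷ zs) (s≤s h) = cong₂ _∷_ (z refl) (zero-full c w zs h)
  zero-full {suc n} (fix0 ∷ c) (x ∷ w) zs h = ⊥-elim (ℕP.<⇒≱ h (rank≤ c))
  zero-full {suc n} (fix1 ∷ c) (x ∷ w) zs h = ⊥-elim (ℕP.<⇒≱ h (rank≤ c))

  ZeroAt-lam : ∀ {s c : Vec Tri n} {w} → ZeroAt c w → ZeroAt c (lam s w)
  ZeroAt-lam {s = []} {w = []} [] = []
  ZeroAt-lam {s = t ∷ s} {w = x ∷ w} (z ∷ zs) = (λ e → trans (cong (ab t) (z e)) (ab-0 t)) ∷ ZeroAt-lam zs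

  data _⊆f_ : Vec Tri n → Vec Tri n → Set where
    [] : [] ⊆f []
    _∷_ : ∀ {t u} {c d : Vec Tri n} → (t ≡ free → u ≡ free) → c ⊆f d → (t ∷ c) ⊆f (u ∷ d)

  ZeroAt-⊆ : ∀ {c d : Vec Tri n} {w} → c ⊆f d → ZeroAt d w → ZeroAt c w
  ZeroAt-⊆ [] [] = []
  ZeroAt-⊆ (h ∷ hs) (z ∷ zs) = (λ e → z (h e)) ∷ ZeroAt-⊆ hs zs

  enlarge : ∀ (c : Vec Tri n) k → rank c ℕ.≤ k → k ℕ.≤ n → Σ (Vec Tri n) λ d → (rank d ≡ k) × (c ⊆f d)
  enlarge-fixed : ∀ t (c : Vec Tri n) k → t ≢ free → rank c ℕ.≤ k → k ℕ.≤ suc n → Σ (Vec Tri (suc n)) λ d → (rank d ≡ k) × ((t ∷ c) ⊆f d)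
  enlarge [] zero h l = [] , refl , []
  enlarge (free ∷ c) (suc k) (s≤s h) (s≤s l) with enlarge c k h l
  ... | d , e , s = free ∷ d , cong suc e , (λ x → x) ∷ s
  enlarge (fix0 ∷ c) k h l = enlarge-fixed fix0 c k (λ ()) h l
  enlarge (fix1 ∷ c) k h l = enlarge-fixed fix1 c k (λ ()) h l
  enlarge-fixed {n} t c k t≢ h l with ℕP.m≤n⇒m<n∨m≡n l
  ... | inj₁ (s≤s l′) with enlarge c k h l′
  ... | d , e , s = fix1 ∷ d , e , (λ x → ⊥-elim (t≢ x)) ∷ s
  enlarge-fixed {n} t c k t≢ h l | inj₂ refl with enlarge c n (rank≤ c) ℕP.≤-refl
  ... | d , e , s = free ∷ d , cong suc e , (λ _ → refl) ∷ s

  freeAt : (c : Vec Tri n) → Fin (rank c) → Fin n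
  freeAt (free ∷ c) zero = zero
  freeAt (free ∷ c) (suc i) = suc (freeAt c i)
  freeAt (fix0 ∷ c) i = suc (freeAt c i)
  freeAt (fix1 ∷ c) i = suc (freeAt c i)

  freeAt-zero : ∀ (c : Vec Tri n) (u : Vec ℚ n) → (∀ i → lookup u (freeAt c i) ≡ 0ℚ) → ZeroAt c u
  freeAt-zero [] [] h = []
  freeAt-zero (free ∷ c) (x ∷ u) h = (λ _ → h zero) ∷ freeAt-zero c u (h ∘ suc)
  freeAt-zero (fix0 ∷ c) (x ∷ u) h = (λ ()) ∷ freeAt-zero c u h
  freeAt-zero (fix1 ∷ c) (x ∷ u) h = (λ ()) ∷ freeAt-zero c u h

  Same : Vec Tri n → Vec Tri n → Vec ℚ n → Set
  Same [] [] [] = ⊤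
  Same (t ∷ c) (u ∷ d) (x ∷ w) = (ab t x ≡ ab u x) × Same c d w

  Same-lam : ∀ (c d : Vec Tri n) w → Same c d w → lam c w ≡ lam d w
  Same-lam [] [] [] _ = refl
  Same-lam (t ∷ c) (u ∷ d) (x ∷ w) (h , hs) = cong₂ _∷_ h (Same-lam c d w hs)

  allFree : Vec Tri n
  allFree = Vec.replicate _ free

  signs : Vec Tri n → Vec Tri n
  signs [] = []
  signs (free ∷ c) = fix1 ∷ signs c
  signs (fix0 ∷ c) = fix0 ∷ signs c
  signs (fix1 ∷ c) = fix1 ∷ signs c

  signs-nofree : ∀ (c : Vec Tri n) → NoFree (signs c)
  signs-nofree [] = []
  signs-nofree (free ∷ c) = (λ ()) ∷ signs-nofree c
  signs-nofree (fix0 ∷ c) = (λ ()) ∷ signs-nofree c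
  signs-nofree (fix1 ∷ c) = (λ ()) ∷ signs-nofree c

  HasSign : Tri → ℚ → Set
  HasSign free x = x ≡ 0ℚ
  HasSign fix0 x = x < 0ℚ
  HasSign fix1 x = 0ℚ < x

  Conf : Vec Tri n → Vec ℚ n → Set
  Conf = Pointwise HasSign

  -- The polynomial approximates |w|, so both signs of w ask for a positive value. The margin 1
  -- costs nothing, since the polynomials used are products of differences of integers.
  PolySign : Tri → ℚ → Set
  PolySign free x = x ≡ 0ℚ
  PolySign fix0 x = 1ℚ ≤ x
  PolySign fix1 x = 1ℚ ≤ x

  PConf : Vec Tri n → Vec ℚ n → Set
  PConf = Pointwise PolySign

  <≤⊥ : ∀ {x y} → x < y → y ≤ x → ⊥
  <≤⊥ h k = <-irrefl refl (<-≤-trans h k)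

  2x≤1⇒x<1 : ∀ {x} → x * two ≤ 1ℚ → x < 1ℚ
  2x≤1⇒x<1 {x} h with x <? 1ℚ
  ... | yes k = k
  ... | no k = ⊥-elim (<≤⊥ (lt-cert (x - 1ℚ + x) (0≤+< (diff≥0 1≤x) (<-≤-trans 0<1 1≤x))
       (solve 1 (λ x → con 1ℚ :+ (x :- con 1ℚ :+ x) := x :* (con 1ℚ :+ con 1ℚ)) refl x)) h)
    where 1≤x = ≮⇒≥ k

  module System (p : ℕ) (κ : ℚ) where

    open Difference p public

    -- The newest entry comes first and sits at the integer position given by the length of the tail.  For the pattern
    -- allFree this is the system x = κ ∇ᵖ|w|; a pattern without free entries replaces |w| by fixed signs, making it linear.
    Sys : ∀ r → Vec Tri (suc (r ℕ.+ p)) → Vec ℚ (suc (r ℕ.+ p)) → Set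
    Sys zero c w = ⊤
    Sys (suc r) (_ ∷ c) (x ∷ w) = (x ≡ κ * dif p (lam c w)) × Sys r c w

    sol : ∀ r → Vec Tri (suc (r ℕ.+ p)) → Vec ℚ (suc p) → Vec ℚ (suc (r ℕ.+ p))
    sol zero c a = a
    sol (suc r) (_ ∷ c) a = κ * dif p (lam c (sol r c a)) ∷ sol r c a

    oldest : ∀ r → Vec ℚ (suc (r ℕ.+ p)) → Vec ℚ (suc p)
    oldest zero w = w
    oldest (suc r) (_ ∷ w) = oldest r w

    Sys-sol : ∀ r c a → Sys r c (sol r c a)
    Sys-sol zero c a = tt
    Sys-sol (suc r) (_ ∷ c) a = refl , Sys-sol r c a

    sol-oldest : ∀ r c w → Sys r c w → sol r c (oldest r w) ≡ w
    sol-oldest zero c w _ = refl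
    sol-oldest (suc r) (_ ∷ c) (x ∷ w) (e , s) rewrite sol-oldest r c w s = cong (_∷ w) (sym e)

    oldest-sol : ∀ r c a → oldest r (sol r c a) ≡ a
    oldest-sol zero c a = refl
    oldest-sol (suc r) (_ ∷ c) a = oldest-sol r c a

    oldest-𝟎 : ∀ r → oldest r 𝟎 ≡ 𝟎
    oldest-𝟎 zero = refl
    oldest-𝟎 (suc r) = oldest-𝟎 r

    sol-lin : ∀ r {s} → NoFree s → LinM (sol r s)
    sol-lin zero nf = (λ u v → refl) , (λ t u → refl)
    sol-lin (suc r) {_ ∷ s} (_ ∷ nf) =
      LinM-∷ {f = λ a → κ * dif p (lam s (sol r s a))} (LinF-* κ {λ a → dif p (lam s (sol r s a))} (LinF-∘ {φ = λ a → lam s (sol r s a)} (dif-lin p)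
        (LinM-∘ {ψ = lam s} {φ = sol r s} (lam-lin nf) (sol-lin r nf)))) (sol-lin r nf)

    -- Only the values of `lam` enter the equations. Hence a solution of the linear system with
    -- fixed signs solves the system with absolute values as soon as it has these signs; prescribed
    -- patterns are realized by solving the linear one.
    Sys-Same : ∀ r c d w → Same c d w → Sys r c w → Sys r d w
    Sys-Same zero c d w _ _ = tt
    Sys-Same (suc r) (t ∷ c) (u ∷ d) (x ∷ w) (_ , h) (e , s) =
      trans e (cong (λ v → κ * dif p v) (Same-lam c d w h)) , Sys-Same r c d w h s

  module Stable (p : ℕ) (κ ε : ℚ) (ε≥0 : 0ℚ ≤ ε) (εκ : ε * κ ≡ 1ℚ) (R : ℕ)
    (small : Difference.stability p R * ε * two ≤ 1ℚ) where

    open System p κ public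

    κε-cancel : ∀ d → ε * (κ * d) ≡ d
    κε-cancel d = trans (sym (*-assoc ε κ d)) (trans (cong (_* d) εκ) (*-identityˡ d))

    C = stability R

    εκ-bound : ∀ {x d N} → x ≡ κ * d → ∣ x ∣ ≤ N → ∣ d ∣ ≤ ε * N
    εκ-bound {d = d} {N} refl h = subst (λ z → ∣ z ∣ ≤ ε * N) (κε-cancel d)
      (≤-trans (≤-reflexive (trans (∣p*q∣≡∣p∣*∣q∣ ε (κ * d)) (cong (_* ∣ κ * d ∣) (0≤p⇒∣p∣≡p ε≥0))))
        (*-monoˡ-≤-nonNeg ε ⦃ nonNegative ε≥0 ⦄ h))

    dif-lam-vals : ∀ r s (w : Vec ℚ (suc (r ℕ.+ p))) (q : Vec ℚ p) → dif p (lam s w ⊖ vals q _) ≡ dif p (lam s w)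
    dif-lam-vals r s w q = trans (dif-⊖ p (lam s w) (vals q _))
       (trans (cong (λ z → dif p (lam s w) - z) (dif-poly q (r ℕ.+ p) (ℕP.m≤n+m p r))) (+-identityʳ _))

    Win-cons : ∀ {η r} (e : Vec ℚ (suc r ℕ.+ p)) → ∣ dif p e ∣ ≤ η → Win η r (Vec.tail e) → Win η (suc r) e
    Win-cons (_ ∷ _) h k = h , k

    win-tail : ∀ {N} r s w (q : Vec ℚ p) → Sys r s w → Bd N (lam s w) → Win (ε * N) r (Vec.tail (lam s w ⊖ vals q _))
    win-tail zero s w q _ _ = tt
    win-tail (suc r) (t ∷ s) (x ∷ w) q (e , sys) (b ∷ bs) = Win-cons (lam s w ⊖ vals q _)
      (subst (λ z → ∣ z ∣ ≤ _) (sym (dif-lam-vals r s w q)) (εκ-bound e (subst (_≤ _) (∣ab∣ t x) b))) (win-tail r s w q sys bs)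

    -- A bootstrap. The differences of the error are ε times entries of w, and these are bounded by
    -- Ω, B and the error E itself; so E ≤ Cε(Ω + B + E), and `small` absorbs the E on the right.
    close : ∀ r s w (q : Vec ℚ p) {ω Ω B} c → suc r ℕ.≤ R → Sys r s w → dif p (lam s w) ≡ ε * ω →
      ∣ ω ∣ ≤ Ω → 0ℚ ≤ B → Bd B (vals q _) → ZeroAt c (lam s w ⊖ vals q _) → p ℕ.≤ rank c →
      Bd (C * (ε * (Ω + B)) * two) (lam s w ⊖ vals q _)
    close r s w q {ω} {Ω} {B} c hr sys dω hω hB bB z pr = Bd-mono bound (Bd-norm e)
      where
      e = lam s w ⊖ vals q _
      E = norm e
      N = Ω + B + E
      0≤Ω = ≤-trans (0≤∣p∣ ω) hω
      N≥0 = 0≤+ (0≤+ 0≤Ω hB) (norm≥0 e)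
      BdN : Bd N (lam s w)
      BdN = Bd-mono (le-cert Ω 0≤Ω (solve 3 (λ Ω B E → (E :+ B) :+ Ω := Ω :+ B :+ E) refl Ω B E)) (Bd-split (lam s w) (vals q _) (Bd-norm e) bB)
      top : ∣ dif p e ∣ ≤ ε * N
      top = subst (λ z → ∣ z ∣ ≤ ε * N) (sym (trans (dif-lam-vals r s w q) dω))
        (≤-trans (≤-reflexive (trans (∣p*q∣≡∣p∣*∣q∣ ε ω) (cong (_* ∣ ω ∣) (0≤p⇒∣p∣≡p ε≥0))))
         (*-monoˡ-≤-nonNeg ε ⦃ nonNegative ε≥0 ⦄ (≤-trans hω (le-cert (B + E) (0≤+ hB (norm≥0 e)) (sym (+-assoc Ω B E))))))
      win : Win (ε * N) (suc r) e
      win = Win-cons e top (win-tail r s w q sys BdN)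
      E≤ : E ≤ C * (ε * N)
      E≤ = norm-least e (0≤* (stability≥0 R) (0≤* ε≥0 N≥0)) (stable R (suc r) e c hr (0≤* ε≥0 N≥0) win z pr)
      bound : E ≤ C * (ε * (Ω + B)) * two
      bound = le-cert _ (0≤+ (0≤* (diff≥0 E≤) 0≤two) (0≤* (diff≥0 small) (norm≥0 e)))
        (solve 6 (λ E C ε Ω B t → E :+ ((C :* (ε :* (Ω :+ B :+ E)) :- E) :* (con 1ℚ :+ con 1ℚ) :+ (con 1ℚ :- C :* ε :* (con 1ℚ :+ con 1ℚ)) :* E)
          := C :* (ε :* (Ω :+ B)) :* (con 1ℚ :+ con 1ℚ)) refl E C ε Ω B two)

    -- The estimate `close` for the zero polynomial and Ω = B = 0: an error that is small relative
    -- to itself vanishes.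
    zeros-trivial : ∀ r s w c → suc r ℕ.≤ R → Sys r s w → dif p (lam s w) ≡ 0ℚ → ZeroAt c w → p ℕ.≤ rank c → w ≡ 𝟎
    zeros-trivial r s w c hr sys d z pr = lam≡𝟎 s w (Bd0 (lam s w) (subst (λ v → Bd 0ℚ v) ee bd))
      where
      v𝟎 : vals (𝟎 {p}) (suc (r ℕ.+ p)) ≡ 𝟎
      v𝟎 = vals-zero 𝟎 _ (λ i _ → ev-𝟎 p (ι i))
      ee : lam s w ⊖ vals 𝟎 _ ≡ lam s w
      ee = trans (cong (lam s w ⊖_) v𝟎) (⊖-𝟎 _)
      bd : Bd 0ℚ (lam s w ⊖ vals 𝟎 _)
      bd = Bd-mono (≤-reflexive (solve 2 (λ C ε → C :* (ε :* (con 0ℚ :+ con 0ℚ)) :* (con 1ℚ :+ con 1ℚ) := con 0ℚ) refl C ε))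
        (close r s w 𝟎 {0ℚ} {0ℚ} {0ℚ} c hr sys (trans d (sym (*-zeroʳ ε))) ≤-refl ≤-refl
          (subst (Bd 0ℚ) (sym v𝟎) (Bd-𝟎 _ ≤-refl)) (subst (ZeroAt c) (sym ee) (ZeroAt-lam {s = s} z)) pr)

    zero-extends : ∀ r s x (w : Vec ℚ (suc (r ℕ.+ p))) → x ≡ κ * dif p (lam s w) → w ≡ 𝟎 → x ∷ w ≡ 𝟎
    zero-extends r s x w e refl = cong (_∷ 𝟎) (trans e (trans (cong (λ v → κ * dif p v) (lam-𝟎 s))
      (trans (cong (κ *_) (LinF-0 {suc (r ℕ.+ p)} {dif p} (dif-lin p))) (*-zeroʳ κ))))

    -- General position: this is why every proper face of the projected cube is a cube.
    generic : ∀ r s w c → r ℕ.≤ R → Sys r s w → ZeroAt c w → suc p ℕ.≤ rank c → w ≡ 𝟎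
    generic zero s w c hr sys z h = zero-full c w z h
    -- The newest zero says that the next difference of the older entries vanishes; with their p
    -- zeros this is the situation of `zeros-trivial`.
    generic (suc r) (t ∷ s) (x ∷ w) (free ∷ c) hr (e , sys) (zx ∷ z) (s≤s h) =
      cong₂ _∷_ (zx refl) (zeros-trivial r s w c hr sys
        (trans (sym (κε-cancel _)) (trans (cong (ε *_) (trans (sym e) (zx refl))) (*-zeroʳ ε))) z h)
    generic (suc r) (t ∷ s) (x ∷ w) (fix0 ∷ c) hr (e , sys) (_ ∷ z) h = zero-extends r s x w e (generic r s w c (ℕP.<⇒≤ hr) sys z h)
    generic (suc r) (t ∷ s) (x ∷ w) (fix1 ∷ c) hr (e , sys) (_ ∷ z) h = zero-extends r s x w e (generic r s w c (ℕP.<⇒≤ hr) sys z h)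

    -- The p + 1 initial values meet p + 1 conditions: agreement with `v` at p positions, among them
    -- the free ones of c, and the value ω that the equation would give to the next entry. The
    -- system is homogenised by an unknown `t`; if `t` were zero, `zeros-trivial` would kill the
    -- whole null vector.
    exists-solution : ∀ r s → NoFree s → suc r ℕ.≤ R → ∀ c → rank c ℕ.≤ p → (v : Vec ℚ (suc (r ℕ.+ p))) (ω : ℚ) →
      Σ (Vec ℚ (suc (r ℕ.+ p))) λ w → Sys r s w × (dif p (lam s w) ≡ ε * ω) ×
        Σ (Vec Tri (suc (r ℕ.+ p))) λ d → (rank d ≡ p) × (c ⊆f d) × ZeroAt d (lam s w ⊖ v)
    exists-solution r s nf hr c rc v ω with enlarge c p rc (ℕP.m≤n⇒m≤1+n (ℕP.m≤n+m p r))
    ... | d , rd , c⊆d = w , sys , dω , d , rd , c⊆d , freeAt-zero d (lam s w ⊖ v) (λ i →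
           trans (VecP.lookup-zipWith _-_ (freeAt d i) (lam s w) v) (trans (cong (_- lookup v (freeAt d i)) (at i)) (x-x (lookup v (freeAt d i)))))
      where
      loc : Fin p → Fin (suc (r ℕ.+ p))
      loc i = freeAt d (subst Fin (sym rd) i)
      loc′ : ∀ i → loc (subst Fin rd i) ≡ freeAt d i
      loc′ i = cong (freeAt d) (subst-sym-subst rd)
      u : Vec ℚ (suc p) → Vec ℚ (suc (r ℕ.+ p))
      u a = lam s (sol r s a)
      u-lin : LinM u
      u-lin = LinM-∘ {ψ = lam s} {φ = sol r s} (lam-lin nf) (sol-lin r nf)
      target : Fin (suc p) → ℚ
      target zero = ε * ω
      target (suc i) = lookup v (loc i)
      form : Fin (suc p) → Vec ℚ (suc p) → ℚ
      form zero a = dif p (u a)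
      form (suc i) a = lookup (u a) (loc i)
      form-lin : ∀ i → LinF (form i)
      form-lin zero = LinF-∘ {φ = u} (dif-lin p) u-lin
      form-lin (suc i) = LinF-∘ {φ = u} (LinF-lookup (loc i)) u-lin
      fs : Fin (suc p) → Vec ℚ (suc (suc p)) → ℚ
      fs i x = form i (Vec.tail x) + - target i * Vec.head x
      fs-lin : ∀ i → LinF (fs i)
      fs-lin i = LinF-+ {f = λ x → form i (Vec.tail x)} {g = λ x → - target i * Vec.head x}
        (LinF-∘ {φ = Vec.tail} (form-lin i) LinM-tail)
        (LinF-* (- target i) {Vec.head} ((λ { (_ ∷ _) (_ ∷ _) → refl }) , (λ { t (_ ∷ _) → refl })))
      nv = nullvec fs fs-lin
      t = Vec.head (proj₁ nv)
      a = Vec.tail (proj₁ nv)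
      eqs : ∀ i → form i a ≡ target i * t
      eqs i = trans (solve 3 (λ f g t → f := (f :+ (:- g) :* t) :+ g :* t) refl (form i a) (target i) t)
        (trans (cong (_+ target i * t) (proj₂ (proj₂ nv) i)) (+-identityˡ _))
      t≢0 : t ≢ 0ℚ
      t≢0 t0 = proj₁ (proj₂ nv) (head-tail-𝟎 (proj₁ nv) t0 a0)
        where
        f0 : ∀ i → form i a ≡ 0ℚ
        f0 i = trans (eqs i) (trans (cong (target i *_) t0) (*-zeroʳ (target i)))
        lamz : ∀ i → lookup (u a) (freeAt d i) ≡ 0ℚ
        lamz i = trans (cong (lookup (u a)) (sym (loc′ i))) (f0 (suc (subst Fin rd i)))
        unlam : ∀ {n} {d s : Vec Tri n} {w} → ZeroAt d (lam s w) → ZeroAt d w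
        unlam {s = []} {w = []} [] = []
        unlam {s = t ∷ s} {w = x ∷ w} (z ∷ zs) = (λ e → ab≡0 t x (z e)) ∷ unlam zs
        a0 : a ≡ 𝟎
        a0 = trans (sym (oldest-sol r s a)) (trans (cong (oldest r)
          (zeros-trivial r s (sol r s a) d hr (Sys-sol r s a) (f0 zero) (unlam {s = s} (freeAt-zero d (u a) lamz)) (ℕP.≤-reflexive (sym rd))))
          (oldest-𝟎 r))
      y = proj₁ (≢0⇒inv t t≢0)
      yt = proj₂ (≢0⇒inv t t≢0)
      w = sol r s (y ⊙ a)
      sys = Sys-sol r s (y ⊙ a)
      scale : ∀ i → form i (y ⊙ a) ≡ target i
      scale i = trans (proj₂ (form-lin i) y a) (trans (cong (y *_) (eqs i))
        (trans (solve 3 (λ y g t → y :* (g :* t) := g :* (y :* t)) refl y (target i) t)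
          (trans (cong (target i *_) yt) (*-identityʳ (target i)))))
      dω : dif p (lam s w) ≡ ε * ω
      dω = scale zero
      at : ∀ i → lookup (lam s w) (freeAt d i) ≡ lookup v (freeAt d i)
      at i = subst (λ j → lookup (lam s w) j ≡ lookup v j) (loc′ i) (scale (suc (subst Fin rd i)))

  -- Realizing sign patterns

  close-positive : ∀ {x q δ} → 1ℚ ≤ q → ∣ x - q ∣ ≤ δ → δ < 1ℚ → 0ℚ < x
  close-positive {x} {q} {δ} h k l = lt-cert _ (0≤+< (diff≥0 (≤-trans (-x≤∣x∣ (x - q)) k)) (0≤+< (diff≥0 h) (diff>0 l)))
    (solve 3 (λ x q δ → con 0ℚ :+ ((δ :- (:- (x :- q))) :+ ((q :- con 1ℚ) :+ (con 1ℚ :- δ))) := x) refl x q δ)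

  neg-of-pos : ∀ {x} → 0ℚ < - x → x < 0ℚ
  neg-of-pos {x} h = lt-cert (- x) h (+-inverseʳ x)

  -- An error below 1 cannot change the sign where the polynomial is at least 1, and at the free
  -- positions the agreement is exact. So the signs assumed in linearising are the actual ones.
  conform : ∀ {δ} (c : Vec Tri n) w v → δ < 1ℚ → PConf c v → ZeroAt c (lam (signs c) w ⊖ v) → Bd δ (lam (signs c) w ⊖ v) →
    Conf c w × Same (signs c) allFree w
  conform [] [] [] h [] [] [] = [] , tt
  conform (free ∷ c) (x ∷ w) (y ∷ v) h (refl ∷ ps) (z ∷ zs) (b ∷ bs) with trans (sym (+-identityʳ x)) (z refl)
  ... | refl = refl ∷ proj₁ ih , refl , proj₂ ih
    where ih = conform c w v h ps zs bs
  conform (fix0 ∷ c) (x ∷ w) (y ∷ v) h (p ∷ ps) (z ∷ zs) (b ∷ bs) = neg-of-pos x₊ ∷ proj₁ ih , sym (x≤0⇒∣x∣≡-x (<⇒≤ (neg-of-pos x₊))) , proj₂ ih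
    where ih = conform c w v h ps zs bs
          x₊ = close-positive p b h
  conform (fix1 ∷ c) (x ∷ w) (y ∷ v) h (p ∷ ps) (z ∷ zs) (b ∷ bs) = x₊ ∷ proj₁ ih , sym (0≤p⇒∣p∣≡p (<⇒≤ x₊)) , proj₂ ih
    where ih = conform c w v h ps zs bs
          x₊ = close-positive p b h

  Bd-lam : ∀ {B} (c : Vec Tri n) w → Bd B (lam c w) → Bd B w
  Bd-lam [] [] [] = []
  Bd-lam (t ∷ c) (x ∷ w) (b ∷ bs) = subst (_≤ _) (∣ab∣ t x) b ∷ Bd-lam c w bs

  lam-Bd : ∀ {B} (c : Vec Tri n) w → Bd B w → Bd B (lam c w)
  lam-Bd [] [] [] = []
  lam-Bd (t ∷ c) (x ∷ w) (b ∷ bs) = subst (_≤ _) (sym (∣ab∣ t x)) b ∷ lam-Bd c w bs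

  pow2*θ : ∀ {θ} j → θ * (two * pow2 j) ≡ 1ℚ → ∀ x → pow2 j * (θ * x) * two ≡ x
  pow2*θ {θ} j e x = trans (solve 3 (λ g θ x → g :* (θ :* x) :* (con 1ℚ :+ con 1ℚ) := θ :* ((con 1ℚ :+ con 1ℚ) :* g) :* x) refl (pow2 j) θ x)
    (trans (cong (_* x) e) (*-identityˡ x))

  pos-sign : ∀ {θ y} → 0ℚ ≤ θ → 0ℚ < θ * y → 0ℚ < y
  pos-sign {θ} {y} hθ h with 0ℚ <? y
  ... | yes k = k
  ... | no k = ⊥-elim (<≤⊥ h (le-cert _ (0≤* hθ (neg≥0 (≮⇒≥ k))) (solve 2 (λ e k → e :* k :+ e :* (:- k) := con 0ℚ) refl θ y)))

  θ*≤ : ∀ {θ x g} → 0ℚ ≤ θ → 0ℚ ≤ x → 1ℚ ≤ g → θ * (two * g) ≡ 1ℚ → θ * x ≤ x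
  θ*≤ {θ} {x} {g} hθ hx hg e = le-cert _ (0≤* (0≤* hθ (0≤+ (diff≥0 hg) (≤-trans 0≤1 hg))) hx)
    (trans (solve 3 (λ θ g x → θ :* x :+ θ :* (g :- con 1ℚ :+ g) :* x := θ :* ((con 1ℚ :+ con 1ℚ) :* g) :* x) refl θ g x)
      (trans (cong (_* x) e) (*-identityˡ x)))

  2x≤2y : ∀ {x y} → x + x ≤ y + y → x ≤ y
  2x≤2y {x} {y} h with x ≤? y
  ... | yes k = k
  ... | no k = ⊥-elim (<≤⊥ (+-mono-< (≰⇒> k) (≰⇒> k)) h)

  neg-window : ∀ d Q e → ∣ d - (0ℚ - Q) ∣ ≤ e → 1ℚ ≤ Q → e * two ≤ 1ℚ → 1ℚ ≤ - d * two
  neg-window d Q e dh hq he = le-cert _ (0≤+ (0≤* (0≤+ (diff≥0 (≤-trans (x≤∣x∣ _) dh)) (diff≥0 hq)) 0≤two) (diff≥0 he))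
    (solve 3 (λ d Q e → con 1ℚ :+ (((e :- (d :- (con 0ℚ :- Q))) :+ (Q :- con 1ℚ)) :* (con 1ℚ :+ con 1ℚ) :+ (con 1ℚ :- e :* (con 1ℚ :+ con 1ℚ))) := (:- d) :* (con 1ℚ :+ con 1ℚ)) refl d Q e)

  neg-2κ : ∀ {κ d} → 0ℚ ≤ κ → 1ℚ ≤ - d * two → κ ≤ - (κ * d) * two
  neg-2κ {κ} {d} hκ h = le-cert _ (0≤* hκ (diff≥0 h)) (solve 2 (λ k d → k :+ k :* ((:- d) :* (con 1ℚ :+ con 1ℚ) :- con 1ℚ) := (:- (k :* d)) :* (con 1ℚ :+ con 1ℚ)) refl κ d)

  neg-large : ∀ {B θ κ d} → 0ℚ ≤ B → 0ℚ ≤ θ → 0ℚ ≤ κ → (B + 1ℚ) * two ≤ θ * κ → 1ℚ ≤ - d * two → B + 1ℚ ≤ θ * ∣ κ * d ∣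
  neg-large {B} {θ} {κ} {d} hB hθ hκ h k = ≤-trans (2x≤2y (subst₂ _≤_
      (solve 1 (λ b → b :* (con 1ℚ :+ con 1ℚ) := b :+ b) refl (B + 1ℚ))
      (solve 2 (λ θ x → θ :* ((:- x) :* (con 1ℚ :+ con 1ℚ)) := θ :* (:- x) :+ θ :* (:- x)) refl θ (κ * d))
      (≤-trans h (*-monoˡ-≤-nonNeg θ ⦃ nonNegative hθ ⦄ (neg-2κ hκ k)))))
    (*-monoˡ-≤-nonNeg θ ⦃ nonNegative hθ ⦄ (-x≤∣x∣ (κ * d)))

  inverse>0 : ∀ {ε κ} → 0ℚ ≤ ε → ε * κ ≡ 1ℚ → 0ℚ < κ
  inverse>0 hε e = pos-sign hε (subst (0ℚ <_) (sym e) 0<1)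

  neg-sign : ∀ {ε κ d} → 0ℚ ≤ ε → 0ℚ ≤ κ → ε * κ ≡ 1ℚ → 1ℚ ≤ - d * two → κ * d < 0ℚ
  neg-sign {ε} {κ} {d} hε hκ e h = neg-of-pos (pos-sign 0≤two (subst (0ℚ <_) (*-comm (- (κ * d)) two) (<-≤-trans (inverse>0 hε e) (neg-2κ hκ h))))

  pos-window : ∀ d X y g → ∣ d - X ∣ ≤ g * y → g * y * two ≡ X → X ≤ d * two
  pos-window d X y g dh e = le-cert _ (0≤+ (0≤* (diff≥0 (≤-trans (-x≤∣x∣ _) dh)) 0≤two) (diff≥0 (≤-reflexive e)))
    (solve 3 (λ d X e → X :+ ((e :- (:- (d :- X))) :* (con 1ℚ :+ con 1ℚ) :+ (X :- e :* (con 1ℚ :+ con 1ℚ))) := d :* (con 1ℚ :+ con 1ℚ)) refl d X (g * y))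

  pos-large : ∀ {B θ κ d X} → 0ℚ ≤ B → 0ℚ ≤ X → (B + 1ℚ) * two ≤ θ * κ → X ≤ d * two → X ≤ θ * (κ * d)
  pos-large {B} {θ} {κ} {d} {X} hB hX h k = ≤-trans k
    (le-cert _ (0≤* (0≤+ (diff≥0 h) (0≤* hB 0≤two)) (pos-sign′ d (≤-trans hX k)))
      (solve 4 (λ B θ k d → d :* (con 1ℚ :+ con 1ℚ) :+ (θ :* k :- (B :+ con 1ℚ) :* (con 1ℚ :+ con 1ℚ) :+ B :* (con 1ℚ :+ con 1ℚ)) :* d := θ :* (k :* d)) refl B θ κ d))
    where
    pos-sign′ : ∀ d → 0ℚ ≤ d * two → 0ℚ ≤ d
    pos-sign′ d h = 2x≤2y (subst (0ℚ ≤_) (solve 1 (λ d → d :* (con 1ℚ :+ con 1ℚ) := d :+ d) refl d) h)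

  module Realize (p : ℕ) (κ ε : ℚ) (ε≥0 : 0ℚ ≤ ε) (εκ : ε * κ ≡ 1ℚ) (R : ℕ)
    (small : Difference.stability p R * ε * two ≤ 1ℚ)
    (B θ : ℚ) (B≥0 : 0ℚ ≤ B) (θ≥0 : 0ℚ ≤ θ) (θ2 : θ * (two * pow2 p) ≡ 1ℚ) where

    Θ : ℚ
    Θ = two * pow2 p

    -- Large enough for a next entry of size Ω to outweigh all older ones: θ Ω = B + 1, and entries
    -- close to the polynomial are at most B + 1.
    Ω : ℚ
    Ω = Θ * (B + 1ℚ)

    δ : ℚ
    δ = Difference.stability p R * (ε * (Ω + B)) * two

    Ω≥0 : 0ℚ ≤ Ω
    Ω≥0 = 0≤* (0≤* 0≤two (pow2≥0 p)) (0≤+ B≥0 0≤1)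

    θΩ : θ * Ω ≡ B + 1ℚ
    θΩ = trans (sym (*-assoc θ Θ (B + 1ℚ))) (trans (cong (_* (B + 1ℚ)) θ2) (*-identityˡ (B + 1ℚ)))

    module Bounds (hδ : pow2 p * δ * two ≤ 1ℚ) (hκ : (B + 1ℚ) * two ≤ θ * κ) where

      open Stable p κ ε ε≥0 εκ R small public

      δ≥0 : 0ℚ ≤ δ
      δ≥0 = 0≤* (0≤* (stability≥0 R) (0≤* ε≥0 (0≤+ Ω≥0 B≥0))) 0≤two

      δ<1 : δ < 1ℚ
      δ<1 = ≤-<-trans (le-cert _ (0≤* (diff≥0 (pow2≥1 p)) δ≥0) (solve 2 (λ g d → d :+ (g :- con 1ℚ) :* d := g :* d) refl (pow2 p) δ))
        (2x≤1⇒x<1 hδ)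

      κ≥0 : 0ℚ ≤ κ
      κ≥0 = <⇒≤ (inverse>0 ε≥0 εκ)

      Real : ∀ r → Vec Tri (suc (r ℕ.+ p)) → Set
      Real r c = Σ (Vec ℚ (suc (r ℕ.+ p))) λ w → Sys r allFree w × Conf c w

      -- The newest entry outweighs every older one by the factor 1/θ = 2^(p+1). The older entries
      -- then change the next p-th difference of absolute values by at most half of the newest one.
      Dom : ∀ r → Vec Tri (suc (r ℕ.+ p)) → Set
      Dom r c = Σ ℚ λ x → Σ (Vec ℚ (r ℕ.+ p)) λ w → Sys r allFree (x ∷ w) × Conf c (x ∷ w) × Bd (θ * ∣ x ∣) w

      Dom⇒Real : ∀ {r c} → Dom r c → Real r c
      Dom⇒Real (x , w , s , cf , _) = x ∷ w , s , cf

      Poly : Vec Tri n → Set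
      Poly {n} c = Σ (Vec ℚ p) λ q → PConf c (vals q n) × Bd B (vals q n)

      -- The linear solution that meets the polynomial at p positions, including its prescribed
      -- zeros, stays close to it everywhere and so has the assumed signs. The next entry ω is still
      -- at choice.
      near : ∀ r (c : Vec Tri (suc (r ℕ.+ p))) → suc r ℕ.≤ R → rank c ℕ.≤ p → (po : Poly c) → ∀ ω → ∣ ω ∣ ≤ Ω →
        Σ (Vec ℚ (suc (r ℕ.+ p))) λ w → Sys r allFree w × Conf c w × (dif p (lam allFree w) ≡ ε * ω) ×
          Bd δ (lam allFree w ⊖ vals (proj₁ po) _)
      near r c hr rc (q , pc , bq) ω hω = w , Sys-Same r (signs c) allFree w same sys , proj₁ cf ,
          subst (λ v → dif p v ≡ ε * ω) le dω , subst (λ v → Bd δ (v ⊖ vals q _)) le bd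
        where
        sl = exists-solution r (signs c) (signs-nofree c) hr c rc (vals q _) ω
        w = proj₁ sl
        sys = proj₁ (proj₂ sl)
        dω = proj₁ (proj₂ (proj₂ sl))
        d = proj₁ (proj₂ (proj₂ (proj₂ sl)))
        rd = proj₁ (proj₂ (proj₂ (proj₂ (proj₂ sl))))
        c⊆d = proj₁ (proj₂ (proj₂ (proj₂ (proj₂ (proj₂ sl)))))
        z = proj₂ (proj₂ (proj₂ (proj₂ (proj₂ (proj₂ sl)))))
        bd : Bd δ (lam (signs c) w ⊖ vals q _)
        bd = close r (signs c) w q d hr sys dω hω B≥0 bq z (ℕP.≤-reflexive (sym rd))
        cf : Conf c w × Same (signs c) allFree w
        cf = conform c w (vals q _) δ<1 pc (ZeroAt-⊆ c⊆d z) bd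
        same : Same (signs c) allFree w
        same = proj₂ cf
        le : lam (signs c) w ≡ lam allFree w
        le = Same-lam (signs c) allFree w same

      near-bound : ∀ {v : Vec ℚ n} {w} → Bd B v → Bd δ (lam allFree w ⊖ v) → Bd (B + 1ℚ) w
      near-bound {v = v} {w} b d = Bd-lam allFree w (Bd-mono (≤-reflexive (+-comm 1ℚ B)) (Bd-split (lam allFree w) v (Bd-mono (<⇒≤ δ<1) d) b))

      real-free : ∀ r c → suc r ℕ.≤ R → rank c ℕ.≤ p → (po : Poly c) →
        Σ (Vec ℚ (suc (r ℕ.+ p))) λ w → Sys (suc r) allFree (0ℚ ∷ w) × Conf (free ∷ c) (0ℚ ∷ w) × Bd δ (lam allFree w ⊖ vals (proj₁ po) _)
      real-free r c hr rc po = let w , sys , cf , d , bd = near r c hr rc po 0ℚ Ω≥0 in w , (sym (trans (cong (κ *_) (trans d (*-zeroʳ ε))) (*-zeroʳ κ)) , sys) , refl ∷ cf , bd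

      head-conf : ∀ t → t ≢ free → Σ ℚ λ ω → HasSign t ω × (∣ ω ∣ ≡ Ω)
      head-conf free h = ⊥-elim (h refl)
      head-conf fix1 h = Ω , 0<Ω , 0≤p⇒∣p∣≡p Ω≥0
        where 0<Ω = 0<* (0<* (0<+≤ 0<1 0≤1) (<-≤-trans 0<1 (pow2≥1 p))) (0≤+< B≥0 0<1)
      head-conf fix0 h = let ω , s , e = head-conf fix1 (λ ()) in - ω , subst (_< 0ℚ) (+-identityˡ (- ω)) (lt-cert ω s (solve 1 (λ x → (con 0ℚ :- x) :+ x := con 0ℚ) refl ω)) , trans (∣-p∣≡∣p∣ ω) e

      dom-fixed : ∀ r t c → t ≢ free → suc r ℕ.≤ R → rank c ℕ.≤ p → Poly c → Dom (suc r) (t ∷ c)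
      dom-fixed r t c t≢ hr rc po = let ω , s , e = head-conf t t≢
                                        w , sys , cf , d , bd = near r c hr rc po ω (≤-reflexive e) in ω , w , (sym (trans (cong (κ *_) d) (trans (sym (*-assoc κ ε ω)) (trans (cong (_* ω) (trans (*-comm κ ε) εκ)) (*-identityˡ ω)))) , sys) ,
          s ∷ cf , Bd-mono (≤-reflexive (trans (sym θΩ) (cong (θ *_) (sym e)))) (near-bound (proj₂ (proj₂ po)) bd)

      -- A zero on top breaks off the polynomial: continuing with Q = q(top) would make the p-th
      -- difference nearly 0, so the entry 0 makes it nearly -Q ≤ -1. Multiplied by κ it gives a
      -- negative entry that outweighs everything older.
      dom-neg : ∀ r c → suc r ℕ.≤ R → rank c ℕ.≤ p → (po : Poly c) → 1ℚ ≤ ev (proj₁ po) (ι (suc (r ℕ.+ p))) → Dom (suc (suc r)) (fix0 ∷ free ∷ c)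
      dom-neg r c hr rc po hq = x , 0ℚ ∷ w , (refl , sys) , x<0 ∷ cf , Bd-mono big (≤-trans ≤0 (≤-reflexive refl) ∷ near-bound (proj₂ (proj₂ po)) bd)
        where
        rf = real-free r c hr rc po
        w = proj₁ rf
        sys = proj₁ (proj₂ rf)
        cf = proj₁ (proj₂ (proj₂ rf))
        bd = proj₂ (proj₂ (proj₂ rf))
        q = proj₁ po
        u = lam allFree w
        Q = ev q (ι (suc (r ℕ.+ p)))
        d = dif p (0ℚ ∷ u)
        x = κ * d
        ≤0 : ∣ 0ℚ ∣ ≤ B + 1ℚ
        ≤0 = 0≤+ B≥0 0≤1
        d≡ : dif p ((0ℚ - Q) ∷ (u ⊖ vals q _)) ≡ d
        d≡ = trans (dif-⊖ p (0ℚ ∷ u) (vals q _)) (trans (cong (λ z → d - z) (dif-poly q (suc (r ℕ.+ p)) (ℕP.m≤n⇒m≤1+n (ℕP.m≤n+m p r)))) (+-identityʳ d))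
        dh : ∣ d - (0ℚ - Q) ∣ ≤ pow2 p * δ
        dh = subst (λ z → ∣ z - (0ℚ - Q) ∣ ≤ pow2 p * δ) d≡ (dif-head p (0ℚ - Q) (u ⊖ vals q _) δ≥0 bd)
        2d : 1ℚ ≤ - d * two
        2d = neg-window d Q (pow2 p * δ) dh hq hδ
        big : B + 1ℚ ≤ θ * ∣ x ∣
        big = neg-large {B} {θ} {κ} {d} B≥0 θ≥0 κ≥0 hκ 2d
        x<0 : x < 0ℚ
        x<0 = neg-sign {ε} {κ} {d} ε≥0 κ≥0 εκ 2d

      -- Whatever its sign, a dominating entry x makes the next difference at least |x|/2, because
      -- it enters with coefficient 1 as |x|. The next entry is κ times this, hence positive and
      -- dominating again.
      dom-pos : ∀ r t c → t ≢ free → Dom r (t ∷ c) → Dom (suc r) (fix1 ∷ t ∷ c)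
      dom-pos r t c t≢ (x , w , sys , (hx ∷ cf) , bd) = y , x ∷ w , (refl , sys) , 0<y ∷ hx ∷ cf , (dom-x ∷ Bd-mono dom-w bd)
        where
        u = lam allFree w
        d = dif p (∣ x ∣ ∷ u)
        y = κ * d
        0<∣x∣ : 0ℚ < ∣ x ∣
        0<∣x∣ = go t t≢ hx
          where
          go : ∀ t → t ≢ free → HasSign t x → 0ℚ < ∣ x ∣
          go free h _ = ⊥-elim (h refl)
          go fix1 h k = <-≤-trans k (x≤∣x∣ x)
          go fix0 h k = <-≤-trans (neg>0 k) (-x≤∣x∣ x)
        X = ∣ x ∣
        X≥0 = <⇒≤ 0<∣x∣
        d≥X : X ≤ d * two
        d≥X = pos-window d X (θ * X) (pow2 p) (dif-head p X u (0≤* θ≥0 X≥0) (lam-Bd allFree w bd)) (pow2*θ {θ} p θ2 X)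
        dom-y : X ≤ θ * y
        dom-y = pos-large {B} {θ} {κ} {d} B≥0 X≥0 hκ d≥X
        0<y : 0ℚ < y
        0<y = pos-sign {θ} {y} θ≥0 (<-≤-trans 0<∣x∣ dom-y)
        dom-x : X ≤ θ * ∣ y ∣
        dom-x = ≤-trans dom-y (*-monoˡ-≤-nonNeg θ ⦃ nonNegative θ≥0 ⦄ (x≤∣x∣ y))
        dom-w : θ * X ≤ θ * ∣ y ∣
        dom-w = ≤-trans (θ*≤ {θ} {X} {pow2 p} θ≥0 X≥0 (pow2≥1 p) θ2) dom-x

  -- Zero patterns of nonnegative polynomials

  abstract
    -- Abstract, since the lists are far too long to be unfolded; they are handled through
    -- membership, uniqueness and length.
    cons3 : (A B C : List (Vec Tri n)) → List (Vec Tri (suc n))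
    cons3 A B C = map (fix0 ∷_) A ++ map (fix1 ∷_) B ++ map (free ∷_) C

    cons3-length : ∀ (A B C : List (Vec Tri n)) → length (cons3 A B C) ≡ length A ℕ.+ (length B ℕ.+ length C)
    cons3-length A B C = trans (ListP.length-++ (map (fix0 ∷_) A)) (cong₂ ℕ._+_ (ListP.length-map _ A)
      (trans (ListP.length-++ (map (fix1 ∷_) B)) (cong₂ ℕ._+_ (ListP.length-map _ B) (ListP.length-map _ C))))

    cons3-all : ∀ (P : Vec Tri (suc n) → Set) {A B C} → (∀ {c} → c ∈ˡ A → P (fix0 ∷ c)) → (∀ {c} → c ∈ˡ B → P (fix1 ∷ c)) →
      (∀ {c} → c ∈ˡ C → P (free ∷ c)) → ∀ {c} → c ∈ˡ cons3 A B C → P c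
    cons3-all P {A} {B} f g h c∈ with Mem.∈-++⁻ (map (fix0 ∷_) A) c∈
    ... | inj₁ x with Mem.∈-map⁻ _ x
    ... | _ , y , refl = f y
    cons3-all P {A} {B} f g h c∈ | inj₂ x with Mem.∈-++⁻ (map (fix1 ∷_) B) x
    ... | inj₁ y with Mem.∈-map⁻ _ y
    ... | _ , z , refl = g z
    cons3-all P {A} {B} f g h c∈ | inj₂ x | inj₂ y with Mem.∈-map⁻ _ y
    ... | _ , z , refl = h z

    cons3-unique : ∀ {A B C : List (Vec Tri n)} → Unique A → Unique B → Unique C → Unique (cons3 A B C)
    cons3-unique {A = A} {B} {C} uA uB uC = Uniq.++⁺ (Uniq.map⁺ VecP.∷-injectiveʳ uA)
        (Uniq.++⁺ (Uniq.map⁺ VecP.∷-injectiveʳ uB) (Uniq.map⁺ VecP.∷-injectiveʳ uC) (λ { (x , y) → d₂ x y })) (λ { (x , y) → d₁ x y })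
      where
      d₂ : ∀ {v} → v ∈ˡ map (fix1 ∷_) B → v ∈ˡ map (free ∷_) C → ⊥
      d₂ x y with Mem.∈-map⁻ _ x
      ... | _ , _ , refl with Mem.∈-map⁻ _ y
      ... | _ , _ , ()
      d₁ : ∀ {v} → v ∈ˡ map (fix0 ∷_) A → v ∈ˡ map (fix1 ∷_) B ++ map (free ∷_) C → ⊥
      d₁ x y with Mem.∈-map⁻ _ x
      ... | _ , _ , refl with Mem.∈-++⁻ (map (fix1 ∷_) B) y
      ... | inj₁ z with Mem.∈-map⁻ _ z
      ... | _ , _ , ()
      d₁ x y | _ , _ , refl | inj₂ z with Mem.∈-map⁻ _ z
      ... | _ , _ , ()

    ∈-cons3₀ : ∀ {A B C : List (Vec Tri n)} {c} → c ∈ˡ A → (fix0 ∷ c) ∈ˡ cons3 A B C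
    ∈-cons3₀ h = Mem.∈-++⁺ˡ (Mem.∈-map⁺ _ h)

    ∈-cons3₁ : ∀ {A B C : List (Vec Tri n)} {c} → c ∈ˡ B → (fix1 ∷ c) ∈ˡ cons3 A B C
    ∈-cons3₁ {A = A} h = Mem.∈-++⁺ʳ (map (fix0 ∷_) A) (Mem.∈-++⁺ˡ (Mem.∈-map⁺ _ h))

    ∈-cons3₂ : ∀ {A B C : List (Vec Tri n)} {c} → c ∈ˡ C → (free ∷ c) ∈ˡ cons3 A B C
    ∈-cons3₂ {A = A} {B} h = Mem.∈-++⁺ʳ (map (fix0 ∷_) A) (Mem.∈-++⁺ʳ (map (fix1 ∷_) B) (Mem.∈-map⁺ _ h))

  nil : ℕ → List (Vec Tri 0)
  nil zero = [] ∷ []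
  nil (suc _) = []

  nil-unique : ∀ z → Unique (nil z)
  nil-unique zero = [] ∷ []
  nil-unique (suc _) = []

  ranked : ℕ → ∀ n → List (Vec Tri n)
  ranked k zero = nil k
  ranked zero (suc n) = cons3 (ranked zero n) (ranked zero n) []
  ranked (suc k) (suc n) = cons3 (ranked (suc k) n) (ranked (suc k) n) (ranked k n)

  ranked-unique : ∀ k n → Unique (ranked k n)
  ranked-unique k zero = nil-unique k
  ranked-unique zero (suc n) = cons3-unique (ranked-unique zero n) (ranked-unique zero n) []
  ranked-unique (suc k) (suc n) = cons3-unique (ranked-unique (suc k) n) (ranked-unique (suc k) n) (ranked-unique k n)

  ranked-rank : ∀ k n {c} → c ∈ˡ ranked k n → rank c ≡ k
  ranked-rank zero zero (here refl) = refl
  ranked-rank zero (suc n) = cons3-all (λ c → rank c ≡ zero) (ranked-rank zero n) (ranked-rank zero n) λ ()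
  ranked-rank (suc k) (suc n) = cons3-all (λ c → rank c ≡ (suc k)) (ranked-rank (suc k) n) (ranked-rank (suc k) n) (cong suc ∘ ranked-rank k n)

  ∈-ranked : ∀ {n} (c : Vec Tri n) → c ∈ˡ ranked (rank c) n
  ∈-ranked [] = here refl
  ∈-ranked (free ∷ c) = ∈-cons3₂ {A = ranked (suc (rank c)) _} {ranked (suc (rank c)) _} (∈-ranked c)
  ∈-ranked (fix0 ∷ c) with rank c | ∈-ranked c
  ... | zero | h = ∈-cons3₀ h
  ... | suc k | h = ∈-cons3₀ h
  ∈-ranked (fix1 ∷ c) with rank c | ∈-ranked c
  ... | zero | h = ∈-cons3₁ {A = ranked 0 _} h
  ... | suc k | h = ∈-cons3₁ {A = ranked (suc k) _} h

  -- Sign patterns whose free positions form the zero set of a nonnegative polynomial, read from the top position down: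
  -- z zeros remain, of which at most s may be completed to double zeros; in odd the last zero read is unpaired,
  -- and in start the zeros adjacent to the top need no pairing.
  even odd start : (s z n : ℕ) → List (Vec Tri n)
  even s z zero = nil z
  even s zero (suc n) = cons3 (even s zero n) (even s zero n) []
  even s (suc z) (suc n) = cons3 (even s (suc z) n) (even s (suc z) n) (odd s z n)
  odd s z zero = nil z
  odd zero zero (suc n) = []
  odd (suc s) zero (suc n) = cons3 (even s zero n) (even s zero n) []
  odd zero (suc z) (suc n) = cons3 [] [] (even zero z n)
  odd (suc s) (suc z) (suc n) = cons3 (even s (suc z) n) (even s (suc z) n) (even (suc s) z n)
  start s z zero = nil z
  start s zero (suc n) = cons3 (even s zero n) (even s zero n) []
  start s (suc z) (suc n) = cons3 (even s (suc z) n) (even s (suc z) n) (start s z n)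

  even-unique : ∀ s z n → Unique (even s z n)
  odd-unique : ∀ s z n → Unique (odd s z n)
  start-unique : ∀ s z n → Unique (start s z n)
  even-unique s z zero = nil-unique z
  even-unique s zero (suc n) = cons3-unique (even-unique s zero n) (even-unique s zero n) []
  even-unique s (suc z) (suc n) = cons3-unique (even-unique s (suc z) n) (even-unique s (suc z) n) (odd-unique s z n)
  odd-unique s z zero = nil-unique z
  odd-unique zero zero (suc n) = []
  odd-unique (suc s) zero (suc n) = cons3-unique (even-unique s zero n) (even-unique s zero n) []
  odd-unique zero (suc z) (suc n) = cons3-unique [] [] (even-unique zero z n)
  odd-unique (suc s) (suc z) (suc n) = cons3-unique (even-unique s (suc z) n) (even-unique s (suc z) n) (even-unique (suc s) z n)
  start-unique s z zero = nil-unique z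
  start-unique s zero (suc n) = cons3-unique (even-unique s zero n) (even-unique s zero n) []
  start-unique s (suc z) (suc n) = cons3-unique (even-unique s (suc z) n) (even-unique s (suc z) n) (start-unique s z n)

  -- Nonnegative polynomials as products of linear factors

  data Factor : Set where
    plus minus : ℕ → Factor

  root : Factor → ℕ
  root (plus z) = z
  root (minus z) = z

  evF : Factor → ℕ → ℚ
  evF (plus z) x = ι x - ι z
  evF (minus z) x = ι z - ι x

  evL : List Factor → ℕ → ℚ
  evL [] x = 1ℚ
  evL (f ∷ L) x = evF f x * evL L x

  valsL : List Factor → ∀ n → Vec ℚ n
  valsL L zero = []
  valsL L (suc n) = evL L n ∷ valsL L n

  1≤* : ∀ {x y} → 1ℚ ≤ x → 1ℚ ≤ y → 1ℚ ≤ x * y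
  1≤* hx hy = *-mono-≤ {1ℚ} {_} {1ℚ} 0≤1 (≤-trans 0≤1 hy) hx hy

  1≤*ˡ : ∀ {x y z} → 1ℚ ≤ x * y → 1ℚ ≤ z → 1ℚ ≤ x * (y * z)
  1≤*ˡ {x} {y} {z} h k = subst (1ℚ ≤_) (*-assoc x y z) (1≤* h k)

  square≥1 : ∀ {x z} → x ℕ.< z ⊎ z ℕ.< x → 1ℚ ≤ evF (plus z) x * evF (plus z) x
  square≥1 {x} {z} (inj₂ h) = 1≤* (ι-gap h) (ι-gap h)
  square≥1 {x} {z} (inj₁ h) = subst (1ℚ ≤_) (solve 2 (λ a b → (b :- a) :* (b :- a) := (a :- b) :* (a :- b)) refl (ι x) (ι z)) (1≤* (ι-gap h) (ι-gap h))

  pair≥1 : ∀ {x z} → x ℕ.< z → 1ℚ ≤ evF (plus z) x * evF (plus (suc z)) x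
  pair≥1 {x} {z} h = subst (1ℚ ≤_) (solve 3 (λ a b c → (b :- a) :* (c :- a) := (a :- b) :* (a :- c)) refl (ι x) (ι z) (ι (suc z)))
    (1≤* (ι-gap h) (ι-gap (ℕP.m<n⇒m<1+n h)))

  Witness : Vec Tri n → ℕ → Set
  Witness {n} c d = Σ (List Factor) λ L → length L ℕ.≤ d × PConf c (valsL L n) × LAll.All (λ f → root f ℕ.≤ n) L

  Positive≥ : ∀ {c : Vec Tri n} {d} → Witness c d → ℕ → Set
  Positive≥ (L , _) b = ∀ x → b ℕ.≤ x → 1ℚ ≤ evL L x

  PConf-map : ∀ {n} (c : Vec Tri n) L L′ → (∀ x → x ℕ.< n → evL L x ≡ 0ℚ → evL L′ x ≡ 0ℚ) → (∀ x → x ℕ.< n → 1ℚ ≤ evL L x → 1ℚ ≤ evL L′ x) →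
    PConf c (valsL L n) → PConf c (valsL L′ n)
  PConf-map [] L L′ f g [] = []
  PConf-map {suc n} (free ∷ c) L L′ f g (p ∷ ps) = f n ℕP.≤-refl p ∷ PConf-map c L L′ (λ x h → f x (ℕP.m<n⇒m<1+n h)) (λ x h → g x (ℕP.m<n⇒m<1+n h)) ps
  PConf-map {suc n} (fix0 ∷ c) L L′ f g (p ∷ ps) = g n ℕP.≤-refl p ∷ PConf-map c L L′ (λ x h → f x (ℕP.m<n⇒m<1+n h)) (λ x h → g x (ℕP.m<n⇒m<1+n h)) ps
  PConf-map {suc n} (fix1 ∷ c) L L′ f g (p ∷ ps) = g n ℕP.≤-refl p ∷ PConf-map c L L′ (λ x h → f x (ℕP.m<n⇒m<1+n h)) (λ x h → g x (ℕP.m<n⇒m<1+n h)) ps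

  PConf-scale : ∀ {n} (c : Vec Tri n) f L → (∀ x → x ℕ.< n → 1ℚ ≤ evF f x) → PConf c (valsL L n) → PConf c (valsL (f ∷ L) n)
  PConf-scale c f L h = PConf-map c L (f ∷ L) (λ x _ e → trans (cong (evF f x *_) e) (*-zeroʳ (evF f x))) (λ x k l → 1≤* (h x k) l)

  PConf-scale2 : ∀ {n} (c : Vec Tri n) f g L → (∀ x → x ℕ.< n → 1ℚ ≤ evF f x * evF g x) → PConf c (valsL L n) → PConf c (valsL (f ∷ g ∷ L) n)
  PConf-scale2 c f g L h = PConf-map c L (f ∷ g ∷ L)
    (λ x _ e → trans (cong (λ y → evF f x * (evF g x * y)) e) (solve 2 (λ a b → a :* (b :* con 0ℚ) := con 0ℚ) refl (evF f x) (evF g x)))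
    (λ x k l → 1≤*ˡ {evF f x} {evF g x} (h x k) l)

  root-plus : ∀ n L → evL (plus n ∷ L) n ≡ 0ℚ
  root-plus n L = trans (cong (_* evL L n) (x-x (ι n))) (*-zeroˡ (evL L n))

  root-minus : ∀ n L → evL (minus n ∷ L) n ≡ 0ℚ
  root-minus n L = trans (cong (_* evL L n) (x-x (ι n))) (*-zeroˡ (evL L n))

  weaken-roots : ∀ {n L} → LAll.All (λ f → root f ℕ.≤ n) L → LAll.All (λ f → root f ℕ.≤ suc n) L
  weaken-roots = LAll.map ℕP.m≤n⇒m≤1+n

  fixed-cons : ∀ t {c : Vec Tri n} {d} → t ≢ free → (w : Witness c d) → Positive≥ w n → Σ (Witness (t ∷ c) d) λ w′ → Positive≥ w′ (suc n)
  fixed-cons free t≢ w P = ⊥-elim (t≢ refl)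
  fixed-cons {n} fix0 t≢ (L , l , pc , r) P = (L , l , P n ℕP.≤-refl ∷ pc , weaken-roots r) , λ x h → P x (ℕP.<⇒≤ h)
  fixed-cons {n} fix1 t≢ (L , l , pc , r) P = (L , l , P n ℕP.≤-refl ∷ pc , weaken-roots r) , λ x h → P x (ℕP.<⇒≤ h)

  square-cons : ∀ {c : Vec Tri n} {d} z → n ≡ z → (w : Witness c d) → Positive≥ w n →
    Σ (List Factor) λ L → length L ℕ.≤ suc (suc d) × PConf c (valsL L n) × LAll.All (λ f → root f ℕ.≤ z) L × (evL L z ≡ 0ℚ) × (∀ x → z ℕ.< x → 1ℚ ≤ evL L x)
  square-cons {n} {c} z refl (L , l , pc , r) P = plus z ∷ plus z ∷ L , s≤s (s≤s l) ,
    PConf-scale2 c (plus z) (plus z) L (λ x h → square≥1 {x} {z} (inj₁ h)) pc ,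
    (ℕP.≤-refl ∷ ℕP.≤-refl ∷ r) , root-plus z (plus z ∷ L) ,
    λ x h → 1≤*ˡ {evF (plus z) x} {evF (plus z) x} (square≥1 {x} {z} (inj₂ h)) (P x (ℕP.<⇒≤ h))

  square-witness : ∀ (c : Vec Tri n) → Σ (Witness c (rank c ℕ.+ rank c)) λ w → Positive≥ w n
  square-witness [] = ([] , z≤n , [] , []) , λ x h → ≤-refl
  square-witness (fix0 ∷ c) = let w , P = square-witness c in fixed-cons fix0 (λ ()) w P
  square-witness (fix1 ∷ c) = let w , P = square-witness c in fixed-cons fix1 (λ ()) w P
  square-witness {suc n} (free ∷ c) = let w , P = square-witness c
                                          L , l , pc , r , z , P′ = square-cons n refl w P in
    (L , ℕP.≤-trans l (ℕP.≤-reflexive (cong suc (sym (ℕP.+-suc (rank c) (rank c))))) , z ∷ pc , weaken-roots r) , P′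

  -- With z zeros, at most s of them completed to double zeros, the degree is at most z + s. The odd
  -- state has one more zero, at position n just above the vector. The start state promises nothing
  -- above the vector, where its factors n - x become negative.
  EvenClaim OddClaim StartClaim : ∀ s z n → Vec Tri n → Set
  EvenClaim s z n c = Σ (Witness c (z ℕ.+ s)) λ w → Positive≥ w n
  OddClaim s z n c = Σ (List Factor) λ L → length L ℕ.≤ suc (z ℕ.+ s) × PConf c (valsL L n) × LAll.All (λ f → root f ℕ.≤ n) L ×
    (evL L n ≡ 0ℚ) × (∀ x → n ℕ.< x → 1ℚ ≤ evL L x)
  StartClaim s z n c = Witness c (z ℕ.+ s)

  odd-fixed : ∀ s z {n} t {c : Vec Tri n} → t ≢ free → EvenClaim s z n c → OddClaim (suc s) z (suc n) (t ∷ c)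
  odd-fixed s z {n} t t≢ (w , P) = let w′ , P′ = fixed-cons t t≢ w P
                                       L , l , rest = square-cons (suc n) refl w′ P′ in
    L , subst (length L ℕ.≤_) (cong suc (sym (ℕP.+-suc z s))) l , rest

  -- The product (x - n)(x - n - 1) is negative only strictly between two consecutive integers, so
  -- two adjacent zeros need no doubling.
  odd-pair : ∀ s z {n} {c : Vec Tri n} → EvenClaim s z n c → OddClaim s (suc z) (suc n) (free ∷ c)
  odd-pair s z {n} {c} ((L , l , pc , r) , P) =
    plus n ∷ plus (suc n) ∷ L , s≤s (s≤s l) ,
    (root-plus n (plus (suc n) ∷ L) ∷ PConf-scale2 c (plus n) (plus (suc n)) L (λ x k → pair≥1 {x} {n} k) pc) ,
    (ℕP.n≤1+n n ∷ ℕP.≤-refl ∷ weaken-roots r) ,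
    trans (cong (evF (plus n) (suc n) *_) (root-plus (suc n) L)) (*-zeroʳ (evF (plus n) (suc n))) ,
    λ x k → 1≤* (ι-gap (ℕP.<-trans ℕP.≤-refl k)) (1≤* (ι-gap k) (P x (ℕP.≤-trans (ℕP.n≤1+n n) (ℕP.<⇒≤ k))))

  even-sound : ∀ s z n {c} → c ∈ˡ even s z n → EvenClaim s z n c
  odd-sound : ∀ s z n {c} → c ∈ˡ odd s z n → OddClaim s z n c
  even-sound s zero zero (here refl) = ([] , z≤n , [] , []) , λ x h → ≤-refl
  even-sound s zero (suc n) = cons3-all (EvenClaim s zero (suc n))
    (λ h → let w , P = even-sound s zero n h in fixed-cons fix0 (λ ()) w P)
    (λ h → let w , P = even-sound s zero n h in fixed-cons fix1 (λ ()) w P) λ ()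
  even-sound s (suc z) (suc n) = cons3-all (EvenClaim s (suc z) (suc n))
    (λ h → let w , P = even-sound s (suc z) n h in fixed-cons fix0 (λ ()) w P)
    (λ h → let w , P = even-sound s (suc z) n h in fixed-cons fix1 (λ ()) w P)
    (λ h → let L , l , pc , r , e , P = odd-sound s z n h in (L , l , e ∷ pc , weaken-roots r) , P)
  -- A zero at the lowest position stays single: the factor x is nonnegative at all positions.
  odd-sound s zero zero (here refl) = plus 0 ∷ [] , s≤s z≤n , [] , (z≤n ∷ []) , refl ,
    λ x h → 1≤* (ι-gap h) ≤-refl
  odd-sound (suc s) zero (suc n) = cons3-all (OddClaim (suc s) zero (suc n))
    (λ h → odd-fixed s zero fix0 (λ ()) (even-sound s zero n h))
    (λ h → odd-fixed s zero fix1 (λ ()) (even-sound s zero n h)) λ ()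
  odd-sound zero (suc z) (suc n) = cons3-all (OddClaim zero (suc z) (suc n)) (λ ()) (λ ()) (λ h → odd-pair zero z (even-sound zero z n h))
  odd-sound (suc s) (suc z) (suc n) = cons3-all (OddClaim (suc s) (suc z) (suc n))
    (λ h → odd-fixed s (suc z) fix0 (λ ()) (even-sound s (suc z) n h))
    (λ h → odd-fixed s (suc z) fix1 (λ ()) (even-sound s (suc z) n h))
    (λ h → odd-pair (suc s) z (even-sound (suc s) z n h))

  start-sound : ∀ s z n {c} → c ∈ˡ start s z n → StartClaim s z n c
  start-sound s zero zero (here refl) = [] , z≤n , [] , []
  start-sound s zero (suc n) = cons3-all (StartClaim s zero (suc n))
    (λ h → let w , P = even-sound s zero n h in proj₁ (fixed-cons fix0 (λ ()) w P))
    (λ h → let w , P = even-sound s zero n h in proj₁ (fixed-cons fix1 (λ ()) w P)) λ ()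
  start-sound s (suc z) (suc n) = cons3-all (StartClaim s (suc z) (suc n))
    (λ h → let w , P = even-sound s (suc z) n h in proj₁ (fixed-cons fix0 (λ ()) w P))
    (λ h → let w , P = even-sound s (suc z) n h in proj₁ (fixed-cons fix1 (λ ()) w P))
    (λ {c} h → let L , l , pc , r = start-sound s z n h in
       -- The factor n - x is positive below n; above n the pattern has only further zeros of this
       -- kind.
       minus n ∷ L , s≤s l , root-minus n L ∷ PConf-scale c (minus n) L (λ x k → ι-gap k) pc , (ℕP.n≤1+n n ∷ weaken-roots r))

  even-rank : ∀ s z n {c} → c ∈ˡ even s z n → rank c ≡ z
  odd-rank : ∀ s z n {c} → c ∈ˡ odd s z n → rank c ≡ z
  even-rank s zero zero (here refl) = refl
  even-rank s zero (suc n) = cons3-all (λ c → rank c ≡ zero) (even-rank s zero n) (even-rank s zero n) λ ()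
  even-rank s (suc z) (suc n) = cons3-all (λ c → rank c ≡ (suc z)) (even-rank s (suc z) n) (even-rank s (suc z) n) (cong suc ∘ odd-rank s z n)
  odd-rank s zero zero (here refl) = refl
  odd-rank (suc s) zero (suc n) = cons3-all (λ c → rank c ≡ zero) (even-rank s zero n) (even-rank s zero n) λ ()
  odd-rank zero (suc z) (suc n) = cons3-all (λ c → rank c ≡ (suc z)) (λ ()) (λ ()) (cong suc ∘ even-rank zero z n)
  odd-rank (suc s) (suc z) (suc n) = cons3-all (λ c → rank c ≡ (suc z)) (even-rank s (suc z) n) (even-rank s (suc z) n) (cong suc ∘ even-rank (suc s) z n)

  start-rank : ∀ s z n {c} → c ∈ˡ start s z n → rank c ≡ z
  start-rank s zero zero (here refl) = refl
  start-rank s zero (suc n) = cons3-all (λ c → rank c ≡ zero) (even-rank s zero n) (even-rank s zero n) λ ()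
  start-rank s (suc z) (suc n) = cons3-all (λ c → rank c ≡ (suc z)) (even-rank s (suc z) n) (even-rank s (suc z) n) (cong suc ∘ start-rank s z n)

  toPoly : ∀ j (L : List Factor) → length L ℕ.< j → Vec ℚ j
  toPoly (suc j) [] h = 1ℚ ∷ 𝟎
  toPoly (suc (suc j)) (plus z ∷ L) (s≤s h) = mulLin (ι z) (toPoly (suc j) L h)
  toPoly (suc (suc j)) (minus z ∷ L) (s≤s h) = (- 1ℚ) ⊙ mulLin (ι z) (toPoly (suc j) L h)

  ev-toPoly : ∀ j L (h : length L ℕ.< j) x → ev (toPoly j L h) (ι x) ≡ evL L x
  ev-toPoly (suc j) [] h x = trans (cong (λ y → 1ℚ + ι x * y) (ev-𝟎 j (ι x))) (trans (cong (1ℚ +_) (*-zeroʳ (ι x))) (+-identityʳ 1ℚ))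
  ev-toPoly (suc (suc j)) (plus z ∷ L) (s≤s h) x = trans (ev-mulLin (ι z) (toPoly (suc j) L h) (ι x)) (cong ((ι x - ι z) *_) (ev-toPoly (suc j) L h x))
  ev-toPoly (suc (suc j)) (minus z ∷ L) (s≤s h) x = trans (ev-⊙ (- 1ℚ) (mulLin (ι z) (toPoly (suc j) L h)) (ι x))
    (trans (cong (- 1ℚ *_) (trans (ev-mulLin (ι z) (toPoly (suc j) L h) (ι x)) (cong ((ι x - ι z) *_) (ev-toPoly (suc j) L h x))))
      (solve 3 (λ x z e → con (- 1ℚ) :* ((x :- z) :* e) := (z :- x) :* e) refl (ι x) (ι z) (evL L x)))

  vals-toPoly : ∀ j L (h : length L ℕ.< j) n → vals (toPoly j L h) n ≡ valsL L n
  vals-toPoly j L h zero = refl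
  vals-toPoly j L h (suc n) = cong₂ _∷_ (ev-toPoly j L h n) (vals-toPoly j L h n)

  pow : ℕ → ℕ → ℚ
  pow M zero = 1ℚ
  pow M (suc d) = ι (suc M) * pow M d

  pow≥1 : ∀ M d → 1ℚ ≤ pow M d
  pow≥1 M zero = ≤-refl
  pow≥1 M (suc d) = 1≤* (le-cert (ι M) (ι≥0 M) refl) (pow≥1 M d)

  evF-bound : ∀ M f x → root f ℕ.≤ M → x ℕ.≤ M → ∣ evF f x ∣ ≤ ι (suc M)
  evF-bound M (plus z) x hz hx = ι-dist (s≤s hx) (s≤s hz)
  evF-bound M (minus z) x hz hx = ι-dist (s≤s hz) (s≤s hx)

  evL-bound : ∀ M d L x → length L ℕ.≤ d → LAll.All (λ f → root f ℕ.≤ M) L → x ℕ.≤ M → ∣ evL L x ∣ ≤ pow M d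
  evL-bound M d [] x h r hx = pow≥1 M d
  evL-bound M (suc d) (f ∷ L) x (s≤s h) (k ∷ ks) hx = ≤-trans (≤-reflexive (∣p*q∣≡∣p∣*∣q∣ (evF f x) (evL L x)))
    (*-mono-≤ (0≤∣p∣ (evF f x)) (≤-trans 0≤1 (pow≥1 M d)) (evF-bound M f x k hx) (evL-bound M d L x h ks hx))

  valsL-bound : ∀ M d L n → length L ℕ.≤ d → LAll.All (λ f → root f ℕ.≤ M) L → n ℕ.≤ M → Bd (pow M d) (valsL L n)
  valsL-bound M d L zero _ _ _ = []
  valsL-bound M d L (suc n) h r k = evL-bound M d L n h r (ℕP.<⇒≤ k) ∷ valsL-bound M d L n h r (ℕP.<⇒≤ k)

  -- Realized patterns with h + 2 free entries

  module Lists (p h : ℕ) where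

    -- Patterns c with h + 2 free entries such that fix0 ∷ c (in negHead), respectively fix1 ∷ c (in posHead), is realized.
    negHead posHead : ∀ r → List (Vec Tri (suc (r ℕ.+ p)))
    negHead zero = []
    negHead (suc r) = cons3 (even h (suc (suc h)) N) (even h (suc (suc h)) N) (ranked (suc h) N)
      where N = suc (r ℕ.+ p)
    posHead zero = []
    posHead (suc r) = cons3 (negHead r) (posHead r) (start h (suc h) (suc (r ℕ.+ p)))

    realized : ∀ r → List (Vec Tri (suc (suc r ℕ.+ p)))
    realized r = cons3 (negHead r) (posHead r) (ranked (suc h) (suc (r ℕ.+ p)))

    negHead-unique : ∀ r → Unique (negHead r)
    negHead-unique zero = []
    negHead-unique (suc r) = cons3-unique (even-unique h (suc (suc h)) _) (even-unique h (suc (suc h)) _) (ranked-unique (suc h) _)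

    posHead-unique : ∀ r → Unique (posHead r)
    posHead-unique zero = []
    posHead-unique (suc r) = cons3-unique (negHead-unique r) (posHead-unique r) (start-unique h (suc h) _)

    realized-unique : ∀ r → Unique (realized r)
    realized-unique r = cons3-unique (negHead-unique r) (posHead-unique r) (ranked-unique (suc h) _)

    negHead-rank : ∀ r {c} → c ∈ˡ negHead r → rank c ≡ suc (suc h)
    negHead-rank (suc r) = cons3-all (λ c → rank c ≡ suc (suc h)) (even-rank h (suc (suc h)) _) (even-rank h (suc (suc h)) _) (cong suc ∘ ranked-rank (suc h) _)

    posHead-rank : ∀ r {c} → c ∈ˡ posHead r → rank c ≡ suc (suc h)
    posHead-rank (suc r) = cons3-all (λ c → rank c ≡ suc (suc h)) (negHead-rank r) (posHead-rank r) (cong suc ∘ start-rank h (suc h) _)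

    realized-rank : ∀ r {c} → c ∈ˡ realized r → rank c ≡ suc (suc h)
    realized-rank r = cons3-all (λ c → rank c ≡ suc (suc h)) (negHead-rank r) (posHead-rank r) (cong suc ∘ ranked-rank (suc h) _)

  module Realizable (p h : ℕ) (2h<p : suc h ℕ.+ suc h ℕ.< p) (κ ε : ℚ) (ε≥0 : 0ℚ ≤ ε) (εκ : ε * κ ≡ 1ℚ) (R : ℕ)
    (small : Difference.stability p R * ε * two ≤ 1ℚ)
    (θ : ℚ) (θ≥0 : 0ℚ ≤ θ) (θ2 : θ * (two * pow2 p) ≡ 1ℚ) where

    M : ℕ
    M = suc R ℕ.+ p

    B : ℚ
    B = pow M p

    B≥0 : 0ℚ ≤ B
    B≥0 = ≤-trans 0≤1 (pow≥1 M p)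

    open Realize p κ ε ε≥0 εκ R small B θ B≥0 θ≥0 θ2 public using (δ)

    module Sound (hδ : pow2 p * δ * two ≤ 1ℚ) (hκ : (B + 1ℚ) * two ≤ θ * κ) where

      open Realize.Bounds p κ ε ε≥0 εκ R small B θ B≥0 θ≥0 θ2 hδ hκ public
      open Lists p h public

      to-Poly : ∀ {n d} {c : Vec Tri n} → n ℕ.≤ M → d ℕ.< p → (w : Witness c d) → Poly c
      to-Poly {n} {d} {c} hn hd (L , l , pc , rt) = toPoly p L l<p , subst (PConf c) (sym e) pc ,
          subst (Bd B) (sym e) (valsL-bound M p L n (ℕP.<⇒≤ l<p) (LAll.map (λ k → ℕP.≤-trans k hn) rt) hn)
        where l<p = ℕP.≤-<-trans l hd
              e = vals-toPoly p L l<p n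

      length≤ : ∀ {r} → r ℕ.≤ R → suc (r ℕ.+ p) ℕ.≤ M
      length≤ h = s≤s (ℕP.+-monoˡ-≤ p h)

      double≤ : ∀ {k} → k ℕ.≤ suc h → k ℕ.+ k ℕ.< p
      double≤ k≤ = ℕP.≤-<-trans (ℕP.+-mono-≤ k≤ k≤) 2h<p

      square-Poly : ∀ r (c : Vec Tri (suc (r ℕ.+ p))) → r ℕ.≤ R → rank c ℕ.≤ suc h → Poly c
      square-Poly r c hr rc = to-Poly (length≤ hr) (double≤ rc) (proj₁ (square-witness c))

      rank≤p : ∀ {k} → k ℕ.≤ suc h → k ℕ.≤ p
      rank≤p k≤ = ℕP.≤-trans (ℕP.m≤m+n _ _) (ℕP.<⇒≤ (double≤ k≤))

      h+2≤p : suc (suc h) ℕ.≤ p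
      h+2≤p = ℕP.≤-trans (s≤s (s≤s (ℕP.m≤m+n h (suc h)))) 2h<p

      h2<p : suc (suc h) ℕ.+ h ℕ.< p
      h2<p = subst (λ k → suc k ℕ.< p) (ℕP.+-suc h h) 2h<p

      low-rank-real : ∀ r (c : Vec Tri (suc (suc r ℕ.+ p))) → suc r ℕ.≤ R → rank c ℕ.≤ suc h → Real (suc r) c
      low-rank-real r (free ∷ c) hr rc = let w , s , cf , _ = real-free r c hr (rank≤p rc′) (square-Poly r c (ℕP.<⇒≤ hr) rc′) in 0ℚ ∷ w , s , cf
        where rc′ = ℕP.≤-trans (ℕP.n≤1+n (rank c)) rc
      low-rank-real r (fix0 ∷ c) hr rc = Dom⇒Real (dom-fixed r fix0 c (λ ()) hr (rank≤p rc) (square-Poly r c (ℕP.<⇒≤ hr) rc))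
      low-rank-real r (fix1 ∷ c) hr rc = Dom⇒Real (dom-fixed r fix1 c (λ ()) hr (rank≤p rc) (square-Poly r c (ℕP.<⇒≤ hr) rc))

      ranked-rank≤ : ∀ n {c} → c ∈ˡ ranked (suc h) n → rank c ℕ.≤ suc h
      ranked-rank≤ n m = ℕP.≤-reflexive (ranked-rank (suc h) n m)

      -- A sign on top of a paired pattern belongs to a polynomial, after which the next value -Ω
      -- can be prescribed. A zero on top of an arbitrary pattern with h + 1 zeros is forced upon a
      -- square and leads to a negative entry by `dom-neg`.
      negHead-sound : ∀ r {c} → suc r ℕ.≤ R → c ∈ˡ negHead r → Dom (suc r) (fix0 ∷ c)
      negHead-sound (suc r) hr = cons3-all (λ c → Dom (suc (suc r)) (fix0 ∷ c))
        (λ m → dom-fixed (suc r) fix0 _ (λ ()) hr (rk m) (po fix0 (λ ()) m))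
        (λ m → dom-fixed (suc r) fix0 _ (λ ()) hr (rk m) (po fix1 (λ ()) m))
        (λ {c} m → dom-neg r c hr′ (rank≤p (ranked-rank≤ _ m)) (square-Poly r c (ℕP.<⇒≤ hr′) (ranked-rank≤ _ m))
          (subst (1ℚ ≤_) (sym (ev-toPoly p _ _ (suc (r ℕ.+ p)))) (proj₂ (square-witness c) (suc (r ℕ.+ p)) ℕP.≤-refl)))
        where
        hr′ = ℕP.<⇒≤ hr
        rk : ∀ {c} → c ∈ˡ even h (suc (suc h)) (suc (r ℕ.+ p)) → rank c ℕ.≤ p
        rk m = subst (ℕ._≤ p) (sym (even-rank h _ _ m)) h+2≤p
        po : ∀ t {c} → t ≢ free → c ∈ˡ even h (suc (suc h)) (suc (r ℕ.+ p)) → Poly (t ∷ c)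
        po t t≢ m = let w , P = even-sound h _ _ m in to-Poly (length≤ hr′) h2<p (proj₁ (fixed-cons t t≢ w P))

      -- A dominating entry of either sign can be followed by a positive one, so all patterns
      -- obtained for the shorter length are inherited. The new ones have a zero below the positive
      -- entry and come from polynomials with single zeros at the top.
      posHead-sound : ∀ r {c} → suc r ℕ.≤ R → c ∈ˡ posHead r → Dom (suc r) (fix1 ∷ c)
      posHead-sound (suc r) hr = cons3-all (λ c → Dom (suc (suc r)) (fix1 ∷ c))
        (λ {c} m → dom-pos (suc r) fix0 c (λ ()) (negHead-sound r (ℕP.<⇒≤ hr) m))
        (λ {c} m → dom-pos (suc r) fix1 c (λ ()) (posHead-sound r (ℕP.<⇒≤ hr) m))
        (λ {c} m → dom-fixed (suc r) fix1 (free ∷ c) (λ ()) hr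
            (subst (λ k → suc k ℕ.≤ p) (sym (start-rank h (suc h) _ m)) h+2≤p)
            (to-Poly (length≤ (ℕP.<⇒≤ hr)) h2<p (start-sound h (suc (suc h)) _ (∈-cons3₂ {A = even h (suc (suc h)) _} {even h (suc (suc h)) _} m))))

      realized-sound : ∀ r {c} → suc r ℕ.≤ R → c ∈ˡ realized r → Real (suc r) c
      realized-sound r hr = cons3-all (Real (suc r))
        (λ m → Dom⇒Real (negHead-sound r hr m)) (λ m → Dom⇒Real (posHead-sound r hr m))
        -- The top zero is prescribed as the next value ω = 0, so that the square has to provide
        -- only h + 1 zeros.
        (λ {c} m → let rc = ranked-rank≤ _ m
                       w , s , cf , _ = real-free r c hr (rank≤p rc) (square-Poly r c (ℕP.<⇒≤ hr) rc) in 0ℚ ∷ w , s , cf)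

  record Fan (p h R : ℕ) : Set where
    field
      κ : ℚ
      κ>0 : 0ℚ < κ
    open System p κ public
    field
      generic : ∀ r s w c → r ℕ.≤ R → Sys r s w → ZeroAt c w → suc p ℕ.≤ rank c → w ≡ 𝟎
      low-rank-real : ∀ r (c : Vec Tri (suc (suc r ℕ.+ p))) → suc r ℕ.≤ R → rank c ℕ.≤ suc h →
        Σ (Vec ℚ (suc (suc r ℕ.+ p))) λ w → Sys (suc r) allFree w × Conf c w
      realized-sound : ∀ r {c} → suc r ℕ.≤ R → c ∈ˡ Lists.realized p h r →
        Σ (Vec ℚ (suc (suc r ℕ.+ p))) λ w → Sys (suc r) allFree w × Conf c w

  scale-inv : ∀ {ε κ x} → 0ℚ ≤ ε → ε * κ ≡ 1ℚ → x ≤ κ → ε * x ≤ 1ℚ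
  scale-inv {ε} {κ} {x} hε e h = subst (ε * x ≤_) e (*-monoˡ-≤-nonNeg ε ⦃ nonNegative hε ⦄ h)

  opaque
   fan : ∀ p h R → suc h ℕ.+ suc h ℕ.< p → Fan p h R
   fan p h R 2h<p = record
    { κ = κ ; κ>0 = κ>0
    ; generic = S.generic ; low-rank-real = S.low-rank-real ; realized-sound = S.realized-sound }
    where
    C : ℚ
    C = Difference.stability p R
    C≥0 : 0ℚ ≤ C
    C≥0 = Difference.stability≥0 p R
    Θ : ℚ
    Θ = two * pow2 p
    Θ≥0 : 0ℚ ≤ Θ
    Θ≥0 = 0≤* 0≤two (pow2≥0 p)
    Θ>0 : 0ℚ < Θ
    Θ>0 = 0<* (0<+≤ 0<1 0≤1) (<-≤-trans 0<1 (pow2≥1 p))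
    θ : ℚ
    θ = proj₁ (>0⇒inv Θ Θ>0)
    θΘ : θ * Θ ≡ 1ℚ
    θΘ = proj₁ (proj₂ (>0⇒inv Θ Θ>0))
    θ≥0 : 0ℚ ≤ θ
    θ≥0 = <⇒≤ (proj₂ (proj₂ (>0⇒inv Θ Θ>0)))
    B : ℚ
    B = pow (suc R ℕ.+ p) p
    B≥0 : 0ℚ ≤ B
    B≥0 = ≤-trans 0≤1 (pow≥1 (suc R ℕ.+ p) p)
    Ω : ℚ
    Ω = Θ * (B + 1ℚ)
    Ω≥0 : 0ℚ ≤ Ω
    Ω≥0 = 0≤* Θ≥0 (0≤+ B≥0 0≤1)
    X₁ : ℚ
    X₁ = C * two
    X₂ : ℚ
    X₂ = pow2 p * (C * (Ω + B) * two) * two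
    X₃ : ℚ
    X₃ = (B + 1ℚ) * two * Θ
    X₁≥0 : 0ℚ ≤ X₁
    X₁≥0 = 0≤* C≥0 0≤two
    X₂≥0 : 0ℚ ≤ X₂
    X₂≥0 = 0≤* (0≤* (pow2≥0 p) (0≤* (0≤* C≥0 (0≤+ Ω≥0 B≥0)) 0≤two)) 0≤two
    X₃≥0 : 0ℚ ≤ X₃
    X₃≥0 = 0≤* (0≤* (0≤+ B≥0 0≤1) 0≤two) Θ≥0
    -- `X₁`, `X₂` and `X₃` are the lower bounds for κ required by `small`, `hδ` and `hκ`; their sum
    -- serves all three.
    κ : ℚ
    κ = 1ℚ + (X₁ + (X₂ + X₃))
    κ>0 : 0ℚ < κ
    κ>0 = 0<+≤ 0<1 (0≤+ X₁≥0 (0≤+ X₂≥0 X₃≥0))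
    ε : ℚ
    ε = proj₁ (>0⇒inv κ κ>0)
    εκ : ε * κ ≡ 1ℚ
    εκ = proj₁ (proj₂ (>0⇒inv κ κ>0))
    ε>0 : 0ℚ < ε
    ε>0 = proj₂ (proj₂ (>0⇒inv κ κ>0))
    ε≥0 : 0ℚ ≤ ε
    ε≥0 = <⇒≤ ε>0
    sum₁ : ∀ a b c → a + (1ℚ + (b + c)) ≡ 1ℚ + (a + (b + c))
    sum₁ = solve 3 (λ a b c → a :+ (con 1ℚ :+ (b :+ c)) := con 1ℚ :+ (a :+ (b :+ c))) refl
    sum₂ : ∀ a b c → b + (1ℚ + (a + c)) ≡ 1ℚ + (a + (b + c))
    sum₂ = solve 3 (λ a b c → b :+ (con 1ℚ :+ (a :+ c)) := con 1ℚ :+ (a :+ (b :+ c))) refl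
    sum₃ : ∀ a b c → c + (1ℚ + (a + b)) ≡ 1ℚ + (a + (b + c))
    sum₃ = solve 3 (λ a b c → c :+ (con 1ℚ :+ (a :+ b)) := con 1ℚ :+ (a :+ (b :+ c))) refl
    reassoc₁ : ∀ ε C t → ε * (C * t) ≡ C * ε * t
    reassoc₁ = solve 3 (λ ε C t → ε :* (C :* t) := C :* ε :* t) refl
    reassoc₂ : ∀ ε g C W t → ε * (g * (C * W * t) * t) ≡ g * (C * (ε * W) * t) * t
    reassoc₂ = solve 5 (λ ε g C W t → ε :* (g :* (C :* W :* t) :* t) := g :* (C :* (ε :* W) :* t) :* t) refl
    small : C * ε * two ≤ 1ℚ
    small = subst (_≤ 1ℚ) (reassoc₁ ε C two) (scale-inv {ε} {κ} {X₁} ε≥0 εκ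
      (le-cert (1ℚ + (X₂ + X₃)) (0≤+ 0≤1 (0≤+ X₂≥0 X₃≥0)) (sum₁ X₁ X₂ X₃)))
    hδ : pow2 p * (C * (ε * (Ω + B)) * two) * two ≤ 1ℚ
    hδ = subst (_≤ 1ℚ) (reassoc₂ ε (pow2 p) C (Ω + B) two) (scale-inv {ε} {κ} {X₂} ε≥0 εκ
      (le-cert (1ℚ + (X₁ + X₃)) (0≤+ 0≤1 (0≤+ X₁≥0 X₃≥0)) (sum₂ X₁ X₂ X₃)))
    X₃≤κ : X₃ ≤ κ
    X₃≤κ = le-cert (1ℚ + (X₁ + X₂)) (0≤+ 0≤1 (0≤+ X₁≥0 X₂≥0)) (sum₃ X₁ X₂ X₃)
    hκ : (B + 1ℚ) * two ≤ θ * κ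
    hκ = subst (_≤ θ * κ) (trans (*-comm θ X₃) (trans (*-assoc ((B + 1ℚ) * two) Θ θ) (trans (cong ((B + 1ℚ) * two *_) (trans (*-comm Θ θ) θΘ)) (*-identityʳ _))))
      (*-monoˡ-≤-nonNeg θ ⦃ nonNegative θ≥0 ⦄ X₃≤κ)
    module S = Realizable.Sound p h 2h<p κ ε ε≥0 εκ R small θ θ≥0 θΘ hδ hκ

  -- Vertices of the projected cube

  dv : ℕ → ∀ n → Vec ℚ n
  dv j zero = []
  dv zero (suc n) = 1ℚ ∷ 𝟎
  dv (suc j) (suc n) = dv j (suc n) ⊖ (0ℚ ∷ dv j n)

  dot-⊖ˡ : ∀ (u v w : Vec ℚ n) → dot (u ⊖ v) w ≡ dot u w - dot v w
  dot-⊖ˡ [] [] [] = refl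
  dot-⊖ˡ (x ∷ u) (y ∷ v) (z ∷ w) rewrite dot-⊖ˡ u v w =
    solve 5 (λ x y z a b → (x :- y) :* z :+ (a :- b) := (x :* z :+ a) :- (y :* z :+ b)) refl x y z (dot u w) (dot v w)

  dv-dif : ∀ j (v : Vec ℚ n) → dot (dv j n) v ≡ dif j v
  dv-dif j [] = refl
  dv-dif zero (x ∷ v) = trans (cong (1ℚ * x +_) (dot-𝟎ˡ v)) (trans (+-identityʳ (1ℚ * x)) (*-identityˡ x))
  dv-dif {suc n} (suc j) (x ∷ v) = trans (dot-⊖ˡ (dv j (suc n)) (0ℚ ∷ dv j n) (x ∷ v))
    (cong₂ _-_ (dv-dif j (x ∷ v)) (trans (cong₂ _+_ (*-zeroˡ x) (dv-dif j v)) (+-identityˡ (dif j v))))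

  Bd-⊖ : ∀ {A B} (u v : Vec ℚ n) → Bd A u → Bd B v → Bd (A + B) (u ⊖ v)
  Bd-⊖ [] [] [] [] = []
  Bd-⊖ (x ∷ u) (y ∷ v) (a ∷ as) (b ∷ bs) = ≤-trans (∣p-q∣≤∣p∣+∣q∣ x y) (+-mono-≤ a b) ∷ Bd-⊖ u v as bs

  Bd-⊙ : ∀ {A B} t (v : Vec ℚ n) → ∣ t ∣ ≤ A → 0ℚ ≤ B → Bd B v → Bd (A * B) (t ⊙ v)
  Bd-⊙ t [] h hB [] = []
  Bd-⊙ {A = A} {B} t (x ∷ v) h hB (b ∷ bs) = ≤-trans (≤-reflexive (∣p*q∣≡∣p∣*∣q∣ t x)) (*-mono-≤ (0≤∣p∣ t) hB h b) ∷ Bd-⊙ t v h hB bs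

  dv-Bd : ∀ j n → Bd (pow2 j) (dv j n)
  dv-Bd j zero = []
  dv-Bd zero (suc n) = ≤-refl ∷ Bd-𝟎 n 0≤1
  dv-Bd (suc j) (suc n) = Bd-⊖ (dv j (suc n)) (0ℚ ∷ dv j n) (dv-Bd j (suc n)) (pow2≥0 j ∷ dv-Bd j n)

  sg : Bool → ℚ
  sg true = 1ℚ
  sg false = - 1ℚ

  ∣sg∣ : ∀ s x → ∣ sg s * x ∣ ≡ ∣ x ∣
  ∣sg∣ true x = cong ∣_∣ (*-identityˡ x)
  ∣sg∣ false x = trans (cong ∣_∣ (solve 1 (λ x → con (- 1ℚ) :* x := :- x) refl x)) (∣-p∣≡∣p∣ x)

  Match : Bool → Tri → Set
  Match s free = ⊤
  Match true fix1 = ⊤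
  Match false fix0 = ⊤
  Match true fix0 = ⊥
  Match false fix1 = ⊥

  infix 4 _∈c_ _≼_
  _∈c_ : Vec Bool n → Vec Tri n → Set
  _∈c_ = Pointwise Match

  _≼_ : Vec Tri n → Vec Tri n → Set
  _≼_ = Pointwise (λ t u → (t ≡ u) ⊎ (u ≡ free))

  ≼-∈ : ∀ {σ : Vec Bool n} {c d} → c ≼ d → σ ∈c c → σ ∈c d
  ≼-∈ [] [] = []
  ≼-∈ (inj₁ refl ∷ l) (m ∷ ms) = m ∷ ≼-∈ l ms
  ≼-∈ (inj₂ refl ∷ l) (m ∷ ms) = tt ∷ ≼-∈ l ms

  ∈-allFree : ∀ (σ : Vec Bool n) → σ ∈c allFree
  ∈-allFree [] = []
  ∈-allFree (s ∷ σ) = tt ∷ ∈-allFree σ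

  sign : ℚ → Tri
  sign x with <-cmp x 0ℚ
  ... | tri< _ _ _ = fix0
  ... | tri≈ _ _ _ = free
  ... | tri> _ _ _ = fix1

  sign-spec : ∀ x → HasSign (sign x) x
  sign-spec x with <-cmp x 0ℚ
  ... | tri< h _ _ = h
  ... | tri≈ _ h _ = h
  ... | tri> _ _ h = h

  HasSign-unique : ∀ t u x → HasSign t x → HasSign u x → t ≡ u
  HasSign-unique free free x _ _ = refl
  HasSign-unique fix0 fix0 x _ _ = refl
  HasSign-unique fix1 fix1 x _ _ = refl
  HasSign-unique free fix0 x h k = ⊥-elim (<-irrefl h k)
  HasSign-unique free fix1 x h k = ⊥-elim (<-irrefl (sym h) k)
  HasSign-unique fix0 free x h k = ⊥-elim (<-irrefl k h)
  HasSign-unique fix1 free x h k = ⊥-elim (<-irrefl (sym k) h)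
  HasSign-unique fix0 fix1 x h k = ⊥-elim (<-asym h k)
  HasSign-unique fix1 fix0 x h k = ⊥-elim (<-asym h k)

  restrict1 : Tri → ℚ → Tri
  restrict1 free x = sign x
  restrict1 fix0 x = fix0
  restrict1 fix1 x = fix1

  restrict : Vec Tri n → Vec ℚ n → Vec Tri n
  restrict = Vec.zipWith restrict1

  restrict-≼ : ∀ (c : Vec Tri n) w → restrict c w ≼ c
  restrict-≼ [] [] = []
  restrict-≼ (free ∷ c) (x ∷ w) = inj₂ refl ∷ restrict-≼ c w
  restrict-≼ (fix0 ∷ c) (x ∷ w) = inj₁ refl ∷ restrict-≼ c w
  restrict-≼ (fix1 ∷ c) (x ∷ w) = inj₁ refl ∷ restrict-≼ c w

  restrict-conf : ∀ (c : Vec Tri n) w → Conf c w → restrict allFree w ≡ c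
  restrict-conf [] [] [] = refl
  restrict-conf (t ∷ c) (x ∷ w) (h ∷ hs) = cong₂ _∷_ (HasSign-unique (sign x) t x (sign-spec x) h) (restrict-conf c w hs)

  restrict-zero : ∀ (w : Vec ℚ n) → ZeroAt (restrict allFree w) w
  restrict-zero [] = []
  restrict-zero (x ∷ w) = (λ e → subst (λ t → HasSign t x) e (sign-spec x)) ∷ restrict-zero w

  -- The loss caused by the sign s against the best sign that t admits.
  deficit : Tri → Bool → ℚ → ℚ
  deficit t s x = ab t x - sg s * x

  deficit-true : ∀ x → ∣ x ∣ - 1ℚ * x ≡ ∣ x ∣ - x
  deficit-true x = cong (λ z → ∣ x ∣ - z) (*-identityˡ x)

  deficit-false : ∀ x → ∣ x ∣ - - 1ℚ * x ≡ ∣ x ∣ + x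
  deficit-false x = solve 2 (λ a x → a :- con (- 1ℚ) :* x := a :+ x) refl ∣ x ∣ x

  deficit≥0 : ∀ t s x → Match s t → 0ℚ ≤ deficit t s x
  deficit≥0 free true x _ = subst (0ℚ ≤_) (sym (deficit-true x)) (diff≥0 (x≤∣x∣ x))
  deficit≥0 free false x _ = subst (0ℚ ≤_) (trans (solve 2 (λ a x → a :- (:- x) := a :+ x) refl ∣ x ∣ x) (sym (deficit-false x))) (diff≥0 (-x≤∣x∣ x))
  deficit≥0 fix1 true x _ = ≤-reflexive (solve 1 (λ x → con 0ℚ := x :- con 1ℚ :* x) refl x)
  deficit≥0 fix0 false x _ = ≤-reflexive (solve 1 (λ x → con 0ℚ := (:- x) :- con (- 1ℚ) :* x) refl x)

  deficit-zero : ∀ t s x → Match s (restrict1 t x) → deficit t s x ≡ 0ℚ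
  deficit-zero fix1 true x _ = solve 1 (λ x → x :- con 1ℚ :* x := con 0ℚ) refl x
  deficit-zero fix0 false x _ = solve 1 (λ x → (:- x) :- con (- 1ℚ) :* x := con 0ℚ) refl x
  deficit-zero free s x m with <-cmp x 0ℚ
  deficit-zero free false x m | tri< h _ _ = trans (deficit-false x) (trans (cong (_+ x) (x≤0⇒∣x∣≡-x (<⇒≤ h))) (+-inverseˡ x))
  deficit-zero free true x m | tri> _ _ h = trans (deficit-true x) (trans (cong (_- x) (0≤p⇒∣p∣≡p (<⇒≤ h))) (x-x x))
  deficit-zero free s x m | tri≈ _ refl _ = solve 1 (λ s → con 0ℚ :- s :* con 0ℚ := con 0ℚ) refl (sg s)

  deficit-pos : ∀ t s x → Match s t → ¬ Match s (restrict1 t x) → 0ℚ < deficit t s x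
  deficit-pos fix1 true x _ h = ⊥-elim (h tt)
  deficit-pos fix0 false x _ h = ⊥-elim (h tt)
  deficit-pos free s x _ h with <-cmp x 0ℚ
  deficit-pos free true x _ h | tri< k _ _ = subst (0ℚ <_) (sym (deficit-true x)) (0≤+< (0≤∣p∣ x) (neg>0 k))
  deficit-pos free false x _ h | tri> _ _ k = subst (0ℚ <_) (sym (deficit-false x)) (0≤+< (0≤∣p∣ x) k)
  deficit-pos free false x _ h | tri< k _ _ = ⊥-elim (h tt)
  deficit-pos free true x _ h | tri> _ _ k = ⊥-elim (h tt)
  deficit-pos free s x _ h | tri≈ _ _ _ = ⊥-elim (h tt)

  match? : ∀ s t → Match s t ⊎ ¬ Match s t
  match? s free = inj₁ tt
  match? true fix1 = inj₁ tt
  match? false fix0 = inj₁ tt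
  match? true fix0 = inj₂ λ ()
  match? false fix1 = inj₂ λ ()

  _∈c?_ : ∀ (σ : Vec Bool n) c → (σ ∈c c) ⊎ ¬ (σ ∈c c)
  [] ∈c? [] = inj₁ []
  (s ∷ σ) ∈c? (t ∷ c) with match? s t | σ ∈c? c
  ... | inj₁ h | inj₁ k = inj₁ (h ∷ k)
  ... | inj₂ h | _ = inj₂ λ { (x ∷ _) → h x }
  ... | inj₁ _ | inj₂ k = inj₂ λ { (_ ∷ x) → k x }

  slackV : Vec ℚ n → Vec Bool n → Vec Tri n → Vec ℚ n → ℚ
  slackV [] [] [] [] = 0ℚ
  slackV (y ∷ ys) (s ∷ σ) (t ∷ c) (x ∷ w) = y * deficit t s x + slackV ys σ c w

  Pos : Vec ℚ n → Set
  Pos = All (0ℚ <_)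

  slack≥0 : ∀ (ys : Vec ℚ n) σ c w → Pos ys → σ ∈c c → 0ℚ ≤ slackV ys σ c w
  slack≥0 [] [] [] [] _ _ = ≤-refl
  slack≥0 (y ∷ ys) (s ∷ σ) (t ∷ c) (x ∷ w) (h ∷ hs) (m ∷ ms) = 0≤+ (0≤* (<⇒≤ h) (deficit≥0 t s x m)) (slack≥0 ys σ c w hs ms)

  slack-zero : ∀ (ys : Vec ℚ n) σ c w → σ ∈c restrict c w → slackV ys σ c w ≡ 0ℚ
  slack-zero [] [] [] [] _ = refl
  slack-zero (y ∷ ys) (s ∷ σ) (t ∷ c) (x ∷ w) (m ∷ ms) =
    trans (cong₂ _+_ (trans (cong (y *_) (deficit-zero t s x m)) (*-zeroʳ y)) (slack-zero ys σ c w ms)) refl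

  slack-pos : ∀ (ys : Vec ℚ n) σ c w → Pos ys → σ ∈c c → ¬ (σ ∈c restrict c w) → 0ℚ < slackV ys σ c w
  slack-pos [] [] [] [] _ _ h = ⊥-elim (h [])
  slack-pos (y ∷ ys) (s ∷ σ) (t ∷ c) (x ∷ w) (p ∷ ps) (m ∷ ms) h with match? s (restrict1 t x)
  ... | inj₂ k = 0<+≤ (0<* p (deficit-pos t s x m k)) (slack≥0 ys σ c w ps ms)
  ... | inj₁ k = 0≤+< (0≤* (<⇒≤ p) (deficit≥0 t s x m)) (slack-pos ys σ c w ps ms (λ z → h (k ∷ z)))

  signed : Vec Bool n → Vec ℚ n → Vec ℚ n
  signed = Vec.zipWith (λ s y → sg s * y)

  signed-slack : ∀ (ys : Vec ℚ n) σ c w → dot w (signed σ ys) ≡ dot ys (lam c w) - slackV ys σ c w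
  signed-slack [] [] [] [] = refl
  signed-slack (y ∷ ys) (s ∷ σ) (t ∷ c) (x ∷ w) rewrite signed-slack ys σ c w =
    solve 6 (λ s x y a D S → x :* (s :* y) :+ (D :- S) := (y :* a :+ D) :- (y :* (a :- s :* x) :+ S)) refl (sg s) x y (ab t x) (dot ys (lam c w)) (slackV ys σ c w)

  MaxOn : (Vec Bool n → ℚ) → Vec Tri n → Vec Tri n → ℚ → Set
  MaxOn f c d v = ∀ σ → σ ∈c c → (σ ∈c d → f σ ≡ v) × (¬ (σ ∈c d) → f σ < v)

  maxOn : ∀ (f : Vec Bool n → ℚ) (ys : Vec Bool n → Vec ℚ n) c w v → (∀ σ → Pos (ys σ)) → (∀ σ → σ ∈c c → f σ ≡ v - slackV (ys σ) σ c w) → MaxOn f c (restrict c w) v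
  maxOn f ys c w v pos h σ m = (λ k → trans (h σ m) (trans (cong (λ z → v - z) (slack-zero (ys σ) σ c w k)) (+-identityʳ v))) ,
    (λ k → lt-cert (slackV (ys σ) σ c w) (slack-pos (ys σ) σ c w (pos σ) m k) (trans (cong (_+ slackV (ys σ) σ c w) (h σ m))
      (solve 2 (λ v s → (v :- s) :+ s := v) refl v (slackV (ys σ) σ c w))))

  dot-tab-+ : ∀ (l : Vec ℚ n) (f g : Fin n → ℚ) → dot l (Vec.tabulate (λ j → f j + g j)) ≡ dot l (Vec.tabulate f) + dot l (Vec.tabulate g)
  dot-tab-+ [] f g = refl
  dot-tab-+ (x ∷ l) f g rewrite dot-tab-+ l (f ∘ suc) (g ∘ suc) = solve 5 (λ x a b c d → x :* (a :+ b) :+ (c :+ d) := (x :* a :+ c) :+ (x :* b :+ d)) refl x (f zero) (g zero) (dot l (Vec.tabulate (f ∘ suc))) (dot l (Vec.tabulate (g ∘ suc)))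

  dot-tab-* : ∀ (l : Vec ℚ n) t (f : Fin n → ℚ) → dot l (Vec.tabulate (λ j → t * f j)) ≡ t * dot l (Vec.tabulate f)
  dot-tab-* [] t f = sym (*-zeroʳ t)
  dot-tab-* (x ∷ l) t f rewrite dot-tab-* l t (f ∘ suc) = solve 4 (λ x t a c → x :* (t :* a) :+ t :* c := t :* (x :* a :+ c)) refl x t (f zero) (dot l (Vec.tabulate (f ∘ suc)))

  tabulate-const : ∀ n (x : ℚ) → Vec.tabulate {n = n} (λ _ → x) ≡ Vec.replicate n x
  tabulate-const zero x = refl
  tabulate-const (suc n) x = cong (x ∷_) (tabulate-const n x)

  module Points (p : ℕ) (κ : ℚ) (κ>0 : 0ℚ < κ) where

    open System p κ

    -- Running bound for the carried functional g, so that the widths Γ + 1 - g stay positive.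
    nextΓ : ℚ → ℚ
    nextΓ Γ = Γ + (Γ + Γ + 1ℚ) * κ * pow2 p

    widthsB : ∀ {n} → ℚ → Vec ℚ n → Vec ℚ n
    widthsB Γ = Vec.map (λ x → Γ + 1ℚ - x)

    carry : ∀ {n} → ℚ → Bool → ℚ → Vec ℚ n → Vec ℚ n
    carry Γ s x g = g ⊖ (sg s * (Γ + 1ℚ - x) * κ) ⊙ dv p _

    widths : ∀ r → Vec Bool (suc (r ℕ.+ p)) → Vec ℚ (suc (r ℕ.+ p)) → ℚ → Vec ℚ (suc (r ℕ.+ p))
    widths zero σ g Γ = widthsB Γ g
    widths (suc r) (s ∷ σ) (x ∷ g) Γ = Γ + 1ℚ - x ∷ widths r σ (carry Γ s x g) (nextΓ Γ)

    top : ∀ {A : Set} r → Vec A (suc (r ℕ.+ p)) → Vec A (suc p)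
    top zero v = v
    top (suc r) (_ ∷ v) = top r v

    -- The vertices are chosen such that the functional a takes the value Σ bᵢ|wᵢ| − Σ yᵢ(|wᵢ| − σᵢwᵢ) at the vertex σ,
    -- where w solves the system with initial values a; g carries the coefficients of |w| left over by newer equations.
    vertex : ∀ r → Vec Bool (suc (r ℕ.+ p)) → Vec ℚ (suc (r ℕ.+ p)) → ℚ → Vec ℚ (suc p)
    vertex r σ g Γ = signed (top r σ) (top r (widths r σ g Γ))

    height : ∀ r → ℚ → Vec ℚ (suc (r ℕ.+ p)) → ℚ
    height zero Γ l = dot (Vec.replicate _ (Γ + 1ℚ)) l
    height (suc r) Γ (x ∷ l) = (Γ + 1ℚ) * x + height r (nextΓ Γ) l

    widthsB-dot : ∀ {n} Γ (g l : Vec ℚ n) → dot (widthsB Γ g) l + dot g l ≡ dot (Vec.replicate n (Γ + 1ℚ)) l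
    widthsB-dot Γ [] [] = refl
    widthsB-dot Γ (x ∷ g) (y ∷ l) = trans (solve 5 (λ Γ x y a b → ((Γ :+ con 1ℚ :- x) :* y :+ a) :+ (x :* y :+ b) := (Γ :+ con 1ℚ) :* y :+ (a :+ b)) refl Γ x y (dot (widthsB Γ g) l) (dot g l))
      (cong ((Γ + 1ℚ) * y +_) (widthsB-dot Γ g l))

    -- Induction from the newest entry x. By its equation, the signed term in x is a linear
    -- combination of the values `lam` at the older entries; `carry` subtracts exactly this
    -- combination, so the choice of σ shows only in the slack.
    vertex-identity : ∀ r c w σ g Γ → Sys r c w →
      dot (oldest r w) (vertex r σ g Γ) + dot g (lam c w) ≡ height r Γ (lam c w) - slackV (widths r σ g Γ) σ c w
    vertex-identity zero c w σ g Γ _ = trans (cong (_+ dot g (lam c w)) (signed-slack (widthsB Γ g) σ c w))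
      (trans (solve 3 (λ a s b → (a :- s) :+ b := (a :+ b) :- s) refl (dot (widthsB Γ g) (lam c w)) (slackV (widthsB Γ g) σ c w) (dot g (lam c w)))
        (cong (_- slackV (widthsB Γ g) σ c w) (widthsB-dot Γ g (lam c w))))
    vertex-identity (suc r) (t ∷ c) (x ∷ w) (s ∷ σ) (y ∷ g) Γ (e , sys) = step
      (dot (oldest r w) (vertex r σ g′ Γ′)) (dot g l) (dot g′ l) (height r Γ′ l) (slackV (widths r σ g′ Γ′) σ c w) (ab t x)
      (vertex-identity r c w σ g′ Γ′ sys) carried
      where
      Γ′ = nextΓ Γ
      Y = Γ + 1ℚ - y
      g′ = carry Γ s y g
      l = lam c w
      carried : dot g′ l ≡ dot g l - sg s * Y * x
      carried = trans (dot-⊖ˡ g ((sg s * Y * κ) ⊙ dv p _) l) (cong (λ z → dot g l - z)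
        (trans (dot-⊙ˡ (sg s * Y * κ) (dv p _) l) (trans (*-assoc (sg s * Y) κ (dot (dv p _) l)) (cong (sg s * Y *_)
          (trans (cong (κ *_) (dv-dif p l)) (sym e))))))
      step : ∀ V D D′ H S a → V + D′ ≡ H - S → D′ ≡ D - sg s * Y * x → V + (y * a + D) ≡ ((Γ + 1ℚ) * a + H) - (Y * (a - sg s * x) + S)
      step V D D′ H S a e₁ e₂ = trans (solve 7 (λ V D y a s Y x → V :+ (y :* a :+ D) := (V :+ (D :- s :* Y :* x)) :+ s :* Y :* x :+ y :* a) refl V D y a (sg s) Y x)
        (trans (cong (λ z → z + sg s * Y * x + y * a) (trans (cong (V +_) (sym e₂)) e₁))
          (solve 7 (λ H S s Γ y x a → (H :- S) :+ s :* (Γ :+ con 1ℚ :- y) :* x :+ y :* a := ((Γ :+ con 1ℚ) :* a :+ H) :- ((Γ :+ con 1ℚ :- y) :* (a :- s :* x) :+ S)) refl H S (sg s) Γ y x a))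

    width>0 : ∀ {Γ x} → ∣ x ∣ ≤ Γ → 0ℚ < Γ + 1ℚ - x
    width>0 {Γ} {x} h = subst (0ℚ <_) (solve 2 (λ Γ x → (Γ :- x) :+ con 1ℚ := Γ :+ con 1ℚ :- x) refl Γ x)
      (0≤+< (diff≥0 (≤-trans (x≤∣x∣ x) h)) 0<1)

    carry-Bd : ∀ {n Γ} s x (g : Vec ℚ n) → ∣ x ∣ ≤ Γ → Bd Γ g → Bd (nextΓ Γ) (carry Γ s x g)
    carry-Bd {Γ = Γ} s x g h b = Bd-⊖ g ((sg s * (Γ + 1ℚ - x) * κ) ⊙ dv p _) b (Bd-⊙ (sg s * (Γ + 1ℚ - x) * κ) (dv p _) bound (pow2≥0 p) (dv-Bd p _))
      where
      bound : ∣ sg s * (Γ + 1ℚ - x) * κ ∣ ≤ (Γ + Γ + 1ℚ) * κ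
      bound = ≤-trans (≤-reflexive (trans (∣p*q∣≡∣p∣*∣q∣ (sg s * (Γ + 1ℚ - x)) κ)
           (cong₂ _*_ (trans (∣sg∣ s (Γ + 1ℚ - x)) (0≤p⇒∣p∣≡p (<⇒≤ (width>0 h)))) (0≤p⇒∣p∣≡p (<⇒≤ κ>0)))))
        (*-monoʳ-≤-nonNeg κ ⦃ nonNegative (<⇒≤ κ>0) ⦄ (le-cert {Γ + 1ℚ - x} {Γ + Γ + 1ℚ} (Γ - - x) (diff≥0 (≤-trans (-x≤∣x∣ x) h))
          (solve 2 (λ Γ x → (Γ :+ con 1ℚ :- x) :+ (Γ :- (:- x)) := Γ :+ Γ :+ con 1ℚ) refl Γ x)))

    widths-pos : ∀ r σ g Γ → Bd Γ g → Pos (widths r σ g Γ)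
    widths-pos zero σ g Γ b = go g b
      where
      go : ∀ {n} (g : Vec ℚ n) → Bd Γ g → Pos (widthsB Γ g)
      go [] [] = []
      go (x ∷ g) (b ∷ bs) = width>0 b ∷ go g bs
    widths-pos (suc r) (s ∷ σ) (x ∷ g) Γ (b ∷ bs) = width>0 b ∷ widths-pos r σ (carry Γ s x g) (nextΓ Γ) (carry-Bd s x g b bs)

    P : ∀ r → Vec Bool (suc (r ℕ.+ p)) → Vec ℚ (suc p)
    P r σ = vertex r σ 𝟎 0ℚ

    W : ∀ r → Vec Bool (suc (r ℕ.+ p)) → Vec ℚ (suc (r ℕ.+ p))
    W r σ = widths r σ 𝟎 0ℚ

    W-pos : ∀ r σ → Pos (W r σ)
    W-pos r σ = widths-pos r σ 𝟎 0ℚ (Bd-𝟎 _ ≤-refl)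

    P-identity : ∀ r c w σ → Sys r c w → dot (oldest r w) (P r σ) ≡ height r 0ℚ (lam c w) - slackV (W r σ) σ c w
    P-identity r c w σ sys = trans (sym (+-identityʳ _)) (trans (cong (dot (oldest r w) (P r σ) +_) (sym (dot-𝟎ˡ (lam c w)))) (vertex-identity r c w σ 𝟎 0ℚ sys))

    maxPattern : ∀ r c w → Sys r c w → MaxOn (λ σ → dot (oldest r w) (P r σ)) c (restrict c w) (height r 0ℚ (lam c w))
    maxPattern r c w sys = maxOn _ (W r) c w _ (W-pos r) (λ σ _ → P-identity r c w σ sys)

    -- This bounds the dimension of a cube face by its number of free entries. Widths depend
    -- affinely on the carried coefficients, and these on the signed widths at newer positions.
    -- Where the sign is fixed, the signed width is a constant multiple of the width, so every
    -- affine relation valid at the free positions propagates to all coordinates.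
    affine-relation : ∀ {k} r c (σ : Fin k → Vec Bool (suc (r ℕ.+ p))) → (∀ j → σ j ∈c c) → (l : Vec ℚ k) →
      dot l (Vec.replicate k 1ℚ) ≡ 0ℚ →
      (∀ i → dot l (Vec.tabulate (λ j → lookup (signed (σ j) (W r (σ j))) (freeAt c i))) ≡ 0ℚ) →
      ∀ i → dot l (Vec.tabulate (λ j → lookup (P r (σ j)) i)) ≡ 0ℚ
    affine-relation {k} r c σ mem l l1 lf = go r c σ (λ _ → 𝟎) 0ℚ mem lf (λ i → trans (cong (dot l) (tab-0 i)) (dot-𝟎ʳ l))
      where
      rel : (Fin k → ℚ) → ℚ
      rel f = dot l (Vec.tabulate f)
      tab-cong : ∀ {m} {f g : Fin m → ℚ} → (∀ j → f j ≡ g j) → Vec.tabulate f ≡ Vec.tabulate g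
      tab-cong h = VecP.tabulate-cong h
      tab-0 : ∀ {m} (i : Fin m) → Vec.tabulate {n = k} (λ _ → lookup (𝟎 {m}) i) ≡ 𝟎
      tab-0 i = trans (tab-cong (λ _ → VecP.lookup-replicate i 0ℚ)) (tabulate-const k 0ℚ)
      rel-1 : rel (λ _ → 1ℚ) ≡ 0ℚ
      rel-1 = trans (cong (dot l) (tabulate-const k 1ℚ)) l1
      rel-affine : ∀ Γ (f : Fin k → ℚ) → rel f ≡ 0ℚ → rel (λ j → Γ + 1ℚ - f j) ≡ 0ℚ
      rel-affine Γ f h = trans (cong (dot l) (tab-cong (λ j → solve 2 (λ Γ x → Γ :+ con 1ℚ :- x := (Γ :+ con 1ℚ) :* con 1ℚ :+ con (- 1ℚ) :* x) refl Γ (f j))))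
        (trans (dot-tab-+ l _ _) (trans (cong₂ _+_ (trans (dot-tab-* l (Γ + 1ℚ) (λ _ → 1ℚ)) (trans (cong ((Γ + 1ℚ) *_) rel-1) (*-zeroʳ (Γ + 1ℚ))))
           (trans (dot-tab-* l (- 1ℚ) f) (trans (cong (- 1ℚ *_) h) refl))) refl))
      rel-signed : ∀ {n} (c : Vec Tri n) (τ : Fin k → Vec Bool n) (y : Fin k → Vec ℚ n) → (∀ j → τ j ∈c c) →
        (∀ i → rel (λ j → lookup (signed (τ j) (y j)) (freeAt c i)) ≡ 0ℚ) → (∀ i → rel (λ j → lookup (y j) i) ≡ 0ℚ) → ∀ i → rel (λ j → lookup (signed (τ j) (y j)) i) ≡ 0ℚ
      go1 : ∀ {n} t (c : Vec Tri n) (τ : Fin k → Vec Bool (suc n)) (y : Fin k → Vec ℚ (suc n)) → (∀ j → τ j ∈c (t ∷ c)) →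
        (∀ i → rel (λ j → lookup (signed (τ j) (y j)) (freeAt (t ∷ c) i)) ≡ 0ℚ) → rel (λ j → lookup (y j) zero) ≡ 0ℚ →
        (rel (λ j → lookup (signed (τ j) (y j)) zero) ≡ 0ℚ) ×
        (∀ i → rel (λ j → lookup (signed (Vec.tail (τ j)) (Vec.tail (y j))) (freeAt c i)) ≡ 0ℚ)
      shift : ∀ {n} (τ : Vec Bool (suc n)) y i → lookup (signed τ y) (suc i) ≡ lookup (signed (Vec.tail τ) (Vec.tail y)) i
      shift (_ ∷ _) (_ ∷ _) i = refl
      head-signed : ∀ {n} (τ : Vec Bool (suc n)) y → lookup (signed τ y) zero ≡ sg (Vec.head τ) * lookup y zero
      head-signed (_ ∷ _) (_ ∷ _) = refl
      head-match : ∀ {n t} {τ : Vec Bool (suc n)} {c} → τ ∈c (t ∷ c) → Match (Vec.head τ) t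
      head-match (m ∷ _) = m
      tail-match : ∀ {n t} {τ : Vec Bool (suc n)} {c} → τ ∈c (t ∷ c) → Vec.tail τ ∈c c
      tail-match (_ ∷ m) = m
      fixed-head : ∀ {n} s (τ : Fin k → Vec Bool (suc n)) (y : Fin k → Vec ℚ (suc n)) → (∀ j → Vec.head (τ j) ≡ s) → rel (λ j → lookup (y j) zero) ≡ 0ℚ → rel (λ j → lookup (signed (τ j) (y j)) zero) ≡ 0ℚ
      fixed-head s τ y h z = trans (cong (dot l) (tab-cong (λ j → trans (head-signed (τ j) (y j)) (cong (λ s → sg s * lookup (y j) zero) (h j)))))
        (trans (dot-tab-* l (sg s) (λ j → lookup (y j) zero)) (trans (cong (sg s *_) z) (*-zeroʳ (sg s))))
      match1 : ∀ {s} → Match s fix1 → s ≡ true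
      match1 {true} _ = refl
      match0 : ∀ {s} → Match s fix0 → s ≡ false
      match0 {false} _ = refl
      go1 free c τ y m f z = f zero , (λ i → trans (cong (dot l) (tab-cong (λ j → sym (shift (τ j) (y j) (freeAt c i))))) (f (suc i)))
      go1 fix0 c τ y m f z = fixed-head false τ y (λ j → match0 (head-match (m j))) z , (λ i → trans (cong (dot l) (tab-cong (λ j → sym (shift (τ j) (y j) (freeAt c i))))) (f i))
      go1 fix1 c τ y m f z = fixed-head true τ y (λ j → match1 (head-match (m j))) z , (λ i → trans (cong (dot l) (tab-cong (λ j → sym (shift (τ j) (y j) (freeAt c i))))) (f i))
      rel-signed (t ∷ c) τ y m f z zero = proj₁ (go1 t c τ y m f (z zero))
      rel-signed (t ∷ c) τ y m f z (suc i) = trans (cong (dot l) (tab-cong (λ j → shift (τ j) (y j) i)))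
        (rel-signed c (λ j → Vec.tail (τ j)) (λ j → Vec.tail (y j)) (λ j → tail-match (m j)) (proj₂ (go1 t c τ y m f (z zero)))
          (λ i → trans (cong (dot l) (tab-cong (λ j → tail-lookup (y j) i))) (z (suc i))) i)
        where tail-lookup : ∀ {n} (y : Vec ℚ (suc n)) i → lookup (Vec.tail y) i ≡ lookup y (suc i)
              tail-lookup (_ ∷ _) i = refl
      go : ∀ r c (σ : Fin k → Vec Bool (suc (r ℕ.+ p))) (g : Fin k → Vec ℚ (suc (r ℕ.+ p))) Γ → (∀ j → σ j ∈c c) →
        (∀ i → rel (λ j → lookup (signed (σ j) (widths r (σ j) (g j) Γ)) (freeAt c i)) ≡ 0ℚ) →
        (∀ i → rel (λ j → lookup (g j) i) ≡ 0ℚ) → ∀ i → rel (λ j → lookup (vertex r (σ j) (g j) Γ) i) ≡ 0ℚ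
      go zero c σ g Γ m f z i = rel-signed c σ (λ j → widthsB Γ (g j)) m f
        (λ i → trans (cong (dot l) (tab-cong (λ j → VecP.lookup-map i _ (g j)))) (rel-affine Γ (λ j → lookup (g j) i) (z i))) i
      go (suc r) (t ∷ c) σ g Γ m f z i = trans (cong (dot l) (tab-cong (λ j → cong (λ v → lookup v i) (vertex-suc (σ j) (g j)))))
        (go r c (λ j → Vec.tail (σ j)) g′ (nextΓ Γ) (λ j → tail-match (m j)) f′ z′ i)
        where
        X : Fin k → ℚ
        X j = sg (Vec.head (σ j)) * (Γ + 1ℚ - Vec.head (g j))
        g′ : Fin k → Vec ℚ (suc (r ℕ.+ p))
        g′ j = carry Γ (Vec.head (σ j)) (Vec.head (g j)) (Vec.tail (g j))
        vertex-suc : ∀ (σ : Vec Bool (suc (suc (r ℕ.+ p)))) g → vertex (suc r) σ g Γ ≡ vertex r (Vec.tail σ) (carry Γ (Vec.head σ) (Vec.head g) (Vec.tail g)) (nextΓ Γ)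
        vertex-suc (s ∷ σ) (x ∷ g) = refl
        widths-suc : ∀ (σ : Vec Bool (suc (suc (r ℕ.+ p)))) g → widths (suc r) σ g Γ ≡ (Γ + 1ℚ - Vec.head g) ∷ widths r (Vec.tail σ) (carry Γ (Vec.head σ) (Vec.head g) (Vec.tail g)) (nextΓ Γ)
        widths-suc (s ∷ σ) (x ∷ g) = refl
        y : Fin k → Vec ℚ (suc (suc (r ℕ.+ p)))
        y j = (Γ + 1ℚ - Vec.head (g j)) ∷ widths r (Vec.tail (σ j)) (g′ j) (nextΓ Γ)
        lookup-head : ∀ {n} (v : Vec ℚ (suc n)) → lookup v zero ≡ Vec.head v
        lookup-head (_ ∷ _) = refl
        lookup-tail : ∀ {n} (v : Vec ℚ (suc n)) i → lookup v (suc i) ≡ lookup (Vec.tail v) i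
        lookup-tail (_ ∷ _) i = refl
        split = go1 t c σ y m (λ i → trans (cong (dot l) (tab-cong (λ j → cong (λ v → lookup (signed (σ j) v) (freeAt (t ∷ c) i)) (sym (widths-suc (σ j) (g j)))))) (f i))
          (rel-affine Γ (λ j → Vec.head (g j)) (trans (cong (dot l) (tab-cong (λ j → sym (lookup-head (g j))))) (z zero)))
        f′ = proj₂ split
        relX : rel X ≡ 0ℚ
        relX = trans (cong (dot l) (tab-cong (λ j → sym (head-signed (σ j) (y j))))) (proj₁ split)
        z′ : ∀ i → rel (λ j → lookup (g′ j) i) ≡ 0ℚ
        z′ i = trans (cong (dot l) (tab-cong (λ j → trans (VecP.lookup-zipWith _-_ i (Vec.tail (g j)) ((X j * κ) ⊙ dv p _))
              (trans (cong₂ _-_ (sym (lookup-tail (g j) i)) (VecP.lookup-map i (X j * κ *_) (dv p _)))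
                (solve 4 (λ a x κ d → a :- x :* κ :* d := a :+ (:- (κ :* d)) :* x) refl (lookup (g j) (suc i)) (X j) κ (lookup (dv p _) i))))))
          (trans (dot-tab-+ l _ _) (trans (cong₂ _+_ (z (suc i)) (trans (dot-tab-* l (- (κ * lookup (dv p _) i)) X) (trans (cong (- (κ * lookup (dv p _) i) *_) relX) (*-zeroʳ (- (κ * lookup (dv p _) i)))))) refl))

  -- Faces and dimensions

  sumℚ-cong : ∀ {f g : Fin n → ℚ} → (∀ i → f i ≡ g i) → sumℚ f ≡ sumℚ g
  sumℚ-cong {zero} h = refl
  sumℚ-cong {suc n} h = cong₂ _+_ (h zero) (sumℚ-cong (h ∘ suc))

  sumℚ-+ : ∀ (f g : Fin n → ℚ) → sumℚ (λ i → f i + g i) ≡ sumℚ f + sumℚ g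
  sumℚ-+ {zero} f g = refl
  sumℚ-+ {suc n} f g = trans (cong (f zero + g zero +_) (sumℚ-+ (f ∘ suc) (g ∘ suc)))
    (solve 4 (λ a b c d → (a :+ b) :+ (c :+ d) := (a :+ c) :+ (b :+ d)) refl (f zero) (g zero) (sumℚ (f ∘ suc)) (sumℚ (g ∘ suc)))

  sumℚ-* : ∀ t (f : Fin n → ℚ) → sumℚ (λ i → t * f i) ≡ t * sumℚ f
  sumℚ-* {zero} t f = sym (*-zeroʳ t)
  sumℚ-* {suc n} t f = trans (cong (t * f zero +_) (sumℚ-* t (f ∘ suc))) (sym (*-distribˡ-+ t (f zero) (sumℚ (f ∘ suc))))

  sumℚ-0 : ∀ n → sumℚ {n} (λ _ → 0ℚ) ≡ 0ℚ
  sumℚ-0 zero = refl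
  sumℚ-0 (suc n) = trans (+-identityˡ _) (sumℚ-0 n)

  sumℚ-swap : ∀ (f : Fin m → Fin n → ℚ) → sumℚ (λ i → sumℚ (f i)) ≡ sumℚ (λ j → sumℚ (λ i → f i j))
  sumℚ-swap {zero} {n} f = sym (sumℚ-0 n)
  sumℚ-swap {suc m} f = trans (cong (sumℚ (f zero) +_) (sumℚ-swap (f ∘ suc))) (sym (sumℚ-+ (f zero) (λ j → sumℚ (λ i → f (suc i) j))))

  sumℚ-dot : ∀ (u v : Vec ℚ n) → sumℚ (λ i → lookup u i * lookup v i) ≡ dot u v
  sumℚ-dot [] [] = refl
  sumℚ-dot (x ∷ u) (y ∷ v) = cong (x * y +_) (sumℚ-dot u v)

  ·-dot : ∀ (a : Point n) (v : Vec ℚ n) → a · lookup v ≡ dot (tabulate a) v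
  ·-dot a v = trans (sumℚ-cong (λ i → cong (_* lookup v i) (sym (VecP.lookup∘tabulate a i)))) (sumℚ-dot (tabulate a) v)

  ·-combination : ∀ {d} (a : Point d) (l : Fin k → ℚ) (p : Fin k → Point d) →
    (∀ i → sumℚ (λ j → l j * p j i) ≡ 0ℚ) → sumℚ (λ j → l j * (a · p j)) ≡ 0ℚ
  ·-combination {k} {d} a l p h = trans (sumℚ-cong (λ j → trans (sym (sumℚ-* (l j) (λ i → a i * p j i))) (sumℚ-cong (λ i →
       solve 3 (λ l a p → l :* (a :* p) := a :* (l :* p)) refl (l j) (a i) (p j i)))))
    (trans (sumℚ-swap {k} {d} (λ j i → a i * (l j * p j i))) (trans (sumℚ-cong {d} (λ i →
       trans (sumℚ-* (a i) (λ j → l j * p j i)) (trans (cong (a i *_) (h i)) (*-zeroʳ (a i))))) (sumℚ-0 d)))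

  *-zero-cancel : ∀ x y → x * y ≡ 0ℚ → y ≢ 0ℚ → x ≡ 0ℚ
  *-zero-cancel x y e h = let z , zy = ≢0⇒inv y h in
    trans (sym (*-identityʳ x)) (trans (cong (x *_) (sym zy)) (trans (solve 3 (λ x z y → x :* (z :* y) := x :* y :* z) refl x z y) (trans (cong (_* z) e) (*-zeroˡ z))))

  affIndep-extend : ∀ {d} (p : Fin (suc k) → Point d) a c → (∀ j → a · p (suc j) ≡ c) → a · p zero ≢ c → AffIndep (p ∘ suc) → AffIndep p
  affIndep-extend {k} p a c on off ind l s z = λ { zero → l0 ; (suc j) → rest j }
    where
    gap≢0 : a · p zero - c ≢ 0ℚ
    gap≢0 e = off (trans (solve 2 (λ x c → x := (x :- c) :+ c) refl (a · p zero) c) (trans (cong (_+ c) e) (+-identityˡ c)))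
    total : sumℚ (λ j → l j * (a · p j)) - c * sumℚ l ≡ 0ℚ
    total = trans (cong₂ (λ x y → x - c * y) (·-combination a l p z) s) (solve 1 (λ c → con 0ℚ :- c :* con 0ℚ := con 0ℚ) refl c)
    l0 : l zero ≡ 0ℚ
    l0 = *-zero-cancel (l zero) (a · p zero - c) (trans
      (trans (solve 4 (λ l x c s → l :* (x :- c) := (l :* x :+ s :* c) :- c :* (l :+ s)) refl (l zero) (a · p zero) c (sumℚ (l ∘ suc)))
        (cong (λ w → (l zero * (a · p zero) + w) - c * (l zero + sumℚ (l ∘ suc))) (sym tl))) total) gap≢0
      where
      tl : sumℚ (λ j → l (suc j) * (a · p (suc j))) ≡ sumℚ (l ∘ suc) * c
      tl = trans (sumℚ-cong (λ j → trans (cong (l (suc j) *_) (on j)) (*-comm (l (suc j)) c))) (trans (sumℚ-* c (l ∘ suc)) (*-comm c _))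
    drop0 : ∀ (f : Fin k → ℚ) x → l zero * x + sumℚ f ≡ 0ℚ → sumℚ f ≡ 0ℚ
    drop0 f x e = trans (sym (trans (cong (λ w → w * x + sumℚ f) l0) (trans (cong (_+ sumℚ f) (*-zeroˡ x)) (+-identityˡ (sumℚ f))))) e
    rest : ∀ j → l (suc j) ≡ 0ℚ
    rest = ind (l ∘ suc) (drop0 (l ∘ suc) 1ℚ (trans (cong (_+ sumℚ (l ∘ suc)) (*-identityʳ (l zero))) s)) (λ i → drop0 _ (p zero i) (z i))

  affIndep-tail : ∀ {d} (p : Fin (suc k) → Point d) → AffIndep p → AffIndep (p ∘ suc)
  affIndep-tail {k} p ind l s z j = ind l′ (trans (+-identityˡ _) s) (λ i → trans (cong (_+ sumℚ (λ j → l j * p (suc j) i)) (*-zeroˡ (p zero i))) (trans (+-identityˡ _) (z i))) (suc j)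
    where
    l′ : Fin (suc k) → ℚ
    l′ zero = 0ℚ
    l′ (suc j) = l j

  module Faces {d m : ℕ} (V : Config d m) where

    Exposes : Subset m → Point d → ℚ → Set
    Exposes S a c = (∀ j → a · V j ≤ c) × (∀ j → (j ∈ S) ⇔ (a · V j ≡ c))

    dim-point : ∀ {S j} → j ∈ S → DimAtLeast V S 0
    dim-point {S} {j} h = (λ _ → j) , (λ _ → h) , λ { l s _ zero → trans (sym (+-identityʳ (l zero))) s }

    dim-extend : ∀ {S S′ k a c j} → S ⊆ S′ → Exposes S a c → j ∈ S′ → j ∉ S → DimAtLeast V S k → DimAtLeast V S′ (suc k)
    dim-extend {S} {S′} {k} {a} {c} {j} sub (_ , ex) j∈ j∉ (ι , mem , ind) = ι′ , mem′ ,
        affIndep-extend (V ∘ ι′) a c (λ i → proj₁ (ex (ι i)) (mem i)) (λ e → j∉ (proj₂ (ex j) e)) ind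
      where
      ι′ : Fin (suc (suc k)) → Fin m
      ι′ zero = j
      ι′ (suc i) = ι i
      mem′ : ∀ i → ι′ i ∈ S′
      mem′ zero = j∈
      mem′ (suc i) = sub (mem i)

    dim-pred : ∀ {S k} → DimAtLeast V S (suc k) → DimAtLeast V S k
    dim-pred (ι , mem , ind) = ι ∘ suc , mem ∘ suc , affIndep-tail (V ∘ ι) ind

    dim-mono : ∀ {S j k} → j ℕ.≤ k → DimAtLeast V S k → DimAtLeast V S j
    dim-mono {k = k} h D with ℕP.m≤n⇒m<n∨m≡n h
    dim-mono {k = suc k} h D | inj₁ (s≤s h′) = dim-mono h′ (dim-pred D)
    ... | inj₂ refl = D

    dim-unique : ∀ {S j k} → HasDim V S j → HasDim V S k → j ≡ k
    dim-unique {S} {j} {k} (Dj , nj) (Dk , nk) with ℕP.<-cmp j k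
    ... | tri< h _ _ = ⊥-elim (nj (dim-mono h Dk))
    ... | tri≈ _ e _ = e
    ... | tri> _ _ h = ⊥-elim (nk (dim-mono h Dj))

    -- Among k + 2 points there is a nontrivial relation that annihilates the constant 1 and the k
    -- functions `φ`; by assumption it annihilates the coordinates too.
    dim-upper : ∀ {S} k (φ : Fin k → Fin m → ℚ) →
      (∀ (ι : Fin (suc (suc k)) → Fin m) → (∀ j → ι j ∈ S) → ∀ (l : Vec ℚ (suc (suc k))) → dot l (Vec.replicate _ 1ℚ) ≡ 0ℚ →
         (∀ i → dot l (tabulate (λ j → φ i (ι j))) ≡ 0ℚ) → ∀ i → dot l (tabulate (λ j → V (ι j) i)) ≡ 0ℚ) →
      ¬ DimAtLeast V S (suc k)
    dim-upper {S} k φ dep (ι , mem , ind) = proj₁ (proj₂ nv) (allzero (proj₁ nv) (ind (lookup l) (trans (sumℚ-cong (λ j → sym (*-identityʳ (lookup l j))))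
        (trans (as-dot l (λ _ → 1ℚ)) (trans (cong (dot l) (ones _)) (eqs zero)))) (λ i → trans (as-dot l (λ j → V (ι j) i)) (dep ι mem l (eqs zero) (λ i → eqs (suc i)) i))))
      where
      coord : Fin (suc k) → Vec ℚ (suc (suc k))
      coord zero = Vec.replicate _ 1ℚ
      coord (suc i) = tabulate (λ j → φ i (ι j))
      nv = nullvec (λ i l → dot (coord i) l) (λ i → LinF-dot (coord i))
      l = proj₁ nv
      eqs : ∀ i → dot l (coord i) ≡ 0ℚ
      eqs i = trans (dot-comm l (coord i)) (proj₂ (proj₂ nv) i)
      as-dot : ∀ {n} (l : Vec ℚ n) (f : Fin n → ℚ) → sumℚ (λ j → lookup l j * f j) ≡ dot l (tabulate f)
      as-dot l f = trans (sumℚ-cong (λ j → cong (lookup l j *_) (sym (VecP.lookup∘tabulate f j)))) (sumℚ-dot l (tabulate f))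
      ones : ∀ n → tabulate {n = n} (λ _ → 1ℚ) ≡ Vec.replicate n 1ℚ
      ones zero = refl
      ones (suc n) = cong (1ℚ ∷_) (ones n)
      allzero : ∀ {n} (v : Vec ℚ n) → (∀ j → lookup v j ≡ 0ℚ) → v ≡ 𝟎
      allzero [] h = refl
      allzero (x ∷ v) h = cong₂ _∷_ (h zero) (allzero v (h ∘ suc))

  min-positive : ∀ {n} (f : Fin n → ℚ) → (∀ j → 0ℚ < f j) → Σ ℚ λ δ → (0ℚ < δ) × (∀ j → δ ≤ f j)
  min-positive {zero} f h = 1ℚ , 0<1 , λ ()
  min-positive {suc n} f h with min-positive (f ∘ suc) (h ∘ suc)
  ... | δ , δ>0 , le with ≤-total (f zero) δ
  ... | inj₁ k = f zero , h zero , λ { zero → ≤-refl ; (suc j) → ≤-trans k (le j) }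
  ... | inj₂ k = δ , δ>0 , λ { zero → k ; (suc j) → le j }

  upper-bound : ∀ {n} (f : Fin n → ℚ) → Σ ℚ λ b → (0ℚ ≤ b) × (∀ j → f j ≤ b)
  upper-bound {zero} f = 0ℚ , ≤-refl , λ ()
  upper-bound {suc n} f = let b , b≥0 , le = upper-bound (f ∘ suc) in
    f zero ⊔ b , ≤-trans b≥0 (p≤q⊔p (f zero) b) , λ { zero → p≤p⊔q (f zero) b ; (suc j) → ≤-trans (le j) (p≤q⊔p (f zero) b) }

  ·-perturb : ∀ {d} (a b x : Point d) δ → (λ i → a i + δ * b i) · x ≡ a · x + δ * (b · x)
  ·-perturb a b x δ = trans (sumℚ-cong (λ i → solve 4 (λ a b x δ → (a :+ δ :* b) :* x := a :* x :+ δ :* (b :* x)) refl (a i) (b i) (x i) δ))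
    (trans (sumℚ-+ (λ i → a i * x i) (λ i → δ * (b i * x i))) (cong (sumℚ (λ i → a i * x i) +_) (sumℚ-* δ (λ i → b i * x i))))

  module FaceOfFace {d m : ℕ} (V : Config d m) where

    open Faces V

    -- Perturb the outer functional by a small multiple of the inner one.
    face-of-face : ∀ {S S′ a c b v} → Exposes S a c → S′ ⊆ S → (∀ {j} → j ∈ S′ → b · V j ≡ v) →
      (∀ {j} → j ∈ S → j ∉ S′ → b · V j < v) → Σ (Point d) λ e → Σ ℚ λ f → Exposes S′ e f
    face-of-face {S} {S′} {a} {c} {b} {v} (le , ex) sub on off = e , c + δ * v , (λ j → bound j) , λ j → fwd j , bwd j
      where
      U = proj₁ (upper-bound (λ j → b · V j - v))
      U≥0 = proj₁ (proj₂ (upper-bound (λ j → b · V j - v)))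
      U-le : ∀ j → b · V j - v ≤ U
      U-le = proj₂ (proj₂ (upper-bound (λ j → b · V j - v)))
      slack : Fin m → ℚ
      slack j with a · V j <? c
      ... | yes _ = c - a · V j
      ... | no _ = 1ℚ
      slack>0 : ∀ j → 0ℚ < slack j
      slack>0 j with a · V j <? c
      ... | yes h = diff>0 h
      ... | no _ = 0<1
      slack-eq : ∀ j → a · V j < c → slack j ≡ c - a · V j
      slack-eq j h with a · V j <? c
      ... | yes _ = refl
      ... | no k = ⊥-elim (k h)
      mp = min-positive slack slack>0
      μ = proj₁ mp
      inv = >0⇒inv (U + 1ℚ) (0≤+< U≥0 0<1)
      y = proj₁ inv
      y>0 = proj₂ (proj₂ inv)
      δ = y * μ
      δ>0 : 0ℚ < δ
      δ>0 = 0<* y>0 (proj₁ (proj₂ mp))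
      e : Point d
      e i = a i + δ * b i
      δU<μ : δ * U < μ
      δU<μ = lt-cert δ δ>0 (trans (solve 3 (λ y μ U → y :* μ :* U :+ y :* μ := y :* (U :+ con 1ℚ) :* μ) refl y μ U)
        (trans (cong (_* μ) (proj₁ (proj₂ inv))) (*-identityˡ μ)))
      outside : ∀ j → j ∉ S → e · V j < c + δ * v
      outside j j∉ = subst (_< c + δ * v) (sym (·-perturb a b (V j) δ)) (lt-cert ((c - a · V j - δ * U) + δ * (U - (b · V j - v)))
          (0<+≤ (diff>0 (<-≤-trans δU<μ (subst (μ ≤_) (slack-eq j a<) (proj₂ (proj₂ mp) j)))) (0≤* (<⇒≤ δ>0) (diff≥0 (U-le j))))
          (solve 6 (λ A D B C U v → (A :+ D :* B) :+ ((C :- A :- D :* U) :+ D :* (U :- (B :- v))) := C :+ D :* v) refl (a · V j) δ (b · V j) c U v))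
        where
        a< : a · V j < c
        a< with a · V j <? c
        ... | yes h = h
        ... | no h = ⊥-elim (j∉ (proj₂ (ex j) (≤-antisym (le j) (≮⇒≥ h))))
      inside : ∀ j → j ∈ S → j ∉ S′ → e · V j < c + δ * v
      inside j j∈ j∉ = subst (_< c + δ * v) (sym (trans (·-perturb a b (V j) δ) (cong (_+ δ * (b · V j)) (proj₁ (ex j) j∈)))) (+-monoʳ-< c (*-monoʳ-<-pos δ ⦃ positive δ>0 ⦄ (off j∈ j∉)))
      fwd : ∀ j → j ∈ S′ → e · V j ≡ c + δ * v
      fwd j h = trans (·-perturb a b (V j) δ) (cong₂ (λ x y → x + δ * y) (proj₁ (ex j) (sub h)) (on h))
      strict : ∀ j → j ∉ S′ → e · V j < c + δ * v
      strict j j∉ with SubP._∈?_ j S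
      ... | yes h = inside j h j∉
      ... | no h = outside j h
      bound : ∀ j → e · V j ≤ c + δ * v
      bound j with SubP._∈?_ j S′
      ... | yes h = ≤-reflexive (fwd j h)
      ... | no h = <⇒≤ (strict j h)
      bwd : ∀ j → e · V j ≡ c + δ * v → j ∈ S′
      bwd j h with SubP._∈?_ j S′
      ... | yes k = k
      ... | no k = ⊥-elim (<-irrefl h (strict j k))

  -- Fourier–Motzkin elimination.
  Con : ℕ → Set
  Con n = Vec ℚ n × ℚ

  Sat : Vec ℚ n → Con n → Set
  Sat x (a , b) = b ≤ dot a x

  Aff : ℕ → Set
  Aff n = Vec ℚ n × ℚ

  val : Aff n → Vec ℚ n → ℚ
  val (u , t) x = dot u x + t

  between : ∀ (Ls Us : List ℚ) → LAll.All (λ l → LAll.All (l ≤_) Us) Ls → Σ ℚ λ x → LAll.All (_≤ x) Ls × LAll.All (x ≤_) Us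
  between [] [] _ = 0ℚ , [] , []
  between [] (u ∷ Us) _ = let x , _ , h = between [] Us [] in u ⊓ x , [] , p⊓q≤p u x ∷ LAll.map (≤-trans (p⊓q≤q u x)) h
  between (l ∷ Ls) Us (h ∷ hs) = let x , ls , us = between Ls Us hs in
    l ⊔ x , p≤p⊔q l x ∷ LAll.map (λ k → ≤-trans k (p≤q⊔p l x)) ls , LAll.zipWith (λ { (p , q) → ⊔-lub p q }) (h , us)

  gapCon : Aff n → Aff n → Con n
  gapCon (u , t) (u′ , t′) = u′ ⊖ u , t - t′

  gapCon-sat : ∀ (l u : Aff n) x → (Sat x (gapCon l u) → val l x ≤ val u x) × (val l x ≤ val u x → Sat x (gapCon l u))
  gapCon-sat (u , t) (u′ , t′) x =
    (λ h → le-cert _ (diff≥0 (subst (t - t′ ≤_) (dot-⊖ˡ u′ u x) h)) (solve 4 (λ a t b s → (a :+ t) :+ ((b :- a) :- (t :- s)) := b :+ s) refl (dot u x) t (dot u′ x) t′)) ,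
    (λ h → subst (t - t′ ≤_) (sym (dot-⊖ˡ u′ u x)) (le-cert _ (diff≥0 h) (solve 4 (λ a t b s → (t :- s) :+ ((b :+ s) :- (a :+ t)) := b :- a) refl (dot u x) t (dot u′ x) t′)))

  record Split (n : ℕ) : Set where
    constructor split
    field
      rest : List (Con n)
      lows ups : List (Aff n)

  SatSplit : ℚ → Vec ℚ n → Split n → Set
  SatSplit x₀ x (split r l u) = LAll.All (Sat x) r × LAll.All (λ a → val a x ≤ x₀) l × LAll.All (λ a → x₀ ≤ val a x) u

  solveFor : ℚ → Con n → Aff n
  solveFor y (a , b) = (- y) ⊙ a , y * b

  val-solveFor : ∀ y (a : Vec ℚ n) b x → val (solveFor y (a , b)) x ≡ y * (b - dot a x)
  val-solveFor y a b x = trans (cong (_+ y * b) (dot-⊙ˡ (- y) a x)) (solve 3 (λ y d b → (:- y) :* d :+ y :* b := y :* (b :- d)) refl y (dot a x) b)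

  separate : List (Con (suc n)) → Split n
  separate [] = split [] [] []
  separate ((α ∷ a , b) ∷ cs) with <-cmp α 0ℚ | separate cs
  ... | tri< h _ _ | split r l u = split r l (solveFor (proj₁ (≢0⇒inv α (<⇒≢ h))) (a , b) ∷ u)
  ... | tri≈ _ _ _ | split r l u = split ((a , b) ∷ r) l u
  ... | tri> _ _ h | split r l u = split r (solveFor (proj₁ (≢0⇒inv α (λ e → <-irrefl (sym e) h))) (a , b) ∷ l) u

  separate-sat : ∀ (cs : List (Con (suc n))) x₀ x → (LAll.All (Sat (x₀ ∷ x)) cs → SatSplit x₀ x (separate cs)) × (SatSplit x₀ x (separate cs) → LAll.All (Sat (x₀ ∷ x)) cs)
  separate-sat [] x₀ x = (λ _ → [] , [] , []) , (λ _ → [])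
  separate-sat ((α ∷ a , b) ∷ cs) x₀ x with <-cmp α 0ℚ | separate cs | separate-sat cs x₀ x
  ... | tri< h _ _ | split r l u | f , g =
      (λ { (s ∷ ss) → let p , q , t = f ss in p , q , fwd s ∷ t }) , (λ { (p , q , (t ∷ ts)) → bwd t ∷ g (p , q , ts) })
    where
    y = proj₁ (≢0⇒inv α (<⇒≢ h))
    yα = proj₂ (≢0⇒inv α (<⇒≢ h))
    D = dot a x
    y≤0 : 0ℚ ≤ - y
    y≤0 with ≤-total y 0ℚ
    ... | inj₁ k = neg≥0 k
    ... | inj₂ k = ⊥-elim (<≤⊥ 0<1 (subst (_≤ 0ℚ) yα (le-cert (y * - α) (0≤* k (<⇒≤ (neg>0 h))) (solve 2 (λ y α → y :* α :+ y :* (:- α) := con 0ℚ) refl y α))))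
    fwd : b ≤ α * x₀ + D → x₀ ≤ val (solveFor y (a , b)) x
    fwd s = subst (x₀ ≤_) (sym (val-solveFor y a b x)) (le-cert (- y * ((α * x₀ + D) - b)) (0≤* y≤0 (diff≥0 s))
      (trans (solve 5 (λ x y α D b → x :+ (:- y) :* ((α :* x :+ D) :- b) := x :* (con 1ℚ :- y :* α) :+ y :* (b :- D)) refl x₀ y α D b)
        (trans (cong (λ z → x₀ * (1ℚ - z) + y * (b - D)) yα) (solve 2 (λ x c → x :* (con 1ℚ :- con 1ℚ) :+ c := c) refl x₀ (y * (b - D))))))
    bwd : x₀ ≤ val (solveFor y (a , b)) x → b ≤ α * x₀ + D
    bwd t = le-cert (- α * (y * (b - D) - x₀)) (0≤* (<⇒≤ (neg>0 h)) (diff≥0 (subst (x₀ ≤_) (val-solveFor y a b x) t)))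
      (trans (solve 5 (λ x y α D b → b :+ (:- α) :* (y :* (b :- D) :- x) := (b :- D) :* (con 1ℚ :- y :* α) :+ (α :* x :+ D)) refl x₀ y α D b)
        (trans (cong (λ z → (b - D) * (1ℚ - z) + (α * x₀ + D)) yα) (solve 2 (λ x c → x :* (con 1ℚ :- con 1ℚ) :+ c := c) refl (b - D) (α * x₀ + D))))
  ... | tri≈ _ refl _ | split r l u | f , g =
      (λ { (s ∷ ss) → let p , q , t = f ss in subst (b ≤_) e s ∷ p , q , t }) , (λ { ((p ∷ ps) , q , t) → subst (b ≤_) (sym e) p ∷ g (ps , q , t) })
    where e = trans (cong (_+ dot a x) (*-zeroˡ x₀)) (+-identityˡ (dot a x))
  ... | tri> _ _ h | split r l u | f , g =
      (λ { (s ∷ ss) → let p , q , t = f ss in p , fwd s ∷ q , t }) , (λ { (p , (q ∷ qs) , t) → bwd q ∷ g (p , qs , t) })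
    where
    α≢0 : α ≢ 0ℚ
    α≢0 e = <-irrefl (sym e) h
    y = proj₁ (≢0⇒inv α α≢0)
    yα = proj₂ (≢0⇒inv α α≢0)
    D = dot a x
    y≥0 : 0ℚ ≤ y
    y≥0 with ≤-total 0ℚ y
    ... | inj₁ k = k
    ... | inj₂ k = ⊥-elim (<≤⊥ 0<1 (subst (_≤ 0ℚ) yα (le-cert (- y * α) (0≤* (neg≥0 k) (<⇒≤ h)) (solve 2 (λ y α → y :* α :+ (:- y) :* α := con 0ℚ) refl y α))))
    fwd : b ≤ α * x₀ + D → val (solveFor y (a , b)) x ≤ x₀
    fwd s = subst (_≤ x₀) (sym (val-solveFor y a b x)) (le-cert (y * ((α * x₀ + D) - b)) (0≤* y≥0 (diff≥0 s))
      (trans (solve 5 (λ x y α D b → y :* (b :- D) :+ y :* ((α :* x :+ D) :- b) := y :* α :* x) refl x₀ y α D b) (trans (cong (_* x₀) yα) (*-identityˡ x₀))))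
    bwd : val (solveFor y (a , b)) x ≤ x₀ → b ≤ α * x₀ + D
    bwd t = le-cert (α * (x₀ - y * (b - D))) (0≤* (<⇒≤ h) (diff≥0 (subst (_≤ x₀) (val-solveFor y a b x) t)))
      (trans (solve 5 (λ x y α D b → b :+ α :* (x :- y :* (b :- D)) := (b :- D) :* (con 1ℚ :- y :* α) :+ (α :* x :+ D)) refl x₀ y α D b)
        (trans (cong (λ z → (b - D) * (1ℚ - z) + (α * x₀ + D)) yα) (solve 2 (λ x c → x :* (con 1ℚ :- con 1ℚ) :+ c := c) refl (b - D) (α * x₀ + D))))

  pairCons : List (Aff n) → List (Aff n) → List (Con n)
  pairCons [] us = []
  pairCons (l ∷ ls) us = map (gapCon l) us ++ pairCons ls us

  pairCons-sat : ∀ (ls us : List (Aff n)) x →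
    (LAll.All (Sat x) (pairCons ls us) → LAll.All (λ l → LAll.All (λ u → val l x ≤ val u x) us) ls) ×
    (LAll.All (λ l → LAll.All (λ u → val l x ≤ val u x) us) ls → LAll.All (Sat x) (pairCons ls us))
  pairCons-sat [] us x = (λ _ → []) , (λ _ → [])
  pairCons-sat (l ∷ ls) us x = let f , g = pairCons-sat ls us x in
    (λ h → LAll.map (λ {u} → proj₁ (gapCon-sat l u x)) (LAllP.map⁻ (LAllP.++⁻ˡ (map (gapCon l) us) h)) ∷ f (LAllP.++⁻ʳ (map (gapCon l) us) h)) ,
    (λ { (h ∷ hs) → LAllP.++⁺ (LAllP.map⁺ (LAll.map (λ {u} → proj₂ (gapCon-sat l u x)) h)) (g hs) })

  feasible? : ∀ n (cs : List (Con n)) → Dec (Σ (Vec ℚ n) λ x → LAll.All (Sat x) cs)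
  feasible? zero cs = map′ (λ h → [] , h) (λ { ([] , h) → h }) (LAll.all? (λ c → proj₂ c ≤? dot (proj₁ c) []) cs)
  feasible? (suc n) cs with separate cs in eq
  ... | split r ls us = map′ to from (feasible? n (r ++ pairCons ls us))
    where
    to : (Σ (Vec ℚ n) λ x → LAll.All (Sat x) (r ++ pairCons ls us)) → Σ (Vec ℚ (suc n)) λ x → LAll.All (Sat x) cs
    to (x , h) = x₀ ∷ x , proj₂ (separate-sat cs x₀ x) (subst (SatSplit x₀ x) (sym eq)
        (LAllP.++⁻ˡ r h , LAllP.map⁻ (proj₁ (proj₂ bt)) , LAllP.map⁻ (proj₂ (proj₂ bt))))
      where
      bt = between (map (λ a → val a x) ls) (map (λ a → val a x) us)
        (LAllP.map⁺ (LAll.map LAllP.map⁺ (proj₁ (pairCons-sat ls us x) (LAllP.++⁻ʳ r h))))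
      x₀ = proj₁ bt
    from : (Σ (Vec ℚ (suc n)) λ x → LAll.All (Sat x) cs) → Σ (Vec ℚ n) λ x → LAll.All (Sat x) (r ++ pairCons ls us)
    from (x₀ ∷ x , h) = let a , b , c = subst (SatSplit x₀ x) eq (proj₁ (separate-sat cs x₀ x) h) in
      x , LAllP.++⁺ a (proj₂ (pairCons-sat ls us x) (LAll.map (λ p → LAll.map (λ q → ≤-trans p q) c) b))

  gather : ∀ {A : Set} → (Fin n → List A) → List A
  gather {zero} f = []
  gather {suc n} f = f zero ++ gather (f ∘ suc)

  gather-all : ∀ {A : Set} {P : A → Set} (f : Fin n → List A) → LAll.All P (gather f) → ∀ j → LAll.All P (f j)
  gather-all {suc n} f h zero = LAllP.++⁻ˡ (f zero) h
  gather-all {suc n} f h (suc j) = gather-all (f ∘ suc) (LAllP.++⁻ʳ (f zero) h) j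

  all-gather : ∀ {A : Set} {P : A → Set} (f : Fin n → List A) → (∀ j → LAll.All P (f j)) → LAll.All P (gather f)
  all-gather {zero} f h = []
  all-gather {suc n} f h = LAllP.++⁺ (h zero) (all-gather (f ∘ suc) (h ∘ suc))

  module Decide {d m : ℕ} (V : Config d m) (S : Subset m) where

    open Faces V

    above below : ℚ → Fin m → Con (suc d)
    above s j = 1ℚ ∷ (- 1ℚ) ⊙ tabulate (V j) , s
    below s j = - 1ℚ ∷ tabulate (V j) , s

    lookup-· : ∀ (a : Vec ℚ d) j → lookup a · V j ≡ dot a (tabulate (V j))
    lookup-· a j = trans (sumℚ-cong (λ i → cong (lookup a i *_) (sym (VecP.lookup∘tabulate (V j) i)))) (sumℚ-dot a (tabulate (V j)))

    above-dot : ∀ c (a : Vec ℚ d) j → dot (proj₁ (above 0ℚ j)) (c ∷ a) ≡ c - lookup a · V j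
    above-dot c a j = trans (cong (1ℚ * c +_) (trans (dot-⊙ˡ (- 1ℚ) (tabulate (V j)) a) (cong (- 1ℚ *_) (trans (dot-comm (tabulate (V j)) a) (sym (lookup-· a j))))))
      (solve 2 (λ c x → con 1ℚ :* c :+ con (- 1ℚ) :* x := c :- x) refl c (lookup a · V j))

    below-dot : ∀ c (a : Vec ℚ d) j → dot (proj₁ (below 0ℚ j)) (c ∷ a) ≡ lookup a · V j - c
    below-dot c a j = trans (cong (- 1ℚ * c +_) (trans (dot-comm (tabulate (V j)) a) (sym (lookup-· a j))))
      (solve 2 (λ c x → con (- 1ℚ) :* c :+ x := x :- c) refl c (lookup a · V j))

    conditions : Fin m → List (Con (suc d))
    conditions j with SubP._∈?_ j S
    ... | yes _ = above 0ℚ j ∷ below 0ℚ j ∷ []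
    ... | no _ = above 1ℚ j ∷ []

    -- Strict inequalities are normalised to a gap of 1. Faces are defined up to scaling the
    -- functional, so this loses nothing and leaves finitely many weak inequalities in c and a.
    Good : ℚ → Point d → Set
    Good c a = ∀ j → (j ∈ S → a · V j ≡ c) × (j ∉ S → a · V j + 1ℚ ≤ c)

    sound : ∀ c a → (∀ j → LAll.All (Sat (c ∷ a)) (conditions j)) → Good c (lookup a)
    sound c a h j with SubP._∈?_ j S | h j
    ... | yes p | x ∷ y ∷ [] = (λ _ → ≤-antisym
            (le-cert _ (subst (0ℚ ≤_) (above-dot c a j) x) (solve 2 (λ x c → x :+ (c :- x) := c) refl (lookup a · V j) c))
            (le-cert _ (subst (0ℚ ≤_) (below-dot c a j) y) (solve 2 (λ x c → c :+ (x :- c) := x) refl (lookup a · V j) c))) , λ q → ⊥-elim (q p)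
    ... | no p | x ∷ [] = (λ q → ⊥-elim (p q)) , λ _ → le-cert _ (diff≥0 (subst (1ℚ ≤_) (above-dot c a j) x))
            (solve 2 (λ x c → (x :+ con 1ℚ) :+ ((c :- x) :- con 1ℚ) := c) refl (lookup a · V j) c)

    complete : ∀ c a → Good c (lookup a) → ∀ j → LAll.All (Sat (c ∷ a)) (conditions j)
    complete c a h j with SubP._∈?_ j S | h j
    ... | yes p | e , _ = subst (0ℚ ≤_) (sym (above-dot c a j)) (diff≥0 (≤-reflexive (e p))) ∷ subst (0ℚ ≤_) (sym (below-dot c a j)) (diff≥0 (≤-reflexive (sym (e p)))) ∷ []
    ... | no p | _ , l = subst (1ℚ ≤_) (sym (above-dot c a j)) (le-cert _ (diff≥0 (l p)) (solve 2 (λ x c → con 1ℚ :+ (c :- (x :+ con 1ℚ)) := c :- x) refl (lookup a · V j) c)) ∷ []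

    Good⇒Exposes : ∀ c a → Good c a → Exposes S a c
    Good⇒Exposes c a g = le , λ j → (λ h → proj₁ (g j) h) , back j
      where
      lt : ∀ j → j ∉ S → a · V j < c
      lt j h = <-≤-trans (lt-cert 1ℚ 0<1 refl) (proj₂ (g j) h)
      le : ∀ j → a · V j ≤ c
      le j with SubP._∈?_ j S
      ... | yes h = ≤-reflexive (proj₁ (g j) h)
      ... | no h = <⇒≤ (lt j h)
      back : ∀ j → a · V j ≡ c → j ∈ S
      back j e with SubP._∈?_ j S
      ... | yes h = h
      ... | no h = ⊥-elim (<-irrefl e (lt j h))

    ·-scale : ∀ t (a x : Point d) → (λ i → t * a i) · x ≡ t * (a · x)
    ·-scale t a x = trans (sumℚ-cong (λ i → *-assoc t (a i) (x i))) (sumℚ-* t (λ i → a i * x i))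

    Exposes⇒Good : ∀ c a → Exposes S a c → Σ ℚ λ t → Good (t * c) (λ i → t * a i)
    Exposes⇒Good c a (le , ex) = t , λ j → (λ h → trans (·-scale t a (V j)) (cong (t *_) (proj₁ (ex j) h))) ,
        (λ h → subst (λ z → z + 1ℚ ≤ t * c) (sym (·-scale t a (V j))) (le-cert _ (0≤* (<⇒≤ t>0) (diff≥0 (subst (μ ≤_) (slack-out j h) (proj₂ (proj₂ mp) j))))
           (trans (solve 4 (λ t x c μ → (t :* x :+ con 1ℚ) :+ t :* ((c :- x) :- μ) := t :* c :+ (con 1ℚ :- t :* μ)) refl t (a · V j) c μ)
             (trans (cong (λ z → t * c + (1ℚ - z)) tμ) (+-identityʳ (t * c))))))
      where
      slack : Fin m → ℚ
      slack j with SubP._∈?_ j S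
      ... | yes _ = 1ℚ
      ... | no _ = c - a · V j
      slack-out : ∀ j → j ∉ S → slack j ≡ c - a · V j
      slack-out j h with SubP._∈?_ j S
      ... | yes k = ⊥-elim (h k)
      ... | no _ = refl
      slack>0 : ∀ j → 0ℚ < slack j
      slack>0 j with SubP._∈?_ j S
      ... | yes _ = 0<1
      ... | no h = diff>0 (≤∧≢⇒< (le j) (λ e → h (proj₂ (ex j) e)))
        where
        ≤∧≢⇒< : ∀ {x y} → x ≤ y → x ≢ y → x < y
        ≤∧≢⇒< {x} {y} k ne with x <? y
        ... | yes l = l
        ... | no l = ⊥-elim (ne (≤-antisym k (≮⇒≥ l)))
      mp = min-positive slack slack>0
      μ = proj₁ mp
      inv = >0⇒inv μ (proj₁ (proj₂ mp))
      t = proj₁ inv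
      tμ = proj₁ (proj₂ inv)
      t>0 = proj₂ (proj₂ inv)

    ·-congˡ : ∀ {a b : Point d} x → (∀ i → a i ≡ b i) → a · x ≡ b · x
    ·-congˡ x h = sumℚ-cong (λ i → cong (_* x i) (h i))

    -- A face count is a list of exactly the faces, so the property must be decided although it
    -- quantifies over all rational functionals. For nonempty S it is the feasibility of a linear
    -- system in d + 1 unknowns.
    face? : Dec (IsFace V S)
    face? with FinP.any? (λ j → SubP._∈?_ j S)
    ... | no ¬ne = no λ { (_ , _ , _ , _ , ne) → ¬ne ne }
    ... | yes ne = map′ to from (feasible? (suc d) (gather conditions))
      where
      to : (Σ (Vec ℚ (suc d)) λ x → LAll.All (Sat x) (gather conditions)) → IsFace V S
      to (c ∷ a , h) = let l , e = Good⇒Exposes c (lookup a) (sound c a (gather-all conditions h)) in lookup a , c , l , e , ne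
      from : IsFace V S → Σ (Vec ℚ (suc d)) λ x → LAll.All (Sat x) (gather conditions)
      from (a , c , l , e , _) = let t , g = Exposes⇒Good c a (l , e) in
        t * c ∷ tabulate (λ i → t * a i) , all-gather conditions (complete (t * c) (tabulate (λ i → t * a i)) λ j →
          (λ h → trans (·-congˡ (V j) (VecP.lookup∘tabulate (λ i → t * a i))) (proj₁ (g j) h)) ,
          (λ h → subst (λ z → z + 1ℚ ≤ t * c) (sym (·-congˡ (V j) (VecP.lookup∘tabulate (λ i → t * a i)))) (proj₂ (g j) h)))

  -- Face lattices of cubes and their charts

  fill : (c : Vec Tri n) → Vec Tri (rank c) → Vec Tri n
  fill [] [] = []
  fill (free ∷ c) (t ∷ d) = t ∷ fill c d
  fill (fix0 ∷ c) d = fix0 ∷ fill c d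
  fill (fix1 ∷ c) d = fix1 ∷ fill c d

  fill-≼ : ∀ (c : Vec Tri n) d → fill c d ≼ c
  fill-≼ [] [] = []
  fill-≼ (free ∷ c) (t ∷ d) = inj₂ refl ∷ fill-≼ c d
  fill-≼ (fix0 ∷ c) d = inj₁ refl ∷ fill-≼ c d
  fill-≼ (fix1 ∷ c) d = inj₁ refl ∷ fill-≼ c d

  fill-onto : ∀ (c c′ : Vec Tri n) → c′ ≼ c → Σ (Vec Tri (rank c)) λ d → fill c d ≡ c′
  fill-onto [] [] [] = [] , refl
  fill-onto (free ∷ c) (t ∷ c′) (_ ∷ l) = let d , e = fill-onto c c′ l in t ∷ d , cong (t ∷_) e
  fill-onto (fix0 ∷ c) (t ∷ c′) (inj₁ refl ∷ l) = let d , e = fill-onto c c′ l in d , cong (fix0 ∷_) e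
  fill-onto (fix1 ∷ c) (t ∷ c′) (inj₁ refl ∷ l) = let d , e = fill-onto c c′ l in d , cong (fix1 ∷_) e

  fill-mono : ∀ (c : Vec Tri n) d d′ → d ≼ d′ → fill c d ≼ fill c d′
  fill-mono [] [] [] [] = []
  fill-mono (free ∷ c) (t ∷ d) (t′ ∷ d′) (h ∷ l) = h ∷ fill-mono c d d′ l
  fill-mono (fix0 ∷ c) d d′ l = inj₁ refl ∷ fill-mono c d d′ l
  fill-mono (fix1 ∷ c) d d′ l = inj₁ refl ∷ fill-mono c d d′ l

  fill-cancel : ∀ (c : Vec Tri n) d d′ → fill c d ≼ fill c d′ → d ≼ d′
  fill-cancel [] [] [] [] = []
  fill-cancel (free ∷ c) (t ∷ d) (t′ ∷ d′) (h ∷ l) = h ∷ fill-cancel c d d′ l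
  fill-cancel (fix0 ∷ c) d d′ (_ ∷ l) = fill-cancel c d d′ l
  fill-cancel (fix1 ∷ c) d d′ (_ ∷ l) = fill-cancel c d d′ l

  ≼⇒≤c : ∀ {c d : Vec Tri n} → c ≼ d → c ≤c d
  ≼⇒≤c (h ∷ l) zero = h
  ≼⇒≤c (h ∷ l) (suc i) = ≼⇒≤c l i

  ≤c⇒≼ : ∀ {c d : Vec Tri n} → c ≤c d → c ≼ d
  ≤c⇒≼ {c = []} {[]} h = []
  ≤c⇒≼ {c = t ∷ c} {u ∷ d} h = h zero ∷ ≤c⇒≼ (h ∘ suc)

  pick1 : Tri → Bool
  pick1 fix0 = false
  pick1 fix1 = true
  pick1 free = true

  pick : Vec Tri n → Vec Bool n
  pick = Vec.map pick1

  pick1-match : ∀ t → Match (pick1 t) t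
  pick1-match fix0 = tt
  pick1-match fix1 = tt
  pick1-match free = tt

  pick-∈ : ∀ (c : Vec Tri n) → pick c ∈c c
  pick-∈ [] = []
  pick-∈ (t ∷ c) = pick1-match t ∷ pick-∈ c

  match-le : ∀ t u → (∀ s → Match s t → Match s u) → (t ≡ u) ⊎ (u ≡ free)
  match-le t free h = inj₂ refl
  match-le fix0 fix0 h = inj₁ refl
  match-le fix1 fix1 h = inj₁ refl
  match-le fix0 fix1 h = ⊥-elim (h false tt)
  match-le fix1 fix0 h = ⊥-elim (h true tt)
  match-le free fix0 h = ⊥-elim (h true tt)
  match-le free fix1 h = ⊥-elim (h false tt)

  incl-≼ : ∀ (c d : Vec Tri n) → (∀ σ → σ ∈c c → σ ∈c d) → c ≼ d
  incl-≼ [] [] h = []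
  incl-≼ (t ∷ c) (u ∷ d) h = match-le t u (λ s m → PW.head (h (s ∷ pick c) (m ∷ pick-∈ c))) ∷
    incl-≼ c d (λ σ m → PW.tail (h (pick1 t ∷ σ) (pick1-match t ∷ m)))

  ≼-antisym : ∀ {c d : Vec Tri n} → c ≼ d → d ≼ c → c ≡ d
  ≼-antisym [] [] = refl
  ≼-antisym (inj₁ refl ∷ l) (_ ∷ k) = cong (_ ∷_) (≼-antisym l k)
  ≼-antisym (inj₂ refl ∷ l) (inj₁ refl ∷ k) = cong (_ ∷_) (≼-antisym l k)
  ≼-antisym (inj₂ refl ∷ l) (inj₂ refl ∷ k) = cong (_ ∷_) (≼-antisym l k)

  ≼-refl : ∀ (c : Vec Tri n) → c ≼ c
  ≼-refl [] = []
  ≼-refl (t ∷ c) = inj₁ refl ∷ ≼-refl c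

  -- Charts are cubes mapped to the vertex set: the large deformed cube and the stacked 12-cubes.
  record Chart {d m : ℕ} (V : Config d m) (N : ℕ) : Set where
    field
      point : Vec Bool N → Fin m
      point-inj : ∀ {σ τ} → point σ ≡ point τ → σ ≡ τ
      set : Vec Tri N → Subset m
      set-∈ : ∀ c {σ} → σ ∈c c → point σ ∈ set c
      ∈-set : ∀ c {j} → j ∈ set c → Σ (Vec Bool N) λ σ → (σ ∈c c) × (point σ ≡ j)
      maximum : ∀ (a : Point d) c → Σ (Vec Tri N) λ c′ → Σ ℚ λ v → (c′ ≼ c) × MaxOn (λ σ → a · V (point σ)) c c′ v

  module Cubes {d m : ℕ} (V : Config d m) {N : ℕ} (ch : Chart V N) where

    open Chart ch
    open Faces V

    point-∈ : ∀ c {σ} → point σ ∈ set c → σ ∈c c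
    point-∈ c h = let τ , k , e = ∈-set c h in subst (_∈c c) (point-inj e) k

    set-mono : ∀ {c c′} → c ≼ c′ → set c ⊆ set c′
    set-mono {c} {c′} l h with ∈-set c h
    ... | σ , k , refl = set-∈ c′ (≼-∈ l k)

    set-cancel : ∀ c c′ → set c ⊆ set c′ → c ≼ c′
    set-cancel c c′ h = incl-≼ c c′ (λ σ k → point-∈ c′ (h (set-∈ c k)))

    -- The functional that exposes S has its maximum over the cube face c on a single subface. As S
    -- is nonempty and lies in `set c`, both maxima agree, and S is this subface.
    sub-face : ∀ c S → IsFace V S → S ⊆ set c → Σ (Vec Tri N) λ c′ → (c′ ≼ c) × (set c′ ≡ S)
    sub-face c S (a , e , le , ex , (j₀ , j₀∈)) sub with maximum a c | ∈-set c (sub j₀∈)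
    ... | c′ , v , l , mx | σ₀ , σ₀∈ , refl = c′ , l , SubP.⊆-antisym incl₁ incl₂
      where
      v≤e : v ≤ e
      v≤e = subst (_≤ e) (proj₁ (mx (pick c′) (≼-∈ l (pick-∈ c′))) (pick-∈ c′)) (le _)
      e≤v : e ≤ v
      e≤v with σ₀ ∈c? c′
      ... | inj₁ h = ≤-reflexive (trans (sym (proj₁ (ex _) j₀∈)) (proj₁ (mx σ₀ σ₀∈) h))
      ... | inj₂ h = <⇒≤ (subst (_< v) (proj₁ (ex _) j₀∈) (proj₂ (mx σ₀ σ₀∈) h))
      v≡e : v ≡ e
      v≡e = ≤-antisym v≤e e≤v
      incl₁ : set c′ ⊆ S
      incl₁ h with ∈-set c′ h
      ... | σ , k , refl = proj₂ (ex _) (trans (proj₁ (mx σ (≼-∈ l k)) k) v≡e)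
      incl₂ : S ⊆ set c′
      incl₂ h with ∈-set c (sub h)
      ... | σ , k , refl with σ ∈c? c′
      ... | inj₁ h′ = set-∈ c′ h′
      ... | inj₂ h′ = ⊥-elim (<-irrefl (trans (proj₁ (ex _) h) (sym v≡e)) (proj₂ (mx σ k) h′))

    cube-equiv : ∀ c → (∀ c′ → c′ ≼ c → IsFace V (set c′)) → CubeEquiv V (set c) (rank c)
    cube-equiv c faces = (λ d → set (fill c d)) ,
      (λ d → faces (fill c d) (fill-≼ c d) , set-mono (fill-≼ c d)) ,
      (λ S f sub → let c′ , l , e = sub-face c S f sub
                       d , e′ = fill-onto c c′ l in d , trans (cong set e′) e) ,
      (λ d d′ → (λ h → set-mono (fill-mono c d d′ (≤c⇒≼ h))) , (λ h → ≼⇒≤c (fill-cancel c d d′ (set-cancel (fill c d) (fill c d′) h))))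

  unit : Tri → ℚ
  unit free = 0ℚ
  unit fix0 = - 1ℚ
  unit fix1 = 1ℚ

  unit-sign : ∀ t → HasSign t (unit t)
  unit-sign free = refl
  unit-sign fix0 = negative⁻¹ (- 1ℚ)
  unit-sign fix1 = 0<1

  units : Vec Tri n → Vec ℚ n
  units = Vec.map unit

  restrict-sign : ∀ (c d : Vec Tri n) w → d ≼ c → Pointwise (λ t u → t ≡ free → HasSign (proj₁ u) (proj₂ u)) c (Vec.zip d w) → restrict c w ≡ d
  restrict-sign [] [] [] [] [] = refl
  restrict-sign (free ∷ c) (u ∷ d) (x ∷ w) (_ ∷ l) (h ∷ hs) = cong₂ _∷_ (HasSign-unique (sign x) u x (sign-spec x) (h refl)) (restrict-sign c d w l hs)
  restrict-sign (fix0 ∷ c) (u ∷ d) (x ∷ w) (inj₁ refl ∷ l) (h ∷ hs) = cong (fix0 ∷_) (restrict-sign c d w l hs)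
  restrict-sign (fix1 ∷ c) (u ∷ d) (x ∷ w) (inj₁ refl ∷ l) (h ∷ hs) = cong (fix1 ∷_) (restrict-sign c d w l hs)

  -- The signs d on the free positions of c make the system of c linear.
  same-signs : ∀ (c d : Vec Tri n) w → d ≼ c → Pointwise (λ t u → t ≡ free → HasSign (proj₁ u) (proj₂ u)) c (Vec.zip d w) → Same (signs d) c w
  same-signs [] [] [] [] [] = tt
  same-signs (free ∷ c) (free ∷ d) (x ∷ w) (_ ∷ l) (h ∷ hs) = trans (h refl) (sym (cong ∣_∣ (h refl))) , same-signs c d w l hs
  same-signs (free ∷ c) (fix0 ∷ d) (x ∷ w) (_ ∷ l) (h ∷ hs) = sym (x≤0⇒∣x∣≡-x (<⇒≤ (h refl))) , same-signs c d w l hs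
  same-signs (free ∷ c) (fix1 ∷ d) (x ∷ w) (_ ∷ l) (h ∷ hs) = sym (0≤p⇒∣p∣≡p (<⇒≤ (h refl))) , same-signs c d w l hs
  same-signs (fix0 ∷ c) (u ∷ d) (x ∷ w) (inj₁ refl ∷ l) (h ∷ hs) = refl , same-signs c d w l hs
  same-signs (fix1 ∷ c) (u ∷ d) (x ∷ w) (inj₁ refl ∷ l) (h ∷ hs) = refl , same-signs c d w l hs

  triOf : Bool → Tri
  triOf true = fix1
  triOf false = fix0

  tri-match : ∀ s → Match s (triOf s)
  tri-match true = tt
  tri-match false = tt

  match-tri : ∀ {s s′} → Match s (triOf s′) → s ≡ s′
  match-tri {true} {true} _ = refl
  match-tri {false} {false} _ = refl

  rank-allFree : ∀ n → rank (allFree {n}) ≡ n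
  rank-allFree zero = refl
  rank-allFree (suc n) = cong suc (rank-allFree n)

  restrict-𝟎 : ∀ n → restrict (allFree {n}) 𝟎 ≡ allFree
  restrict-𝟎 zero = refl
  restrict-𝟎 (suc n) = cong₂ _∷_ (HasSign-unique (sign 0ℚ) free 0ℚ (sign-spec 0ℚ) refl) (restrict-𝟎 n)

  -- The projected cube and its box facet

  module Base {p h R : ℕ} (F : Fan p h R) (r : ℕ) (hr : r ℕ.≤ R) where

    open Fan F
    open Points p κ κ>0 public

    N : ℕ
    N = suc (r ℕ.+ p)

    flow : Vec ℚ (suc p) → Vec ℚ N
    flow a = sol r allFree a

    pattern-of : Vec ℚ (suc p) → Vec Tri N
    pattern-of a = restrict allFree (flow a)

    maxOf : ∀ c a → MaxOn (λ σ → dot a (P r σ)) c (restrict c (sol r c a)) (height r 0ℚ (lam c (sol r c a)))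
    maxOf c a = subst (λ b → MaxOn (λ σ → dot b (P r σ)) c (restrict c (sol r c a)) (height r 0ℚ (lam c (sol r c a)))) (oldest-sol r c a)
      (maxPattern r c (sol r c a) (Sys-sol r c a))

    maxBase : ∀ a → MaxOn (λ σ → dot a (P r σ)) allFree (pattern-of a) (height r 0ℚ (lam allFree (flow a)))
    maxBase = maxOf allFree

    real-pattern : ∀ {c} → (Σ (Vec ℚ N) λ w → Sys r allFree w × Conf c w) → Σ (Vec ℚ (suc p)) λ a → pattern-of a ≡ c
    real-pattern {c} (w , sys , cf) = oldest r w , trans (cong (restrict allFree) (sol-oldest r allFree w sys)) (restrict-conf c w cf)

    flow-trivial : ∀ s a c → suc p ℕ.≤ rank c → ZeroAt c (sol r s a) → a ≡ 𝟎
    flow-trivial s a c h z = trans (sym (oldest-sol r s a)) (trans (cong (oldest r) (generic r s (sol r s a) c hr (Sys-sol r s a) z h)) (oldest-𝟎 r))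

    pattern-rank : ∀ a → a ≢ 𝟎 → rank (pattern-of a) ℕ.≤ p
    pattern-rank a a≢0 with rank (pattern-of a) ℕ.≤? p
    ... | yes h = h
    ... | no h = ⊥-elim (a≢0 (flow-trivial allFree a (pattern-of a) (ℕP.≰⇒> h) (restrict-zero (flow a))))

    -- By general position a solution with p + 1 zeros is zero. So the p + 1 initial values can be
    -- replaced by the values at any p + 1 positions, again after homogenising with an unknown `t`.
    prescribe : ∀ s → NoFree s → ∀ c → rank c ℕ.≤ suc p → (v : Vec ℚ N) →
      Σ (Vec ℚ (suc p)) λ a → ZeroAt c (Vec.zipWith _-_ (sol r s a) v)
    prescribe s nf c rc v with enlarge c (suc p) rc (s≤s (ℕP.m≤n+m p r))
    ... | d , rd , c⊆d = y ⊙ a , ZeroAt-⊆ c⊆d (freeAt-zero d _ λ i →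
         trans (VecP.lookup-zipWith _-_ (freeAt d i) (sol r s (y ⊙ a)) v) (trans (cong (_- lookup v (freeAt d i)) (at i)) (+-inverseʳ (lookup v (freeAt d i)))))
      where
      loc : Fin (suc p) → Fin N
      loc i = freeAt d (subst Fin (sym rd) i)
      loc′ : ∀ i → loc (subst Fin rd i) ≡ freeAt d i
      loc′ i = cong (freeAt d) (subst-sym-subst rd)
      form : Fin (suc p) → Vec ℚ (suc p) → ℚ
      form i a = lookup (sol r s a) (loc i)
      form-lin : ∀ i → LinF (form i)
      form-lin i = LinF-∘ {φ = sol r s} (LinF-lookup (loc i)) (sol-lin r nf)
      fs : Fin (suc p) → Vec ℚ (suc (suc p)) → ℚ
      fs i x = form i (Vec.tail x) + - lookup v (loc i) * Vec.head x
      nv = nullvec fs (λ i → LinF-+ {f = λ x → form i (Vec.tail x)} {g = λ x → - lookup v (loc i) * Vec.head x}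
        (LinF-∘ {φ = Vec.tail} (form-lin i) LinM-tail)
        (LinF-* (- lookup v (loc i)) {Vec.head} ((λ { (_ ∷ _) (_ ∷ _) → refl }) , (λ { t (_ ∷ _) → refl }))))
      t = Vec.head (proj₁ nv)
      a = Vec.tail (proj₁ nv)
      eqs : ∀ i → form i a ≡ lookup v (loc i) * t
      eqs i = trans (solve 3 (λ f g t → f := (f :+ (:- g) :* t) :+ g :* t) refl (form i a) (lookup v (loc i)) t)
        (trans (cong (_+ lookup v (loc i) * t) (proj₂ (proj₂ nv) i)) (+-identityˡ _))
      t≢0 : t ≢ 0ℚ
      t≢0 t0 = proj₁ (proj₂ nv) (head-tail-𝟎 (proj₁ nv) t0 (flow-trivial s a d (ℕP.≤-reflexive (sym rd))
          (freeAt-zero d (sol r s a) (λ i → trans (cong (lookup (sol r s a)) (sym (loc′ i)))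
            (trans (eqs (subst Fin rd i)) (trans (cong (lookup v (loc (subst Fin rd i)) *_) t0) (*-zeroʳ (lookup v (loc (subst Fin rd i))))))))))
      y = proj₁ (≢0⇒inv t t≢0)
      yt = proj₂ (≢0⇒inv t t≢0)
      at : ∀ i → lookup (sol r s (y ⊙ a)) (freeAt d i) ≡ lookup v (freeAt d i)
      at i = subst (λ j → lookup (sol r s (y ⊙ a)) j ≡ lookup v j) (loc′ i)
        (trans (proj₂ (form-lin (subst Fin rd i)) y a) (trans (cong (y *_) (eqs (subst Fin rd i)))
          (trans (solve 3 (λ y g t → y :* (g :* t) := g :* (y :* t)) refl y (lookup v (loc (subst Fin rd i))) t)
            (trans (cong (lookup v (loc (subst Fin rd i)) *_) yt) (*-identityʳ (lookup v (loc (subst Fin rd i))))))))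

    -- Values with the signs of c′ are prescribed at the free positions of c in the linear system
    -- for `signs c′`. Then its solution also satisfies the system of c, which takes absolute values
    -- just there. The maximum is relative to c; nothing is claimed about c being a face of the
    -- projection.
    expose : ∀ c → rank c ℕ.≤ suc p → ∀ c′ → c′ ≼ c → Σ (Vec ℚ (suc p)) λ b → Σ ℚ λ v → MaxOn (λ σ → dot b (P r σ)) c c′ v
    expose c rc c′ l = b , height r 0ℚ (lam c w) , subst (λ d → MaxOn (λ σ → dot b (P r σ)) c d (height r 0ℚ (lam c w))) (restrict-sign c c′ w l hs)
        (subst (λ b → MaxOn (λ σ → dot b (P r σ)) c (restrict c w) (height r 0ℚ (lam c w))) (oldest-sol r (signs c′) b)
          (maxPattern r c w (Sys-Same r (signs c′) c w (same-signs c c′ w l hs) (Sys-sol r (signs c′) b))))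
      where
      pr = prescribe (signs c′) (signs-nofree c′) c rc (units c′)
      b : Vec ℚ (suc p)
      b = proj₁ pr
      w : Vec ℚ N
      w = sol r (signs c′) b
      values : ∀ {n} (c c′ : Vec Tri n) w → ZeroAt c (Vec.zipWith _-_ w (units c′)) → Pointwise (λ t u → t ≡ free → HasSign (proj₁ u) (proj₂ u)) c (Vec.zip c′ w)
      values [] [] [] [] = []
      values (t ∷ c) (u ∷ c′) (x ∷ w) (z ∷ zs) = (λ e → subst (HasSign u) (trans (sym (trans (cong (_+ unit u) (z e)) (+-identityˡ (unit u))))
         (solve 2 (λ x u → (x :- u) :+ u := x) refl x (unit u))) (unit-sign u)) ∷ values c c′ w zs
      hs = values c c′ w (proj₂ pr)

    -- The facet F to be capped: the maximum of the first coordinate.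
    embB : ∀ {r} → Vec Bool r → Vec Bool p → Vec Bool (suc (r ℕ.+ p))
    embB [] τ = true ∷ τ
    embB (s ∷ pr) τ = s ∷ embB pr τ

    embP : ∀ {r} → Vec Bool r → Vec Tri p → Vec Tri (suc (r ℕ.+ p))
    embP [] τ = fix1 ∷ τ
    embP (s ∷ pr) τ = triOf s ∷ embP pr τ

    embB-inj : ∀ {r} (pr : Vec Bool r) {τ τ′} → embB pr τ ≡ embB pr τ′ → τ ≡ τ′
    embB-inj [] refl = refl
    embB-inj (s ∷ pr) e = embB-inj pr (cong Vec.tail e)

    embB-∈ : ∀ {r} (pr : Vec Bool r) {τ c} → τ ∈c c → embB pr τ ∈c embP pr c
    embB-∈ [] m = tt ∷ m
    embB-∈ (s ∷ pr) m = tri-match s ∷ embB-∈ pr m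

    ∈-embP : ∀ {r} (pr : Vec Bool r) {σ c} → σ ∈c embP pr c → Σ (Vec Bool p) λ τ → (τ ∈c c) × (σ ≡ embB pr τ)
    ∈-embP [] {true ∷ σ} (_ ∷ m) = σ , m , refl
    ∈-embP (s ∷ pr) {s′ ∷ σ} (x ∷ m) with match-tri {s′} {s} x | ∈-embP pr m
    ... | refl | τ , k , refl = τ , k , refl

    embP-rank : ∀ {r} (pr : Vec Bool r) c → rank (embP pr c) ≡ rank c
    embP-rank [] c = refl
    embP-rank (true ∷ pr) c = embP-rank pr c
    embP-rank (false ∷ pr) c = embP-rank pr c

    ≼-embP : ∀ {r} (pr : Vec Bool r) {c} → c ≼ embP pr allFree → Σ (Vec Tri p) λ τ → c ≡ embP pr τ
    ≼-embP [] {t ∷ c} (inj₁ refl ∷ l) = c , refl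
    ≼-embP (true ∷ pr) {t ∷ c} (inj₁ refl ∷ l) = let τ , e = ≼-embP pr l in τ , cong (fix1 ∷_) e
    ≼-embP (false ∷ pr) {t ∷ c} (inj₁ refl ∷ l) = let τ , e = ≼-embP pr l in τ , cong (fix0 ∷_) e

    top-rank : ∀ r (c : Vec Tri (suc (r ℕ.+ p))) → rank (top r c) ℕ.≤ rank c
    top-rank zero c = ℕP.≤-refl
    top-rank (suc r) (free ∷ c) = ℕP.m≤n⇒m≤1+n (top-rank r c)
    top-rank (suc r) (fix0 ∷ c) = top-rank r c
    top-rank (suc r) (fix1 ∷ c) = top-rank r c

    facet-shape : ∀ r (c : Vec Tri (suc (r ℕ.+ p))) → top r c ≡ fix1 ∷ allFree → rank c ℕ.≤ p → Σ (Vec Bool r) λ pr → c ≡ embP pr allFree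
    facet-shape zero c e h = [] , e
    facet-shape (suc r) (free ∷ c) e h = ⊥-elim (ℕP.<⇒≱ (s≤s (ℕP.≤-trans (ℕP.≤-reflexive (trans (sym (rank-allFree p)) (cong rank (sym e)))) (top-rank r c))) h)
    facet-shape (suc r) (fix0 ∷ c) e h = let pr , e′ = facet-shape r c e h in false ∷ pr , cong (fix0 ∷_) e′
    facet-shape (suc r) (fix1 ∷ c) e h = let pr , e′ = facet-shape r c e h in true ∷ pr , cong (fix1 ∷_) e′

    top-restrict : ∀ r w → top r (restrict allFree w) ≡ restrict allFree (oldest r w)
    top-restrict zero w = refl
    top-restrict (suc r) (_ ∷ w) = top-restrict r w

    e₀ : Vec ℚ (suc p)
    e₀ = 1ℚ ∷ 𝟎

    -- The p zero initial values exhaust the bound of `pattern-rank`, so every newer entry is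
    -- nonzero and the pattern has exactly p free entries.
    facet : Σ (Vec Bool r) λ pr → pattern-of e₀ ≡ embP pr allFree
    facet = facet-shape r (pattern-of e₀) (trans (top-restrict r (flow e₀)) (trans (cong (restrict allFree) (oldest-sol r allFree e₀))
        (cong₂ _∷_ (HasSign-unique (sign 1ℚ) fix1 1ℚ (sign-spec 1ℚ) 0<1) (restrict-𝟎 p))))
      (pattern-rank e₀ (λ e → 1≢0 (cong Vec.head e)))

    prefix : Vec Bool r
    prefix = proj₁ facet

    widths-facet : ∀ r (pr : Vec Bool r) τ τ′ g Γ → top r (widths r (embB pr τ) g Γ) ≡ top r (widths r (embB pr τ′) g Γ)
    widths-facet zero [] τ τ′ g Γ = refl
    widths-facet (suc r) (s ∷ pr) τ τ′ (x ∷ g) Γ = widths-facet r pr τ τ′ (carry Γ s x g) (nextΓ Γ)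

    top-embB : ∀ {r} (pr : Vec Bool r) τ → top r (embB pr τ) ≡ true ∷ τ
    top-embB [] τ = refl
    top-embB (s ∷ pr) τ = top-embB pr τ

    facet-widths : Vec ℚ (suc p)
    facet-widths = top r (W r (embB prefix (Vec.replicate p true)))

    top-Pos : ∀ r (v : Vec ℚ (suc (r ℕ.+ p))) → Pos v → Pos (top r v)
    top-Pos zero v h = h
    top-Pos (suc r) (_ ∷ v) (_ ∷ h) = top-Pos r v h

    apex : ℚ
    apex = Vec.head facet-widths

    Y : Vec ℚ p
    Y = Vec.tail facet-widths

    Y-pos : Pos Y
    Y-pos = go facet-widths (top-Pos r _ (W-pos r _))
      where
      go : ∀ {n} (v : Vec ℚ (suc n)) → Pos v → Pos (Vec.tail v)
      go (_ ∷ _) (_ ∷ h) = h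

    -- F is an axis-parallel box, because the oldest coordinates of the system are unconstrained.
    facet-points : ∀ τ → P r (embB prefix τ) ≡ apex ∷ signed τ Y
    facet-points τ = trans (cong₂ signed (top-embB prefix τ) (widths-facet r prefix τ (Vec.replicate p true) 𝟎 0ℚ)) (go facet-widths)
      where
      go : ∀ (v : Vec ℚ (suc p)) → signed (true ∷ τ) v ≡ Vec.head v ∷ signed τ (Vec.tail v)
      go (x ∷ v) = cong (_∷ signed τ v) (*-identityˡ x)

    e₀-dot : ∀ (v : Vec ℚ (suc p)) → dot e₀ v ≡ Vec.head v
    e₀-dot (x ∷ v) = trans (cong₂ _+_ (*-identityˡ x) (dot-𝟎ˡ v)) (+-identityʳ x)

    apex-max : ∀ σ → ¬ (σ ∈c embP prefix allFree) → Vec.head (P r σ) < apex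
    apex-max σ out = subst₂ _<_ (e₀-dot (P r σ)) (trans (sym at) (trans (e₀-dot (P r σ₀)) (cong Vec.head (facet-points (Vec.replicate p true)))))
        (proj₂ (mx σ (∈-allFree σ)) out)
      where
      mx : MaxOn (λ σ → dot e₀ (P r σ)) allFree (embP prefix allFree) (height r 0ℚ (lam allFree (flow e₀)))
      mx = subst (λ c → MaxOn (λ σ → dot e₀ (P r σ)) allFree c (height r 0ℚ (lam allFree (flow e₀)))) (proj₂ facet) (maxBase e₀)
      σ₀ = embB prefix (Vec.replicate p true)
      at : dot e₀ (P r σ₀) ≡ height r 0ℚ (lam allFree (flow e₀))
      at = proj₁ (mx σ₀ (∈-allFree σ₀)) (embB-∈ prefix (∈-allFree _))

  -- What is used of the neighbourly cubical polytope with vertices P σ, σ ∈ {0,1}^N.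
  record CubicalBase (p h N : ℕ) (good : List (Vec Tri N)) : Set where
    field
      p<N : p ℕ.< N
      P : Vec Bool N → Vec ℚ (suc p)
      pattern-of : Vec ℚ (suc p) → Vec Tri N
      top : Vec ℚ (suc p) → ℚ
      maxBase : ∀ a → MaxOn (λ σ → dot a (P σ)) allFree (pattern-of a) (top a)
      maxOn-pattern : ∀ a c → Σ (Vec Tri N) λ c′ → Σ ℚ λ v → (c′ ≼ c) × MaxOn (λ σ → dot a (P σ)) c c′ v
      expose : ∀ c → rank c ℕ.≤ suc p → ∀ c′ → c′ ≼ c → Σ (Vec ℚ (suc p)) λ b → Σ ℚ λ v → MaxOn (λ σ → dot b (P σ)) c c′ v
      pattern-rank : ∀ a → a ≢ 𝟎 → rank (pattern-of a) ℕ.≤ p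
      coordinate : ∀ c → Fin (rank c) → Vec Bool N → ℚ
      affine : ∀ {k} c (σ : Fin k → Vec Bool N) → (∀ j → σ j ∈c c) → (l : Vec ℚ k) → dot l (Vec.replicate k 1ℚ) ≡ 0ℚ →
        (∀ i → dot l (tabulate (λ j → coordinate c i (σ j))) ≡ 0ℚ) → ∀ i → dot l (tabulate (λ j → lookup (P (σ j)) i)) ≡ 0ℚ
      embB : Vec Bool p → Vec Bool N
      embP : Vec Tri p → Vec Tri N
      embB-inj : ∀ {τ τ′} → embB τ ≡ embB τ′ → τ ≡ τ′
      embB-∈ : ∀ {τ c} → τ ∈c c → embB τ ∈c embP c
      ∈-embP : ∀ {σ c} → σ ∈c embP c → Σ (Vec Bool p) λ τ → (τ ∈c c) × (σ ≡ embB τ)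
      embP-rank : ∀ c → rank (embP c) ≡ rank c
      ≼-embP : ∀ {c} → c ≼ embP allFree → Σ (Vec Tri p) λ τ → c ≡ embP τ
      apex : ℚ
      Y : Vec ℚ p
      Y-pos : Pos Y
      facet-points : ∀ τ → P (embB τ) ≡ apex ∷ signed τ Y
      apex-max : ∀ σ → ¬ (σ ∈c embP allFree) → Vec.head (P σ) < apex
      low-rank : ∀ c → rank c ℕ.≤ suc h → Σ (Vec ℚ (suc p)) λ a → pattern-of a ≡ c
      good-real : ∀ {c} → c ∈ˡ good → Σ (Vec ℚ (suc p)) λ a → pattern-of a ≡ c

  opaque
    cubicalBase : ∀ p h r → suc h ℕ.+ suc h ℕ.< p → CubicalBase p h (suc (suc r ℕ.+ p)) (Lists.realized p h r)
    cubicalBase p h r hp = record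
      { p<N = s≤s (ℕP.m≤n+m p (suc r)) ; P = P (suc r) ; pattern-of = pattern-of ; top = λ a → height (suc r) 0ℚ (lam allFree (flow a)) ; maxBase = maxBase
      ; maxOn-pattern = λ a c → restrict c (Fan.sol F (suc r) c a) , _ , restrict-≼ c _ , maxOf c a
      ; expose = expose ; pattern-rank = pattern-rank
      ; coordinate = λ c i σ → lookup (signed σ (W (suc r) σ)) (freeAt c i)
      ; affine = λ c σ m l s f → affine-relation (suc r) c σ m l s f
      ; embB = embB prefix ; embP = embP prefix ; embB-inj = embB-inj prefix ; embB-∈ = embB-∈ prefix ; ∈-embP = ∈-embP prefix
      ; embP-rank = embP-rank prefix ; ≼-embP = ≼-embP prefix
      ; apex = apex ; Y = Y ; Y-pos = Y-pos ; facet-points = facet-points ; apex-max = apex-max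
      ; low-rank = λ c h → real-pattern (Fan.low-rank-real F r c ℕP.≤-refl h)
      ; good-real = λ m → real-pattern (Fan.realized-sound F r ℕP.≤-refl m) }
      where
      F : Fan p h (suc r)
      F = fan p h (suc r) hp
      open Base F (suc r) ℕP.≤-refl

  -- The tower of caps

  -- A strictly concave sequence has one maximum or two adjacent equal ones. Accordingly a steep
  -- functional is maximal within one level of the tower or along the sides of one cap.
  data Peak (v : ℕ → ℚ) (K : ℕ) : Set where
    single : ∀ j → j ℕ.≤ K → (∀ i → i ℕ.≤ K → i ≢ j → v i < v j) → Peak v K
    pair : ∀ j → j ℕ.< K → v j ≡ v (suc j) → (∀ i → i ℕ.≤ K → i ≢ j → i ≢ suc j → v i < v j) → Peak v K

  module _ (v : ℕ → ℚ) (M : ℕ) (concave : ∀ i j → i ℕ.< j → j ℕ.< M → v (suc j) - v j < v (suc i) - v i) where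

    descend : ∀ j k → j ℕ.< k → k ℕ.< M → v (suc j) ≤ v j → v (suc k) < v k
    descend j k h hk l = lt-cert _ (0<+≤ (diff>0 (concave j k h hk)) (diff≥0 l))
      (solve 4 (λ a b c d → a :+ (((c :- d) :- (a :- b)) :+ (d :- c)) := b) refl (v (suc k)) (v k) (v (suc j)) (v j))

    peak : ∀ K → K ℕ.≤ M → Peak v K
    peak zero h = single 0 z≤n λ { zero _ ne → ⊥-elim (ne refl) }
    peak (suc K) h with peak K (ℕP.<⇒≤ h)
    ... | pair j hj e f = pair j (ℕP.m<n⇒m<1+n hj) e λ i hi ne ne′ → go i hi ne ne′
      where
      vK : v K ≤ v j
      vK with K ℕ.≟ suc j
      ... | yes refl = ≤-reflexive (sym e)
      ... | no ne = <⇒≤ (f K ℕP.≤-refl (λ e → ℕP.<-irrefl (sym e) hj) ne)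
      go : ∀ i → i ℕ.≤ suc K → i ≢ j → i ≢ suc j → v i < v j
      go i hi ne ne′ with ℕP.m≤n⇒m<n∨m≡n hi
      ... | inj₁ (s≤s l) = f i l ne ne′
      ... | inj₂ refl = <-≤-trans (descend j K hj h (≤-reflexive (sym e))) vK
    ... | single j hj f with ℕP.m≤n⇒m<n∨m≡n hj
    ... | inj₁ j<K = single j (ℕP.m≤n⇒m≤1+n hj) go
      where
      go : ∀ i → i ℕ.≤ suc K → i ≢ j → v i < v j
      go i hi ne with ℕP.m≤n⇒m<n∨m≡n hi
      ... | inj₁ (s≤s l) = f i l ne
      ... | inj₂ refl = <-trans (descend j K j<K h (<⇒≤ (f (suc j) j<K (λ e → ℕP.1+n≢n e)))) (f K ℕP.≤-refl (λ e → ℕP.<-irrefl (sym e) j<K))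
    ... | inj₂ refl with <-cmp (v (suc K)) (v K)
    ... | tri< l _ _ = single K (ℕP.n≤1+n K) go
      where
      go : ∀ i → i ℕ.≤ suc K → i ≢ K → v i < v K
      go i hi ne with ℕP.m≤n⇒m<n∨m≡n hi
      ... | inj₁ (s≤s l) = f i l ne
      ... | inj₂ refl = l
    ... | tri≈ _ e _ = pair K ℕP.≤-refl (sym e) go
      where
      go : ∀ i → i ℕ.≤ suc K → i ≢ K → i ≢ suc K → v i < v K
      go i hi ne ne′ with ℕP.m≤n⇒m<n∨m≡n hi
      ... | inj₁ (s≤s l) = f i l ne
      ... | inj₂ e = ⊥-elim (ne′ e)
    ... | tri> _ _ l = single (suc K) ℕP.≤-refl go
      where
      go : ∀ i → i ℕ.≤ suc K → i ≢ suc K → v i < v (suc K)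
      go i hi ne with ℕP.m≤n⇒m<n∨m≡n hi
      ... | inj₂ e = ⊥-elim (ne e)
      ... | inj₁ (s≤s k) with i ℕ.≟ K
      ... | yes refl = l
      ... | no ne′ = <-trans (f i k ne′) l

  lower-bound-cube : ∀ n (f : Vec Bool n → ℚ) → (∀ σ → 0ℚ < f σ) → Σ ℚ λ δ → (0ℚ < δ) × (∀ σ → δ ≤ f σ)
  lower-bound-cube zero f h = f [] , h [] , λ { [] → ≤-refl }
  lower-bound-cube (suc n) f h with lower-bound-cube n (λ σ → f (true ∷ σ)) (λ σ → h _) | lower-bound-cube n (λ σ → f (false ∷ σ)) (λ σ → h _)
  ... | a , a>0 , la | b , b>0 , lb with ≤-total a b
  ... | inj₁ k = a , a>0 , λ { (true ∷ σ) → la σ ; (false ∷ σ) → ≤-trans k (lb σ) }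
  ... | inj₂ k = b , b>0 , λ { (true ∷ σ) → ≤-trans k (la σ) ; (false ∷ σ) → lb σ }

  upper-bound-cube : ∀ n (f : Vec Bool n → ℚ) → Σ ℚ λ b → (0ℚ ≤ b) × (∀ σ → f σ ≤ b)
  upper-bound-cube zero f = f [] ⊔ 0ℚ , p≤q⊔p (f []) 0ℚ , λ { [] → p≤p⊔q (f []) 0ℚ }
  upper-bound-cube (suc n) f = let a , a≥0 , la = upper-bound-cube n (λ σ → f (true ∷ σ))
                                   b , b≥0 , lb = upper-bound-cube n (λ σ → f (false ∷ σ)) in
    a ⊔ b , ≤-trans a≥0 (p≤p⊔q a b) , λ { (true ∷ σ) → ≤-trans (la σ) (p≤p⊔q a b) ; (false ∷ σ) → ≤-trans (lb σ) (p≤q⊔p a b) }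

  ratio : ∀ (y v : Vec ℚ n) → Pos y → Σ ℚ λ C → (0ℚ ≤ C) × Pointwise (λ y v → ∣ v ∣ ≤ C * y) y v
  ratio [] [] [] = 0ℚ , ≤-refl , []
  ratio (y ∷ ys) (v ∷ vs) (h ∷ hs) = D , ≤-trans C≥0 (p≤q⊔p (∣ v ∣ * z) C) , hd ∷ grow ys hs rest
    where
    rc = ratio ys vs hs
    C = proj₁ rc
    C≥0 = proj₁ (proj₂ rc)
    inv = >0⇒inv y h
    z = proj₁ inv
    D = (∣ v ∣ * z) ⊔ C
    rest = proj₂ (proj₂ rc)
    hd : ∣ v ∣ ≤ D * y
    hd = ≤-trans (≤-reflexive (sym (trans (*-assoc ∣ v ∣ z y) (trans (cong (∣ v ∣ *_) (proj₁ (proj₂ inv))) (*-identityʳ ∣ v ∣)))))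
      (*-monoʳ-≤-nonNeg y ⦃ nonNegative (<⇒≤ h) ⦄ (p≤p⊔q (∣ v ∣ * z) C))
    grow : ∀ {n} (ys : Vec ℚ n) {vs : Vec ℚ n} → Pos ys → Pointwise (λ y v → ∣ v ∣ ≤ C * y) ys vs → Pointwise (λ y v → ∣ v ∣ ≤ D * y) ys vs
    grow [] [] [] = []
    grow (y ∷ ys) (h ∷ hs) (k ∷ ks) = ≤-trans k (*-monoʳ-≤-nonNeg y ⦃ nonNegative (<⇒≤ h) ⦄ (p≤q⊔p (∣ v ∣ * z) C)) ∷ grow ys hs ks

  ratio-dot : ∀ {C} (y v a : Vec ℚ n) → Pointwise (λ y v → ∣ v ∣ ≤ C * y) y v → dot a v ≤ C * dot y (lam allFree a)
  ratio-dot {C = C} [] [] [] [] = ≤-reflexive (sym (*-zeroʳ C))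
  ratio-dot {C = C} (y ∷ ys) (v ∷ vs) (a ∷ as) (h ∷ hs) = ≤-trans (+-mono-≤ hd (ratio-dot {C = C} ys vs as hs))
      (≤-reflexive (solve 4 (λ C y a d → C :* y :* a :+ C :* d := C :* (y :* a :+ d)) refl C y ∣ a ∣ (dot ys (lam allFree as))))
    where
    hd : a * v ≤ C * y * ∣ a ∣
    hd = ≤-trans (x≤∣x∣ (a * v)) (≤-trans (≤-reflexive (trans (∣p*q∣≡∣p∣*∣q∣ a v) (*-comm ∣ a ∣ ∣ v ∣)))
      (*-monoʳ-≤-nonNeg ∣ a ∣ ⦃ ∣-∣-nonNeg a ⦄ h))

  weight≥0 : ∀ (y a : Vec ℚ n) → Pos y → 0ℚ ≤ dot y (lam allFree a)
  weight≥0 [] [] [] = ≤-refl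
  weight≥0 (y ∷ ys) (a ∷ as) (h ∷ hs) = 0≤+ (0≤* (<⇒≤ h) (0≤∣p∣ a)) (weight≥0 ys as hs)

  weight-zero : ∀ (y a : Vec ℚ n) → Pos y → dot y (lam allFree a) ≤ 0ℚ → a ≡ 𝟎
  weight-zero [] [] [] _ = refl
  weight-zero (y ∷ ys) (a ∷ as) (h ∷ hs) l = cong₂ _∷_ a≡0 (weight-zero ys as hs (≤-trans (le-cert (y * ∣ a ∣) (0≤* (<⇒≤ h) (0≤∣p∣ a)) (+-comm _ (y * ∣ a ∣))) l))
    where
    a≡0 : a ≡ 0ℚ
    a≡0 with a ≟ 0ℚ
    ... | yes e = e
    ... | no ne = ⊥-elim (<≤⊥ (0<+≤ (0<* h pos-a) (weight≥0 ys as hs)) l)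
      where
      pos-a : 0ℚ < ∣ a ∣
      pos-a with 0ℚ <? ∣ a ∣
      ... | yes k = k
      ... | no k = ⊥-elim (ne (∣p∣≡0⇒p≡0 a (≤-antisym (≮⇒≥ k) (0≤∣p∣ a))))

  -- For functionals steeper than ρ only the facet can be seen.
  dominated : ∀ α M x h C γ ρ D → 0ℚ < α → 0ℚ ≤ h → 0ℚ < γ → γ ≤ M - x → ρ * γ ≡ C + γ → ρ * h ≤ α → D ≤ C * h → α * x + D < α * M + h
  dominated α M x h C γ ρ D hα hh hγ gap e hρ hD = lt-cert (α * ((M - x) - γ) + ((α - ρ * h) * γ + ((C * h - D) + (γ * h + h)))) total
      (trans (solve 8 (λ α M x h C γ ρ D → (α :* x :+ D) :+ (α :* ((M :- x) :- γ) :+ ((α :- ρ :* h) :* γ :+ ((C :* h :- D) :+ (γ :* h :+ h)))) :=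
          (α :* M :+ h) :+ h :* ((C :+ γ) :- ρ :* γ)) refl α M x h C γ ρ D)
        (trans (cong (λ z → (α * M + h) + h * ((C + γ) - z)) e) (solve 3 (λ s h c → s :+ h :* (c :- c) := s) refl (α * M + h) h (C + γ))))
    where
    t₁ = 0≤* (<⇒≤ hα) (diff≥0 gap)
    t₃ = diff≥0 hD
    total : 0ℚ < α * ((M - x) - γ) + ((α - ρ * h) * γ + ((C * h - D) + (γ * h + h)))
    total with 0ℚ <? h
    ... | yes p = 0≤+< t₁ (0≤+< (0≤* (diff≥0 hρ) (<⇒≤ hγ)) (0≤+< t₃ (0≤+< (0≤* (<⇒≤ hγ) hh) p)))
    ... | no p = 0≤+< t₁ (0<+≤ (0<* (lt-cert α hα (trans (+-identityˡ α) (sym (trans (cong (λ z → α - ρ * z) h0) (solve 2 (λ α ρ → α :- ρ :* con 0ℚ := α) refl α ρ))))) hγ)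
          (0≤+ t₃ (0≤+ (0≤* (<⇒≤ hγ) hh) hh)))
      where
      h0 : h ≡ 0ℚ
      h0 = ≤-antisym (≮⇒≥ p) hh

  module Tower {p h N : ℕ} {good : _} (B : CubicalBase p h N good) (K : ℕ) where

    open CubicalBase B public

    -- The support function of the box with half-widths `Y`, the last p coordinates of F.
    weight : Vec ℚ p → ℚ
    weight a = dot Y (lam allFree a)

    facetP : Vec Tri N
    facetP = embP allFree

    abstract
      gap-data : Σ ℚ λ γ → (0ℚ < γ) × (∀ σ → ¬ (σ ∈c facetP) → γ ≤ apex - Vec.head (P σ))
      gap-data = proj₁ lb , proj₁ (proj₂ lb) , λ σ out → subst (proj₁ lb ≤_) (f-out σ out) (proj₂ (proj₂ lb) σ)
        where
        f : Vec Bool N → ℚ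
        f σ with σ ∈c? facetP
        ... | inj₁ _ = 1ℚ
        ... | inj₂ _ = apex - Vec.head (P σ)
        f>0 : ∀ σ → 0ℚ < f σ
        f>0 σ with σ ∈c? facetP
        ... | inj₁ _ = 0<1
        ... | inj₂ out = diff>0 (apex-max σ out)
        f-out : ∀ σ → ¬ (σ ∈c facetP) → f σ ≡ apex - Vec.head (P σ)
        f-out σ out with σ ∈c? facetP
        ... | inj₁ m = ⊥-elim (out m)
        ... | inj₂ _ = refl
        lb : Σ ℚ λ δ → (0ℚ < δ) × (∀ σ → δ ≤ f σ)
        lb = lower-bound-cube N f f>0

    γ : ℚ
    γ = proj₁ gap-data

    γ>0 : 0ℚ < γ
    γ>0 = proj₁ (proj₂ gap-data)

    abstract
      spread : Σ ℚ λ C → (0ℚ ≤ C) × (∀ σ a → dot a (Vec.tail (P σ)) ≤ C * weight a)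
      spread = C , C≥0 , λ σ a → ≤-trans (ratio-dot {C = proj₁ (ratio Y (Vec.tail (P σ)) Y-pos)} Y (Vec.tail (P σ)) a (proj₂ (proj₂ (ratio Y (Vec.tail (P σ)) Y-pos))))
          (*-monoʳ-≤-nonNeg (weight a) ⦃ nonNegative (weight≥0 Y a Y-pos) ⦄ (proj₂ (proj₂ ub) σ))
        where
        ub : Σ ℚ λ b → (0ℚ ≤ b) × (∀ σ → proj₁ (ratio Y (Vec.tail (P σ)) Y-pos) ≤ b)
        ub = upper-bound-cube N (λ σ → proj₁ (ratio Y (Vec.tail (P σ)) Y-pos))
        C : ℚ
        C = proj₁ ub
        C≥0 : 0ℚ ≤ C
        C≥0 = proj₁ (proj₂ ub)

    C : ℚ
    C = proj₁ spread

    abstract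
      ρ-data : Σ ℚ λ ρ → (ρ * γ ≡ C + γ) × (0ℚ < ρ)
      ρ-data = let y , yγ , y>0 = >0⇒inv γ γ>0 in
        (C + γ) * y , trans (*-assoc (C + γ) y γ) (trans (cong ((C + γ) *_) yγ) (*-identityʳ (C + γ))) , 0<* (0≤+< (proj₁ (proj₂ spread)) γ>0) y>0

    -- The value (C + γ)/γ: at this slope, the loss of γ in the first coordinate outside F outweighs
    -- the gain of at most C times the weight in the others.
    ρ : ℚ
    ρ = proj₁ ρ-data

    ρ>0 : 0ℚ < ρ
    ρ>0 = proj₂ (proj₂ ρ-data)

    dot-split : ∀ α (a : Vec ℚ p) (v : Vec ℚ (suc p)) → dot (α ∷ a) v ≡ α * Vec.head v + dot a (Vec.tail v)
    dot-split α a (x ∷ v) = refl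

    steep : ∀ α a σ → 0ℚ < α → ρ * weight a ≤ α → ¬ (σ ∈c facetP) → dot (α ∷ a) (P σ) < α * apex + weight a
    steep α a σ hα hs out = subst (_< α * apex + weight a) (sym (dot-split α a (P σ)))
      (dominated α apex (Vec.head (P σ)) (weight a) C γ ρ (dot a (Vec.tail (P σ))) hα (weight≥0 Y a Y-pos) γ>0
        (proj₂ (proj₂ gap-data) σ out) (proj₁ (proj₂ ρ-data)) hs (proj₂ (proj₂ spread) σ a))

    -- Level l of the tower is the box F scaled by s l and moved outwards by t l.
    abstract
      μ-data : Σ ℚ λ μ → (μ * ι (suc K) ≡ 1ℚ) × (0ℚ < μ)
      μ-data = >0⇒inv (ι (suc K)) (0<+≤ 0<1 (ι≥0 K))

    μ : ℚ
    μ = proj₁ μ-data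

    μ>0 : 0ℚ < μ
    μ>0 = proj₂ (proj₂ μ-data)

    abstract
      η-data : Σ ℚ λ y → (y * (ρ * ι (suc K)) ≡ 1ℚ) × (0ℚ < y)
      η-data = >0⇒inv (ρ * ι (suc K)) (0<* ρ>0 (0<+≤ 0<1 (ι≥0 K)))

    -- The value μ/(ρ(K + 1)), which keeps each rise at most μ/ρ (`inc-flat`). The tower is then so
    -- flat that functionals with slope below ρ lose more by the shrinking of the box than they gain
    -- by its rise.
    η : ℚ
    η = μ * proj₁ η-data

    η>0 : 0ℚ < η
    η>0 = 0<* μ>0 (proj₂ (proj₂ η-data))

    -- The rises decrease strictly while the box shrinks linearly. This strict concavity keeps the
    -- side facets of different caps apart.
    inc : ℕ → ℚ
    inc l = η * ι (K ℕ.∸ l)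

    inc>0 : ∀ {l} → l ℕ.< K → 0ℚ < inc l
    inc>0 {l} h = 0<* η>0 (<-≤-trans 0<1 (ι-mono-≤ {1} (ℕP.m<n⇒0<n∸m h)))

    inc-desc : ∀ i j → i ℕ.< j → j ℕ.< K → inc j < inc i
    inc-desc i j h hj = *-monoʳ-<-pos η ⦃ positive η>0 ⦄ (lt-cert _ (<-≤-trans 0<1 (ι-gap (ℕP.∸-monoʳ-< h (ℕP.<⇒≤ hj))))
      (solve 2 (λ a b → a :+ (b :- a) := b) refl (ι (K ℕ.∸ j)) (ι (K ℕ.∸ i))))

    inc-flat : ∀ l → ρ * inc l ≤ μ
    inc-flat l = le-cert (ρ * η * (ι (suc K) - ι (K ℕ.∸ l))) (0≤* (0≤* (<⇒≤ ρ>0) (<⇒≤ η>0)) (diff≥0 (ι-mono-≤ (ℕP.≤-trans (ℕP.m∸n≤m K l) (ℕP.n≤1+n K)))))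
      (trans (solve 5 (λ ρ μ y a b → ρ :* (μ :* y :* a) :+ ρ :* (μ :* y) :* (b :- a) := μ :* (y :* (ρ :* b))) refl ρ μ (proj₁ η-data) (ι (K ℕ.∸ l)) (ι (suc K)))
        (trans (cong (μ *_) (proj₁ (proj₂ η-data))) (*-identityʳ μ)))

    s t : ℕ → ℚ
    s zero = 1ℚ
    s (suc l) = s l - μ
    t zero = 0ℚ
    t (suc l) = t l + inc l

    s>0 : ∀ l → l ℕ.≤ K → 0ℚ < s l
    s>0 l h = subst (0ℚ <_) (sym (trans (closed l) (trans (cong (_- ι l * μ) (sym (proj₁ (proj₂ μ-data)))) (solve 3 (λ μ a b → μ :* a :- b :* μ := μ :* (a :- b)) refl μ (ι (suc K)) (ι l)))))
        (0<* μ>0 (<-≤-trans 0<1 (ι-gap (s≤s h))))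
      where
      closed : ∀ l → s l ≡ 1ℚ - ι l * μ
      closed zero = solve 1 (λ μ → con 1ℚ := con 1ℚ :- con 0ℚ :* μ) refl μ
      closed (suc l) = trans (cong (_- μ) (closed l)) (solve 2 (λ l μ → (con 1ℚ :- l :* μ) :- μ := con 1ℚ :- (con 1ℚ :+ l) :* μ) refl (ι l) μ)

    layer : ℕ → Vec Bool p → Vec ℚ (suc p)
    layer l τ = (apex + t l) ∷ signed τ (s l ⊙ Y)

    -- For H = `weight a`, the maximum of the functional (α, a) on level l.
    value : ℚ → ℚ → ℕ → ℚ
    value α H l = α * (apex + t l) + s l * H

    value-step : ∀ α H l → value α H (suc l) - value α H l ≡ α * inc l - μ * H
    value-step α H l = solve 7 (λ α A t i s μ H → (α :* (A :+ (t :+ i)) :+ (s :- μ) :* H) :- (α :* (A :+ t) :+ s :* H) := α :* i :- μ :* H) refl α apex (t l) (inc l) (s l) μ H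

    Pos-⊙ : ∀ {n} {y : Vec ℚ n} {x} → 0ℚ < x → Pos y → Pos (x ⊙ y)
    Pos-⊙ h [] = []
    Pos-⊙ h (k ∷ ks) = 0<* h k ∷ Pos-⊙ h ks

    layer-max : ∀ l → l ℕ.≤ K → ∀ α a c → MaxOn (λ τ → dot (α ∷ a) (layer l τ)) c (restrict c a) (value α (dot Y (lam c a)) l)
    layer-max l h α a c = maxOn _ (λ _ → s l ⊙ Y) c a _ (λ _ → Pos-⊙ (s>0 l h) Y-pos) λ τ _ →
      trans (cong (α * (apex + t l) +_) (trans (signed-slack (s l ⊙ Y) τ c a) (cong (_- slackV (s l ⊙ Y) τ c a) (dot-⊙ˡ (s l) Y (lam c a)))))
        (solve 3 (λ a b c → a :+ (b :- c) := (a :+ b) :- c) refl (α * (apex + t l)) (s l * dot Y (lam c a)) (slackV (s l ⊙ Y) τ c a))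

    Index : Set
    Index = Vec Bool N ⊎ (Fin K × Vec Bool p)

    pt : Index → Vec ℚ (suc p)
    pt (inj₁ σ) = P σ
    pt (inj₂ (j , τ)) = layer (suc (toℕ j)) τ

    lev : Fin (suc K) → Vec Bool p → Index
    lev zero τ = inj₁ (embB τ)
    lev (suc j) τ = inj₂ (j , τ)

    lev-pt : ∀ l τ → pt (lev l τ) ≡ layer (toℕ l) τ
    lev-pt zero τ = trans (facet-points τ) (cong₂ _∷_ (sym (+-identityʳ apex)) (cong (signed τ) (sym (1⊙ Y))))
    lev-pt (suc j) τ = refl

    lev-inj : ∀ {l l′ τ τ′} → lev l τ ≡ lev l′ τ′ → (l ≡ l′) × (τ ≡ τ′)
    lev-inj {zero} {zero} e = refl , embB-inj (inj₁-inj e)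
      where
      inj₁-inj : ∀ {A B : Set} {x y : A} → inj₁ {B = B} x ≡ inj₁ y → x ≡ y
      inj₁-inj refl = refl
    lev-inj {suc l} {suc .l} refl = refl , refl

    lev-max : ∀ l α a c → MaxOn (λ τ → dot (α ∷ a) (pt (lev l τ))) c (restrict c a) (value α (dot Y (lam c a)) (toℕ l))
    lev-max l α a c τ m = subst (λ v → (τ ∈c restrict c a → dot (α ∷ a) v ≡ value α (dot Y (lam c a)) (toℕ l)) × (¬ (τ ∈c restrict c a) → dot (α ∷ a) v < value α (dot Y (lam c a)) (toℕ l)))
      (sym (lev-pt l τ)) (layer-max (toℕ l) (ℕP.≤-pred (FinP.toℕ<n l)) α a c τ m)

    -- The vertices of the cap between levels j and j + 1.
    rung : Fin K → Bool → Fin (suc K)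
    rung j true = suc j
    rung j false = inject₁ j

    cap : Fin K → Vec Bool (suc p) → Index
    cap j (b ∷ τ) = lev (rung j b) τ

    rung-inj : ∀ j {b b′} → rung j b ≡ rung j b′ → b ≡ b′
    rung-inj j {true} {true} e = refl
    rung-inj j {false} {false} e = refl
    rung-inj j {true} {false} e = ⊥-elim (ℕP.1+n≢n (trans (cong toℕ e) (FinP.toℕ-inject₁ j)))
    rung-inj j {false} {true} e = ⊥-elim (ℕP.1+n≢n (sym (trans (sym (FinP.toℕ-inject₁ j)) (cong toℕ e))))

    cap-inj : ∀ j {σ τ} → cap j σ ≡ cap j τ → σ ≡ τ
    cap-inj j {b ∷ σ} {b′ ∷ τ} e = let x , y = lev-inj {rung j b} {rung j b′} e in cong₂ _∷_ (rung-inj j x) y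

    low up : ℚ → ℚ → Fin K → ℚ
    low α H j = value α H (toℕ j)
    up α H j = value α H (suc (toℕ j))

    low-value : ∀ α H j → value α H (toℕ (inject₁ j)) ≡ low α H j
    low-value α H j = cong (value α H) (FinP.toℕ-inject₁ j)

    cap-max-levels : ∀ j α a t c u v → (u ≡ t) ⊎ (t ≡ free) → (∀ b → Match b u → value α (dot Y (lam c a)) (toℕ (rung j b)) ≡ v) →
      (∀ b → Match b t → ¬ Match b u → value α (dot Y (lam c a)) (toℕ (rung j b)) < v) →
      MaxOn (λ σ → dot (α ∷ a) (pt (cap j σ))) (t ∷ c) (u ∷ restrict c a) v
    cap-max-levels j α a t c u v _ on off (b ∷ τ) (mb ∷ mτ) = (λ { (x ∷ y) → trans (proj₁ lm y) (on b x) }) , below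
      where
      lm = lev-max (rung j b) α a c τ mτ
      below : ¬ ((b ∷ τ) ∈c (u ∷ restrict c a)) → dot (α ∷ a) (pt (lev (rung j b) τ)) < v
      below ne with match? b u | τ ∈c? restrict c a
      ... | inj₁ x | inj₁ y = ⊥-elim (ne (x ∷ y))
      ... | inj₁ x | inj₂ y = subst (_ <_) (on b x) (proj₂ lm y)
      ... | inj₂ x | inj₁ y = subst (_< v) (sym (proj₁ lm y)) (off b mb x)
      ... | inj₂ x | inj₂ y = <-trans (proj₂ lm y) (off b mb x)

    cap-max : ∀ j a c → Σ (Vec Tri (suc p)) λ c′ → Σ ℚ λ v → (c′ ≼ c) × MaxOn (λ σ → dot a (pt (cap j σ))) c c′ v
    cap-max j (α ∷ a) (fix0 ∷ c) = fix0 ∷ restrict c a , _ , inj₁ refl ∷ restrict-≼ c a ,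
      cap-max-levels j α a fix0 c fix0 (low α (dot Y (lam c a)) j) (inj₁ refl) (λ { false _ → low-value α (dot Y (lam c a)) j }) (λ { false _ h → ⊥-elim (h tt) })
    cap-max j (α ∷ a) (fix1 ∷ c) = fix1 ∷ restrict c a , _ , inj₁ refl ∷ restrict-≼ c a ,
      cap-max-levels j α a fix1 c fix1 (up α (dot Y (lam c a)) j) (inj₁ refl) (λ { true _ → refl }) (λ { true _ h → ⊥-elim (h tt) })
    cap-max j (α ∷ a) (free ∷ c) with <-cmp (low α (dot Y (lam c a)) j) (up α (dot Y (lam c a)) j)
    ... | tri< l _ _ = fix1 ∷ restrict c a , _ , inj₂ refl ∷ restrict-≼ c a ,
      cap-max-levels j α a free c fix1 (up α (dot Y (lam c a)) j) (inj₂ refl) (λ { true _ → refl })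
        (λ { true _ h → ⊥-elim (h tt) ; false _ _ → subst (_< up α (dot Y (lam c a)) j) (sym (low-value α (dot Y (lam c a)) j)) l })
    ... | tri≈ _ e _ = free ∷ restrict c a , _ , inj₂ refl ∷ restrict-≼ c a ,
      cap-max-levels j α a free c free (up α (dot Y (lam c a)) j) (inj₂ refl) (λ { true _ → refl ; false _ → trans (low-value α (dot Y (lam c a)) j) e })
        (λ _ _ h → ⊥-elim (h tt))
    ... | tri> _ _ l = fix0 ∷ restrict c a , _ , inj₂ refl ∷ restrict-≼ c a ,
      cap-max-levels j α a free c fix0 (low α (dot Y (lam c a)) j) (inj₂ refl) (λ { false _ → low-value α (dot Y (lam c a)) j })
        (λ { false _ h → ⊥-elim (h tt) ; true _ _ → l })

  exists? : ∀ n {Q : Vec Bool n → Set} → (∀ σ → Dec (Q σ)) → Dec (Σ (Vec Bool n) Q)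
  exists? zero dec = map′ (λ q → [] , q) (λ { ([] , q) → q }) (dec [])
  exists? (suc n) dec with exists? n (λ σ → dec (true ∷ σ)) | exists? n (λ σ → dec (false ∷ σ))
  ... | yes (σ , q) | _ = yes (true ∷ σ , q)
  ... | no _ | yes (σ , q) = yes (false ∷ σ , q)
  ... | no a | no b = no λ { (true ∷ σ , q) → a (σ , q) ; (false ∷ σ , q) → b (σ , q) }

  ∈c-dec : ∀ (σ : Vec Bool n) c → Dec (σ ∈c c)
  ∈c-dec σ c with σ ∈c? c
  ... | inj₁ h = yes h
  ... | inj₂ h = no h

  dec-true : ∀ {A : Set} (d : Dec A) → A → ⌊ d ⌋ ≡ true
  dec-true (yes _) _ = refl
  dec-true (no ¬a) a = ⊥-elim (¬a a)

  true-dec : ∀ {A : Set} (d : Dec A) → ⌊ d ⌋ ≡ true → A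
  true-dec (yes a) _ = a

  collect : (Fin n → Bool) → Subset n
  collect = tabulate

  ∈-collect : ∀ (f : Fin n → Bool) {j} → f j ≡ true → j ∈ collect f
  ∈-collect f {j} e = VecP.lookup⇒[]= j (tabulate f) (trans (VecP.lookup∘tabulate f j) e)

  collect-∈ : ∀ (f : Fin n → Bool) {j} → j ∈ collect f → f j ≡ true
  collect-∈ f {j} h = trans (sym (VecP.lookup∘tabulate f j)) (VecP.[]=⇒lookup h)

  restrict-units : ∀ (c d : Vec Tri n) → d ≼ c → restrict c (units d) ≡ d
  restrict-units [] [] [] = refl
  restrict-units (free ∷ c) (u ∷ d) (_ ∷ l) = cong₂ _∷_ (HasSign-unique (sign (unit u)) u (unit u) (sign-spec (unit u)) (unit-sign u)) (restrict-units c d l)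
  restrict-units (fix0 ∷ c) (u ∷ d) (inj₁ refl ∷ l) = cong (fix0 ∷_) (restrict-units c d l)
  restrict-units (fix1 ∷ c) (u ∷ d) (inj₁ refl ∷ l) = cong (fix1 ∷_) (restrict-units c d l)

  ≼-allFree : ∀ (c : Vec Tri n) → c ≼ allFree
  ≼-allFree [] = []
  ≼-allFree (t ∷ c) = inj₂ refl ∷ ≼-allFree c

  lower-pattern : ∀ (c : Vec Tri n) → rank c ≡ suc k → Σ (Vec Tri n) λ d → (d ≼ c) × (rank d ≡ k) × Σ (Vec Bool n) λ σ → (σ ∈c c) × ¬ (σ ∈c d)
  lower-pattern (free ∷ c) e = fix1 ∷ c , inj₂ refl ∷ ≼-refl c , ℕP.suc-injective e , false ∷ pick c , tt ∷ pick-∈ c , λ { (() ∷ _) }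
  lower-pattern (fix0 ∷ c) e = let d , l , r , σ , m , o = lower-pattern c e in fix0 ∷ d , inj₁ refl ∷ l , r , false ∷ σ , tt ∷ m , λ { (_ ∷ x) → o x }
  lower-pattern (fix1 ∷ c) e = let d , l , r , σ , m , o = lower-pattern c e in fix1 ∷ d , inj₁ refl ∷ l , r , true ∷ σ , tt ∷ m , λ { (_ ∷ x) → o x }

  free-or-fixed : ∀ (c : Vec Tri n) i → (Σ (Fin (rank c)) λ k → freeAt c k ≡ i) ⊎ (Σ Bool λ b → ∀ τ → τ ∈c c → lookup τ i ≡ b)
  free-or-fixed (free ∷ c) zero = inj₁ (zero , refl)
  free-or-fixed (fix0 ∷ c) zero = inj₂ (false , λ { (false ∷ _) _ → refl ; (true ∷ _) (() ∷ _) })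
  free-or-fixed (fix1 ∷ c) zero = inj₂ (true , λ { (true ∷ _) _ → refl ; (false ∷ _) (() ∷ _) })
  free-or-fixed (t ∷ c) (suc i) with free-or-fixed c i
  ... | inj₂ (b , h) = inj₂ (b , λ { (_ ∷ τ) (_ ∷ m) → h τ m })
  free-or-fixed (free ∷ c) (suc i) | inj₁ (k , e) = inj₁ (suc k , cong suc e)
  free-or-fixed (fix0 ∷ c) (suc i) | inj₁ (k , e) = inj₁ (k , cong suc e)
  free-or-fixed (fix1 ∷ c) (suc i) | inj₁ (k , e) = inj₁ (k , cong suc e)

  module Geometry {d m : ℕ} (V : Config d m) {N : ℕ} (ch : Chart V N)
    (expose : ∀ c → rank c ℕ.≤ d → ∀ c′ → c′ ≼ c → Σ (Point d) λ b → Σ ℚ λ v → MaxOn (λ σ → b · V (Chart.point ch σ)) c c′ v)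
    (φ : ∀ c → Fin (rank c) → Fin m → ℚ)
    (dependent : ∀ {k} c (ι : Fin k → Fin m) → (∀ j → ι j ∈ Chart.set ch c) → ∀ (l : Vec ℚ k) → dot l (Vec.replicate k 1ℚ) ≡ 0ℚ →
       (∀ i → dot l (tabulate (λ j → φ c i (ι j))) ≡ 0ℚ) → ∀ i → dot l (tabulate (λ j → V (ι j) i)) ≡ 0ℚ) where

    open Chart ch public
    open Faces V
    open Cubes V ch public
    open FaceOfFace V

    subpattern-face : ∀ c → rank c ℕ.≤ d → IsFace V (set c) → ∀ c′ → c′ ≼ c → IsFace V (set c′)
    subpattern-face c rc (a , v , le , ex , _) c′ l =
      let b , w , mx = expose c rc c′ l
          e , f , le′ , ex′ = face-of-face {set c} {set c′} {a} {v} {b} {w} (le , ex) (set-mono l) (on b w mx) (off b w mx)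
      in e , f , le′ , ex′ , (point (pick c′) , set-∈ c′ (pick-∈ c′))
      where
      on : ∀ b w → MaxOn (λ σ → b · V (point σ)) c c′ w → ∀ {j} → j ∈ set c′ → b · V j ≡ w
      on b w mx h with ∈-set c′ h
      ... | σ , m , refl = proj₁ (mx σ (≼-∈ l m)) m
      off : ∀ b w → MaxOn (λ σ → b · V (point σ)) c c′ w → ∀ {j} → j ∈ set c → j ∉ set c′ → b · V j < w
      off b w mx h h′ with ∈-set c h
      ... | σ , m , refl = proj₂ (mx σ m) (λ x → h′ (set-∈ c′ x))

    -- Fixing one free entry gives a smaller face, and a point outside its hyperplane raises the
    -- dimension by one.
    dim-lower : ∀ k c → rank c ≡ k → k ℕ.≤ d → IsFace V (set c) → DimAtLeast V (set c) k
    dim-lower zero c e h f = dim-point (set-∈ c (pick-∈ c))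
    dim-lower (suc k) c e h f =
      let c′ , l , r , σ , m , o = lower-pattern c e
          f′ = subpattern-face c (subst (ℕ._≤ d) (sym e) h) f c′ l
          a , v , le , ex , _ = f′
      in dim-extend {set c′} {set c} {k} {a} {v} {point σ} (set-mono l) (le , ex) (set-∈ c m) (λ x → o (point-∈ c′ x))
           (dim-lower k c′ r (ℕP.<⇒≤ h) f′)

    dim-exact : ∀ c → rank c ℕ.≤ d → IsFace V (set c) → HasDim V (set c) (rank c)
    dim-exact c h f = dim-lower (rank c) c refl h f , dim-upper (rank c) (φ c) (λ ι mem l → dependent c ι mem l)

    facet-cube : ∀ c → rank c ℕ.≤ d → IsFace V (set c) → CubeEquiv V (set c) (rank c)
    facet-cube c h f = cube-equiv c (subpattern-face c h f)

  -- The capped polytope and its charts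

  module Capped {q h N : ℕ} {good : List (Vec Tri N)} (B : CubicalBase (suc q) h N good) (K′ : ℕ)
    {m : ℕ} (e : Fin m ↔ Tower.Index B (suc K′)) where

    p K : ℕ
    p = suc q
    K = suc K′

    open Tower B K public
    to = Inverse.to e
    from = Inverse.from e

    to-from : ∀ i → to (from i) ≡ i
    to-from i = Inverse.strictlyInverseˡ e i

    from-to : ∀ j → from (to j) ≡ j
    from-to j = Inverse.strictlyInverseʳ e j

    V : Config (suc p) m
    V j = lookup (pt (to j))

    open Faces V

    evalV : ∀ (b : Vec ℚ (suc p)) j → lookup b · V j ≡ dot b (pt (to j))
    evalV b j = sumℚ-dot b (pt (to j))

    evalF : ∀ (b : Vec ℚ (suc p)) i → lookup b · V (from i) ≡ dot b (pt i)
    evalF b i = trans (evalV b (from i)) (cong (λ x → dot b (pt x)) (to-from i))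

    MaxOn-cong : ∀ {M} {f g : Vec Bool M → ℚ} {c c′ v} → (∀ σ → f σ ≡ g σ) → MaxOn f c c′ v → MaxOn g c c′ v
    MaxOn-cong {v = v} h mx σ m = (λ x → trans (sym (h σ)) (proj₁ (mx σ m) x)) , (λ x → subst (_< v) (h σ) (proj₂ (mx σ m) x))

    module Make {M : ℕ} (f : Vec Bool M → Index) (f-inj : ∀ {σ τ} → f σ ≡ f τ → σ ≡ τ)
      (mx : ∀ a c → Σ (Vec Tri M) λ c′ → Σ ℚ λ v → (c′ ≼ c) × MaxOn (λ σ → dot a (pt (f σ))) c c′ v) where

      pointM : Vec Bool M → Fin m
      pointM σ = from (f σ)

      inPattern? : ∀ c j → Dec (Σ (Vec Bool M) λ σ → (σ ∈c c) × (pointM σ ≡ j))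
      inPattern? c j = exists? M (λ σ → ∈c-dec σ c ×-dec (pointM σ FinP.≟ j))

      setM : Vec Tri M → Subset m
      setM c = collect (λ j → ⌊ inPattern? c j ⌋)

      chart : Chart V M
      chart = record
        { point = pointM
        ; point-inj = λ {σ} {τ} x → f-inj (trans (sym (to-from (f σ))) (trans (cong to x) (to-from (f τ))))
        ; set = setM
        ; set-∈ = λ c {σ} h → ∈-collect _ (dec-true (inPattern? c (pointM σ)) (σ , h , refl))
        ; ∈-set = λ c {j} h → true-dec (inPattern? c j) (collect-∈ _ h)
        ; maximum = λ a c → let c′ , v , l , mo = mx (tabulate a) c in
            c′ , v , l , MaxOn-cong (λ σ → sym (trans (·-dot a (pt (to (pointM σ)))) (cong (λ x → dot (tabulate a) (pt x)) (to-from (f σ))))) mo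
        }

      -- Unlike `MaxOn`, this compares with all points of the configuration, also those outside the
      -- chart.
      Top : Vec ℚ (suc p) → Vec Tri M → ℚ → Set
      Top b c v = (∀ σ → σ ∈c c → dot b (pt (f σ)) ≡ v) × (∀ i → (∀ σ → σ ∈c c → f σ ≢ i) → dot b (pt i) < v)

      Top-values : ∀ b c v → Top b c v → ∀ j → (j ∈ setM c → dot b (pt (to j)) ≡ v) × (j ∉ setM c → dot b (pt (to j)) < v)
      Top-values b c v (on , off) j =
        (λ h → let σ , m , x = Chart.∈-set chart c h in trans (cong (λ y → dot b (pt y)) (trans (cong to (sym x)) (to-from (f σ)))) (on σ m)) ,
        (λ h → off (to j) λ σ m x → h (subst (_∈ setM c) (trans (cong from x) (from-to j)) (Chart.set-∈ chart c m)))

      Top-exposes : ∀ b c v → Top b c v → IsFace V (setM c)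
      Top-exposes b c v tp = lookup b , v , (λ j → subst (_≤ v) (sym (evalV b j)) (le j)) , (λ j → (λ x → trans (evalV b j) (proj₁ (tv j) x)) , bwd j) ,
          (pointM (pick c) , Chart.set-∈ chart c (pick-∈ c))
        where
        tv = Top-values b c v tp
        le : ∀ j → dot b (pt (to j)) ≤ v
        le j with SubP._∈?_ j (setM c)
        ... | yes x = ≤-reflexive (proj₁ (tv j) x)
        ... | no x = <⇒≤ (proj₂ (tv j) x)
        bwd : ∀ j → lookup b · V j ≡ v → j ∈ setM c
        bwd j x with SubP._∈?_ j (setM c)
        ... | yes y = y
        ... | no y = ⊥-elim (<-irrefl (trans (sym (evalV b j)) x) (proj₂ (tv j) y))

      identify : ∀ (a : Point (suc p)) c v S → Top (tabulate a) c v → (F : IsFace V S) → proj₁ F ≡ a → setM c ≡ S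
      identify a c v S tp (.a , w , le , ex , (j₀ , j₀∈)) refl = SubP.⊆-antisym i₁ i₂
        where
        b = tabulate a
        tv = Top-values b c v tp
        at-vertex : ∀ j → a · V j ≡ dot b (pt (to j))
        at-vertex j = ·-dot a (pt (to j))
        v≤w : v ≤ w
        v≤w = subst (_≤ w) (trans (at-vertex _) (proj₁ (tv _) (Chart.set-∈ chart c (pick-∈ c)))) (le (pointM (pick c)))
        w≤v : w ≤ v
        w≤v with SubP._∈?_ j₀ (setM c)
        ... | yes x = ≤-reflexive (trans (sym (proj₁ (ex j₀) j₀∈)) (trans (at-vertex j₀) (proj₁ (tv j₀) x)))
        ... | no x = <⇒≤ (subst (_< v) (trans (sym (at-vertex j₀)) (proj₁ (ex j₀) j₀∈)) (proj₂ (tv j₀) x))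
        i₁ : setM c ⊆ S
        i₁ {j} x = proj₂ (ex j) (trans (trans (at-vertex j) (proj₁ (tv j) x)) (≤-antisym v≤w w≤v))
        i₂ : S ⊆ setM c
        i₂ {j} x with SubP._∈?_ j (setM c)
        ... | yes y = y
        ... | no y = ⊥-elim (<-irrefl (trans (sym (at-vertex j)) (trans (proj₁ (ex j) x) (≤-antisym w≤v v≤w))) (proj₂ (tv j) y))

    inj₁-inj : ∀ {x y} → _≡_ {A = Index} (inj₁ x) (inj₁ y) → x ≡ y
    inj₁-inj refl = refl

    module BaseM = Make inj₁ inj₁-inj maxOn-pattern
    module CapM (j : Fin K) = Make (cap j) (cap-inj j) (cap-max j)

    baseφ : ∀ c → Fin (rank c) → Fin m → ℚ
    baseφ c i j = go (to j)
      where
      go : Index → ℚ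
      go (inj₁ σ) = coordinate c i σ
      go (inj₂ _) = 0ℚ

    base-expose : ∀ c → rank c ℕ.≤ suc p → ∀ c′ → c′ ≼ c → Σ (Point (suc p)) λ b → Σ ℚ λ v → MaxOn (λ σ → b · V (BaseM.pointM σ)) c c′ v
    base-expose c rc c′ l = let b , v , mo = expose c rc c′ l in lookup b , v , MaxOn-cong (λ σ → sym (evalF b (inj₁ σ))) mo

    base-dependent : ∀ {k} c (ι : Fin k → Fin m) → (∀ j → ι j ∈ BaseM.setM c) → ∀ (l : Vec ℚ k) → dot l (Vec.replicate k 1ℚ) ≡ 0ℚ →
       (∀ i → dot l (tabulate (λ j → baseφ c i (ι j))) ≡ 0ℚ) → ∀ i → dot l (tabulate (λ j → V (ι j) i)) ≡ 0ℚ
    base-dependent {k} c ι mem l s z i = trans (cong (dot l) (VecP.tabulate-cong (λ j → cong (λ x → lookup (pt x) i) (at j))))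
        (affine c σ (λ j → proj₁ (proj₂ (w j))) l s (λ i → trans (cong (dot l) (VecP.tabulate-cong (λ j → sym (φ-at i j)))) (z i)) i)
      where
      w : ∀ j → Σ (Vec Bool N) λ σ → (σ ∈c c) × (BaseM.pointM σ ≡ ι j)
      w j = Chart.∈-set BaseM.chart c (mem j)
      σ : Fin k → Vec Bool N
      σ j = proj₁ (w j)
      at : ∀ j → to (ι j) ≡ inj₁ (σ j)
      at j = trans (cong to (sym (proj₂ (proj₂ (w j))))) (to-from (inj₁ (σ j)))
      φ-at : ∀ i j → baseφ c i (ι j) ≡ coordinate c i (σ j)
      φ-at i j rewrite at j = refl

    module BaseG = Geometry V BaseM.chart base-expose baseφ base-dependent

    cap-expose-vec : ∀ j c → ∀ c′ → c′ ≼ c → Σ (Vec ℚ (suc p)) λ b → Σ ℚ λ v → MaxOn (λ σ → dot b (pt (cap j σ))) c c′ v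
    cap-expose-vec j (fix0 ∷ c) (fix0 ∷ d) (inj₁ refl ∷ l) = 0ℚ ∷ units d , low 0ℚ (dot Y (lam c (units d))) j , subst (λ z → MaxOn (λ σ → dot (0ℚ ∷ units d) (pt (cap j σ))) (fix0 ∷ c) (fix0 ∷ z) (low 0ℚ (dot Y (lam c (units d))) j)) (restrict-units c d l)
      (cap-max-levels j 0ℚ (units d) fix0 c fix0 (low 0ℚ (dot Y (lam c (units d))) j) (inj₁ refl) (λ { false _ → low-value 0ℚ (dot Y (lam c (units d))) j }) (λ { false _ h → ⊥-elim (h tt) }))
    cap-expose-vec j (fix1 ∷ c) (fix1 ∷ d) (inj₁ refl ∷ l) = 0ℚ ∷ units d , up 0ℚ (dot Y (lam c (units d))) j , subst (λ z → MaxOn (λ σ → dot (0ℚ ∷ units d) (pt (cap j σ))) (fix1 ∷ c) (fix1 ∷ z) (up 0ℚ (dot Y (lam c (units d))) j)) (restrict-units c d l)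
      (cap-max-levels j 0ℚ (units d) fix1 c fix1 (up 0ℚ (dot Y (lam c (units d))) j) (inj₁ refl) (λ { true _ → refl }) (λ { true _ h → ⊥-elim (h tt) }))
    cap-expose-vec j (free ∷ c) (u ∷ d) (_ ∷ l) = α ∷ a , proj₁ (go u step) , subst (λ z → MaxOn (λ σ → dot (α ∷ a) (pt (cap j σ))) (free ∷ c) (u ∷ z) (proj₁ (go u step))) (restrict-units c d l) (proj₂ (go u step))
      where
      a = units d
      H = dot Y (lam c a)
      inv = >0⇒inv (inc (toℕ j)) (inc>0 (FinP.toℕ<n j))
      -- Solves α · inc - μ H = `unit u`, so that the upper end of the cap is better, equal or worse
      -- according to u.
      α = (μ * H + unit u) * proj₁ inv
      step : up α H j - low α H j ≡ unit u
      step = trans (value-step α H (toℕ j)) (trans (cong (_- μ * H) (trans (*-assoc (μ * H + unit u) (proj₁ inv) (inc (toℕ j)))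
         (trans (cong ((μ * H + unit u) *_) (proj₁ (proj₂ inv))) (*-identityʳ (μ * H + unit u)))))
         (solve 2 (λ x u → (x :+ u) :- x := u) refl (μ * H) (unit u)))
      recover : ∀ {x} → up α H j - low α H j ≡ x → low α H j + x ≡ up α H j
      recover refl = solve 2 (λ u l → l :+ (u :- l) := u) refl (up α H j) (low α H j)
      go : ∀ u → up α H j - low α H j ≡ unit u → Σ ℚ λ v → MaxOn (λ σ → dot (α ∷ a) (pt (cap j σ))) (free ∷ c) (u ∷ restrict c a) v
      go fix1 s = up α H j , cap-max-levels j α a free c fix1 (up α H j) (inj₂ refl) (λ { true _ → refl })
        (λ { true _ h → ⊥-elim (h tt) ; false _ _ → subst (_< up α H j) (sym (low-value α H j)) (lt-cert 1ℚ 0<1 (recover s)) })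
      go free s = up α H j , cap-max-levels j α a free c free (up α H j) (inj₂ refl)
        (λ { true _ → refl ; false _ → trans (low-value α H j) (trans (sym (+-identityʳ (low α H j))) (recover s)) }) (λ _ _ h → ⊥-elim (h tt))
      go fix0 s = low α H j , cap-max-levels j α a free c fix0 (low α H j) (inj₂ refl) (λ { false _ → low-value α H j })
        (λ { false _ h → ⊥-elim (h tt) ; true _ _ → lt-cert 1ℚ 0<1 (trans (cong (_+ 1ℚ) (sym (recover s))) (solve 1 (λ x → (x :+ con (- 1ℚ)) :+ con 1ℚ := x) refl (low α H j))) })

    capφ : ∀ (c : Vec Tri (suc p)) → Fin (rank c) → Fin m → ℚ
    capφ c i j = V j (freeAt c i)

    -- Within a cap the scale s is an affine function of the first coordinate, and every other
    -- coordinate is s times a signed half-width. Where the sign is fixed, this coordinate is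
    -- therefore affine in the first one.
    cap-dependent : ∀ {k} jc c (ι : Fin k → Fin m) → (∀ j → ι j ∈ CapM.setM jc c) → ∀ (l : Vec ℚ k) → dot l (Vec.replicate k 1ℚ) ≡ 0ℚ →
       (∀ i → dot l (tabulate (λ j → capφ c i (ι j))) ≡ 0ℚ) → ∀ i → dot l (tabulate (λ j → V (ι j) i)) ≡ 0ℚ
    cap-dependent {k} jc (t₀ ∷ c) ι mem l s₀ z = result
      where
      w : ∀ j → Σ (Vec Bool (suc p)) λ σ → (σ ∈c (t₀ ∷ c)) × (CapM.pointM jc σ ≡ ι j)
      w j = Chart.∈-set (CapM.chart jc) (t₀ ∷ c) (mem j)
      bit : Fin k → Bool
      bit j = Vec.head (proj₁ (w j))
      rest : Fin k → Vec Bool p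
      rest j = Vec.tail (proj₁ (w j))
      L : Fin k → ℕ
      L j = toℕ (rung jc (bit j))
      cons : ∀ {M} (σ : Vec Bool (suc M)) → σ ≡ Vec.head σ ∷ Vec.tail σ
      cons (_ ∷ _) = refl
      at : ∀ j → pt (to (ι j)) ≡ layer (L j) (rest j)
      at j = trans (cong pt (trans (cong to (sym (proj₂ (proj₂ (w j))))) (trans (to-from _) (cong (cap jc) (cons (proj₁ (w j)))))))
        (lev-pt (rung jc (bit j)) (rest j))
      rel : (Fin k → ℚ) → ℚ
      rel f = dot l (tabulate f)
      rel-cong : ∀ {f g : Fin k → ℚ} → (∀ j → f j ≡ g j) → rel f ≡ rel g
      rel-cong h = cong (dot l) (VecP.tabulate-cong h)
      rel-const : ∀ x → rel (λ _ → x) ≡ 0ℚ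
      rel-const x = trans (rel-cong (λ _ → sym (*-identityʳ x))) (trans (dot-tab-* l x (λ _ → 1ℚ))
        (trans (cong (λ v → x * dot l v) (tabulate-const k 1ℚ)) (trans (cong (x *_) s₀) (*-zeroʳ x))))
      rel-scale : ∀ x f → rel f ≡ 0ℚ → rel (λ j → x * f j) ≡ 0ℚ
      rel-scale x f h = trans (dot-tab-* l x f) (trans (cong (x *_) h) (*-zeroʳ x))
      X : Fin k → ℚ
      X j = apex + t (L j)
      mem-c : ∀ j → bit j ∷ rest j ∈c (t₀ ∷ c)
      mem-c j = subst (_∈c (t₀ ∷ c)) (cons (proj₁ (w j))) (proj₁ (proj₂ (w j)))
      relX : rel X ≡ 0ℚ
      relX with free-or-fixed (t₀ ∷ c) zero
      ... | inj₁ (i , ei) = trans (rel-cong (λ j → sym (trans (cong (λ x → lookup (pt (to (ι j))) x) ei) (cong (λ v → lookup v zero) (at j))))) (z i)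
      ... | inj₂ (b , h) = trans (rel-cong (λ j → cong (λ b → apex + t (toℕ (rung jc b))) (h _ (mem-c j)))) (rel-const (apex + t (toℕ (rung jc b))))
      inv = >0⇒inv (inc (toℕ jc)) (inc>0 (FinP.toℕ<n jc))
      slope = - (μ * proj₁ inv)
      base₀ = s (toℕ jc) - slope * (apex + t (toℕ jc))
      s-affine : ∀ b → s (toℕ (rung jc b)) ≡ base₀ + slope * (apex + t (toℕ (rung jc b)))
      s-affine false rewrite FinP.toℕ-inject₁ jc = solve 2 (λ s x → s := (s :- x) :+ x) refl (s (toℕ jc)) (slope * (apex + t (toℕ jc)))
      s-affine true = sym (trans (solve 6 (λ s μ y A t i → (s :- (:- (μ :* y)) :* (A :+ t)) :+ (:- (μ :* y)) :* (A :+ (t :+ i)) := s :- μ :* (y :* i)) refl (s (toℕ jc)) μ (proj₁ inv) apex (t (toℕ jc)) (inc (toℕ jc)))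
        (cong (λ x → s (toℕ jc) - x) (trans (cong (μ *_) (proj₁ (proj₂ inv))) (*-identityʳ μ))))
      relS : rel (λ j → s (L j)) ≡ 0ℚ
      relS = trans (rel-cong (λ j → s-affine (bit j))) (trans (dot-tab-+ l (λ _ → base₀) (λ j → slope * X j))
        (trans (cong₂ _+_ (rel-const base₀) (rel-scale slope X relX)) refl))
      entry : ∀ j i → V (ι j) (suc i) ≡ sg (lookup (rest j) i) * lookup Y i * s (L j)
      entry j i = trans (cong (λ v → lookup v (suc i)) (at j)) (trans (VecP.lookup-zipWith _ i (rest j) (s (L j) ⊙ Y))
        (trans (cong (sg (lookup (rest j) i) *_) (VecP.lookup-map i (s (L j) *_) Y)) (solve 3 (λ a b c → a :* (b :* c) := a :* c :* b) refl (sg (lookup (rest j) i)) (s (L j)) (lookup Y i))))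
      result : ∀ i → rel (λ j → V (ι j) i) ≡ 0ℚ
      result zero = trans (rel-cong (λ j → cong (λ v → lookup v zero) (at j))) relX
      result (suc i) with free-or-fixed (t₀ ∷ c) (suc i)
      ... | inj₁ (i′ , ei) = trans (rel-cong (λ j → cong (V (ι j)) (sym ei))) (z i′)
      ... | inj₂ (b , h) = trans (rel-cong (λ j → trans (entry j i) (cong (λ b → sg b * lookup Y i * s (L j)) (h _ (mem-c j)))))
        (rel-scale (sg b * lookup Y i) (λ j → s (L j)) relS)

    cap-expose : ∀ j c → rank c ℕ.≤ suc p → ∀ c′ → c′ ≼ c → Σ (Point (suc p)) λ b → Σ ℚ λ v → MaxOn (λ σ → b · V (CapM.pointM j σ)) c c′ v
    cap-expose j c _ c′ l = let b , v , mo = cap-expose-vec j c c′ l in lookup b , v , MaxOn-cong (λ σ → sym (evalF b (cap j σ))) mo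

    module CapG (j : Fin K) = Geometry V (CapM.chart j) (cap-expose j) capφ (cap-dependent j)

  module _ (v : ℕ → ℚ) (M : ℕ) (concave : ∀ i j → i ℕ.< j → j ℕ.< M → v (suc j) - v j < v (suc i) - v i) where

    flat-peak : ∀ j → j ℕ.< M → v j ≡ v (suc j) → ∀ i → i ℕ.≤ M → i ≢ j → i ≢ suc j → v i < v j
    flat-peak j hj e i hi ne ne′ with ℕP.<-cmp i j
    ... | tri≈ _ x _ = ⊥-elim (ne x)
    ... | tri< h _ _ = rise j i h (λ k hk → ascend k hk)
      where
      ascend : ∀ k → k ℕ.< j → v k < v (suc k)
      ascend k h = lt-cert ((v (suc k) - v k) - (v (suc j) - v j)) (diff>0 (concave k j h hj))
        (trans (cong (λ z → v k + ((v (suc k) - v k) - (z - v j))) (sym e)) (solve 3 (λ a b c → a :+ ((b :- a) :- (c :- c)) := b) refl (v k) (v (suc k)) (v j)))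
      rise : ∀ j i → i ℕ.< j → (∀ k → k ℕ.< j → v k < v (suc k)) → v i < v j
      rise (suc j) i (s≤s h) up with ℕP.m≤n⇒m<n∨m≡n h
      ... | inj₁ l = <-trans (rise j i l (λ k hk → up k (ℕP.m<n⇒m<1+n hk))) (up j ℕP.≤-refl)
      ... | inj₂ refl = up i ℕP.≤-refl
    ... | tri> _ _ h = subst (v i <_) (sym e) (fall i (ℕP.≤∧≢⇒< h (λ x → ne′ (sym x))) hi)
      where
      fall : ∀ i → suc j ℕ.< i → i ℕ.≤ M → v i < v (suc j)
      fall (suc i) (s≤s h) l with ℕP.m≤n⇒m<n∨m≡n h
      ... | inj₁ h′ = <-trans (descend v M concave j i h l (≤-reflexive (sym e))) (fall i h′ (ℕP.<⇒≤ l))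
      ... | inj₂ refl = descend v M concave j (suc j) h l (≤-reflexive (sym e))

  unique-⊆-length : ∀ {A : Set} {xs ys : List A} → Unique xs → (∀ {x} → x ∈ˡ xs → x ∈ˡ ys) → length xs ℕ.≤ length ys
  unique-⊆-length {xs = []} u sub = z≤n
  unique-⊆-length {xs = x ∷ xs} (x∉ ∷ u) sub with Mem.∈-∃++ (sub (here refl))
  ... | as , bs , refl = ℕP.≤-trans (s≤s (unique-⊆-length u sub′)) (ℕP.≤-reflexive (sym (trans (ListP.length-++ as) (trans (ℕP.+-suc (length as) (length bs)) (cong suc (sym (ListP.length-++ as)))))))
    where
    sub′ : ∀ {z} → z ∈ˡ xs → z ∈ˡ as ++ bs
    sub′ {z} m with Mem.∈-++⁻ as (sub (there m))
    ... | inj₁ h = Mem.∈-++⁺ˡ h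
    ... | inj₂ (here refl) = ⊥-elim (LAll.lookup x∉ m refl)
    ... | inj₂ (there h) = Mem.∈-++⁺ʳ as h

  length-product : ∀ {A C : Set} (xs : List A) (ys : List C) → length (cartesianProduct xs ys) ≡ length xs ℕ.* length ys
  length-product [] ys = refl
  length-product (x ∷ xs) ys = trans (ListP.length-++ (map (x ,_) ys)) (cong₂ ℕ._+_ (ListP.length-map (x ,_) ys) (length-product xs ys))

  -- All faces of the capped polytope

  module Global {q h N : ℕ} {good : List (Vec Tri N)} (B : CubicalBase (suc q) h N good) (K′ : ℕ)
    {m : ℕ} (e : Fin m ↔ Tower.Index B (suc K′)) where

    open Capped B K′ e public
    open Faces V

    private
      M-le : ∀ {M} {f : Vec Bool M → ℚ} {c c′ v} → MaxOn f c c′ v → ∀ σ → σ ∈c c → f σ ≤ v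
      M-le {c′ = c′} mx σ m with σ ∈c? c′
      ... | inj₁ x = ≤-reflexive (proj₁ (mx σ m) x)
      ... | inj₂ x = <⇒≤ (proj₂ (mx σ m) x)

    value-0 : ∀ α H → value α H 0 ≡ α * apex + H
    value-0 α H = solve 3 (λ α a h → α :* (a :+ con 0ℚ) :+ con 1ℚ :* h := α :* a :+ h) refl α apex H

    concave : ∀ α H → 0ℚ < α → ∀ i j → i ℕ.< j → j ℕ.< K → value α H (suc j) - value α H j < value α H (suc i) - value α H i
    concave α H hα i j h hj = subst₂ _<_ (sym (value-step α H j)) (sym (value-step α H i))
      (+-monoˡ-< (- (μ * H)) (*-monoʳ-<-pos α ⦃ positive hα ⦄ (inc-desc i j h hj)))

    lev-le : ∀ l α a τ → dot (α ∷ a) (pt (lev l τ)) ≤ value α (weight a) (toℕ l)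
    lev-le l α a τ = M-le (lev-max l α a allFree) τ (∈-allFree τ)

    value-0≤top : ∀ α a → value α (weight a) 0 ≤ top (α ∷ a)
    value-0≤top α a = subst (_≤ top (α ∷ a)) (proj₁ (lev-max zero α a allFree τ (∈-allFree τ)) (pick-∈ (restrict allFree a)))
        (M-le (maxBase (α ∷ a)) (embB τ) (∈-allFree (embB τ)))
      where τ = pick (restrict allFree a)

    -- By `inc-flat` each step up the tower loses μ H - α · inc > 0. All levels stay below level 0,
    -- which belongs to the base, and the maximal face of the base is not affected.
    flat-top : ∀ α a → α < ρ * weight a → BaseM.Top (α ∷ a) (pattern-of (α ∷ a)) (top (α ∷ a))
    flat-top α a hα = (λ σ m → proj₁ (maxBase (α ∷ a) σ (∈-allFree σ)) m) , off
      where
      H = weight a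
      H≥0 = weight≥0 Y a Y-pos
      down : ∀ l → l ℕ.< K → value α H (suc l) < value α H l
      down l hl = lt-cert (μ * H - α * inc l) (diff>0 (<-≤-trans
          (*-monoˡ-<-pos (inc l) ⦃ positive (inc>0 hl) ⦄ hα)
          (subst (_≤ μ * H) (solve 3 (λ r i h → r :* i :* h := r :* h :* i) refl ρ (inc l) H) (*-monoʳ-≤-nonNeg H ⦃ nonNegative H≥0 ⦄ (inc-flat l)))))
        (trans (cong (value α H (suc l) +_) (trans (solve 2 (λ x y → y :- x := :- (x :- y)) refl (α * inc l) (μ * H)) (cong -_ (sym (value-step α H l)))))
          (solve 2 (λ a b → a :+ (:- (a :- b)) := b) refl (value α H (suc l)) (value α H l)))
      below : ∀ l → l ℕ.< K → value α H (suc l) < value α H 0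
      below zero hl = down 0 hl
      below (suc l) hl = <-trans (down (suc l) hl) (below l (ℕP.<⇒≤ hl))
      off : ∀ i → (∀ σ → σ ∈c pattern-of (α ∷ a) → inj₁ σ ≢ i) → dot (α ∷ a) (pt i) < top (α ∷ a)
      off (inj₁ σ) x = proj₂ (maxBase (α ∷ a) σ (∈-allFree σ)) (λ y → x σ y refl)
      off (inj₂ (j , τ)) x = ≤-<-trans (lev-le (suc j) α a τ) (<-≤-trans (below (toℕ j) (FinP.toℕ<n j)) (value-0≤top α a))

    -- By `steep` the base vertices outside F stay below level 0, so only the levels compete. The
    -- entry u records which ends of cap j attain the maximum.
    steep-top : ∀ α a → 0ℚ < α → ρ * weight a ≤ α → ∀ j u v → (∀ b → Match b u → value α (weight a) (toℕ (rung j b)) ≡ v) →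
      (∀ l → (Σ Bool λ b → Match b u × (rung j b ≡ l)) ⊎ (value α (weight a) (toℕ l) < v)) →
      CapM.Top j (α ∷ a) (u ∷ restrict allFree a) v
    steep-top α a hα hs j u v on lv = on′ , off
      where
      H = weight a
      ρa = restrict allFree a
      on′ : ∀ σ → σ ∈c (u ∷ ρa) → dot (α ∷ a) (pt (cap j σ)) ≡ v
      on′ (b ∷ τ) (mb ∷ mτ) = trans (proj₁ (lev-max (rung j b) α a allFree τ (∈-allFree τ)) mτ) (on b mb)
      lv-le : ∀ l → value α H (toℕ l) ≤ v
      lv-le l with lv l
      ... | inj₁ (b , mb , refl) = ≤-reflexive (on b mb)
      ... | inj₂ x = <⇒≤ x
      off-level : ∀ l τ → (∀ σ → σ ∈c (u ∷ ρa) → cap j σ ≢ lev l τ) → dot (α ∷ a) (pt (lev l τ)) < v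
      off-level l τ x with τ ∈c? ρa | lv l
      ... | inj₂ y | _ = <-≤-trans (proj₂ (lev-max l α a allFree τ (∈-allFree τ)) y) (lv-le l)
      ... | inj₁ _ | inj₂ y = ≤-<-trans (lev-le l α a τ) y
      ... | inj₁ y | inj₁ (b , mb , refl) = ⊥-elim (x (b ∷ τ) (mb ∷ y) refl)
      off : ∀ i → (∀ σ → σ ∈c (u ∷ ρa) → cap j σ ≢ i) → dot (α ∷ a) (pt i) < v
      off (inj₂ (i , τ)) x = off-level (suc i) τ x
      off (inj₁ σ) x with σ ∈c? embP allFree
      ... | inj₂ out = <-≤-trans (steep α a σ hα hs out) (subst (_≤ v) (value-0 α H) (lv-le zero))
      ... | inj₁ m with ∈-embP m
      ... | τ , _ , refl = off-level zero τ x

    positive-slope : ∀ α a → α ∷ a ≢ 𝟎 → ρ * weight a ≤ α → 0ℚ < α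
    positive-slope α a ne hs with 0ℚ <? α
    ... | yes x = x
    ... | no x = ⊥-elim (ne (cong₂ _∷_ α0 (weight-zero Y a Y-pos (≮⇒≥ λ hw → x (<-≤-trans (0<* ρ>0 hw) hs)))))
      where
      α0 : α ≡ 0ℚ
      α0 = ≤-antisym (≮⇒≥ x) (≤-trans (0≤* (<⇒≤ ρ>0) (weight≥0 Y a Y-pos)) hs)

    locate : ∀ b → b ≢ 𝟎 → (Σ ℚ λ v → BaseM.Top b (pattern-of b) v) ⊎ (Σ (Fin K) λ j → Σ (Vec Tri (suc p)) λ c → Σ ℚ λ v → CapM.Top j b c v)
    locate (α ∷ a) ne with α <? ρ * weight a
    ... | yes h = inj₁ (_ , flat-top α a h)
    ... | no h = inj₂ (go (peak (value α H) K (concave α H hα) K ℕP.≤-refl))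
      where
      H = weight a
      hs = ≮⇒≥ h
      hα = positive-slope α a ne hs
      go : Peak (value α H) K → Σ (Fin K) λ j → Σ (Vec Tri (suc p)) λ c → Σ ℚ λ v → CapM.Top j (α ∷ a) c v
      go (pair j j<K e f) = jf , _ , _ , steep-top α a hα hs jf free (value α H j) on lv
        where
        jf = Fin.fromℕ< j<K
        jt : toℕ jf ≡ j
        jt = FinP.toℕ-fromℕ< j<K
        on : ∀ b → Match b free → value α H (toℕ (rung jf b)) ≡ value α H j
        on true _ = trans (cong (value α H ∘ suc) jt) (sym e)
        on false _ = cong (value α H) (trans (FinP.toℕ-inject₁ jf) jt)
        lv : ∀ l → (Σ Bool λ b → Match b free × (rung jf b ≡ l)) ⊎ (value α H (toℕ l) < value α H j)
        lv l with toℕ l ℕ.≟ j | toℕ l ℕ.≟ suc j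
        ... | yes x | _ = inj₁ (false , tt , FinP.toℕ-injective (trans (trans (FinP.toℕ-inject₁ jf) jt) (sym x)))
        ... | no _ | yes x = inj₁ (true , tt , FinP.toℕ-injective (trans (cong suc jt) (sym x)))
        ... | no x | no y = inj₂ (f (toℕ l) (ℕP.≤-pred (FinP.toℕ<n l)) x y)
      go (single j j≤K f) with ℕP.m≤n⇒m<n∨m≡n j≤K
      ... | inj₁ j<K = jf , _ , _ , steep-top α a hα hs jf fix0 (value α H j) on lv
        where
        jf = Fin.fromℕ< j<K
        jt : toℕ (inject₁ jf) ≡ j
        jt = trans (FinP.toℕ-inject₁ jf) (FinP.toℕ-fromℕ< j<K)
        on : ∀ b → Match b fix0 → value α H (toℕ (rung jf b)) ≡ value α H j
        on false _ = cong (value α H) jt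
        lv : ∀ l → (Σ Bool λ b → Match b fix0 × (rung jf b ≡ l)) ⊎ (value α H (toℕ l) < value α H j)
        lv l with toℕ l ℕ.≟ j
        ... | yes x = inj₁ (false , tt , FinP.toℕ-injective (trans jt (sym x)))
        ... | no x = inj₂ (f (toℕ l) (ℕP.≤-pred (FinP.toℕ<n l)) x)
      -- No cap begins at the top level K; it is addressed as the upper end of the last cap.
      ... | inj₂ refl = jf , _ , _ , steep-top α a hα hs jf fix1 (value α H K) on lv
        where
        jf = Fin.fromℕ K′
        jt : toℕ (rung jf true) ≡ K
        jt = cong suc (FinP.toℕ-fromℕ K′)
        on : ∀ b → Match b fix1 → value α H (toℕ (rung jf b)) ≡ value α H K
        on true _ = cong (value α H) jt
        lv : ∀ l → (Σ Bool λ b → Match b fix1 × (rung jf b ≡ l)) ⊎ (value α H (toℕ l) < value α H K)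
        lv l with toℕ l ℕ.≟ K
        ... | yes x = inj₁ (true , tt , FinP.toℕ-injective (trans jt (sym x)))
        ... | no x = inj₂ (f (toℕ l) (ℕP.≤-pred (FinP.toℕ<n l)) x)

    units-weight : ∀ τ → τ ≢ allFree → 0ℚ < weight (units τ)
    units-weight τ ne with 0ℚ <? weight (units τ)
    ... | yes x = x
    ... | no x = ⊥-elim (ne (trans (sym (restrict-units allFree τ (≼-allFree τ)))
        (trans (cong (restrict allFree) (weight-zero Y (units τ) Y-pos (≮⇒≥ x))) (restrict-𝟎 p))))

    -- For α = μ H / inc the levels j and j + 1 have equal maxima, and by concavity all others are
    -- lower. Such an α is positive since H > 0, which is where τ ≠ `allFree` enters: the whole cap
    -- is not a proper face.
    cap-face : ∀ j τ → τ ≢ allFree → IsFace V (CapM.setM j (free ∷ τ))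
    cap-face j τ ne = subst (λ z → IsFace V (CapM.setM j (free ∷ z))) (restrict-units allFree τ (≼-allFree τ))
        (CapM.Top-exposes j (α ∷ a) _ _ (steep-top α a hα hs j free (value α H (toℕ j)) on lv))
      where
      a = units τ
      H = weight a
      hH = units-weight τ ne
      inv = >0⇒inv (inc (toℕ j)) (inc>0 (FinP.toℕ<n j))
      y = proj₁ inv
      α = μ * H * y
      hα : 0ℚ < α
      hα = 0<* (0<* μ>0 hH) (proj₂ (proj₂ inv))
      hs : ρ * H ≤ α
      hs = subst (_≤ α) (trans (solve 4 (λ r i h y → (r :* i) :* h :* y := r :* h :* (y :* i)) refl ρ (inc (toℕ j)) H y)
           (trans (cong (ρ * H *_) (proj₁ (proj₂ inv))) (*-identityʳ (ρ * H))))
         (*-monoʳ-≤-nonNeg y ⦃ nonNegative (<⇒≤ (proj₂ (proj₂ inv))) ⦄ (*-monoʳ-≤-nonNeg H ⦃ nonNegative (<⇒≤ hH) ⦄ (inc-flat (toℕ j))))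
      level : value α H (suc (toℕ j)) - value α H (toℕ j) ≡ 0ℚ
      level = trans (value-step α H (toℕ j)) (trans (cong (_- μ * H) (trans (*-assoc (μ * H) y (inc (toℕ j))) (trans (cong (μ * H *_) (proj₁ (proj₂ inv))) (*-identityʳ (μ * H)))))
        (+-inverseʳ (μ * H)))
      equal : value α H (toℕ j) ≡ value α H (suc (toℕ j))
      equal = trans (sym (+-identityʳ _)) (trans (cong (value α H (toℕ j) +_) (sym level)) (solve 2 (λ a b → a :+ (b :- a) := b) refl (value α H (toℕ j)) (value α H (suc (toℕ j)))))
      on : ∀ b → Match b free → value α H (toℕ (rung j b)) ≡ value α H (toℕ j)
      on true _ = sym equal
      on false _ = cong (value α H) (FinP.toℕ-inject₁ j)
      lv : ∀ l → (Σ Bool λ b → Match b free × (rung j b ≡ l)) ⊎ (value α H (toℕ l) < value α H (toℕ j))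
      lv l with toℕ l ℕ.≟ toℕ j | toℕ l ℕ.≟ suc (toℕ j)
      ... | yes x | _ = inj₁ (false , tt , FinP.toℕ-injective (trans (FinP.toℕ-inject₁ j) (sym x)))
      ... | no _ | yes x = inj₁ (true , tt , FinP.toℕ-injective (sym x))
      ... | no x | no y = inj₂ (flat-peak (value α H) K (concave α H hα) (toℕ j) (FinP.toℕ<n j) equal (toℕ l) (ℕP.≤-pred (FinP.toℕ<n l)) x y)

    cap-subface : ∀ j t τ → τ ≢ allFree → IsFace V (CapM.setM j (t ∷ τ))
    cap-subface j t τ ne = CapG.subpattern-face j (free ∷ τ) (s≤s (rank≤ τ)) (cap-face j τ ne) (t ∷ τ) (inj₂ refl ∷ ≼-refl τ)

    set-≡ : ∀ {M M′} (C : Chart V M) (D : Chart V M′) c d →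
      (∀ σ → σ ∈c c → Σ (Vec Bool M′) λ τ → (τ ∈c d) × (Chart.point D τ ≡ Chart.point C σ)) →
      (∀ τ → τ ∈c d → Σ (Vec Bool M) λ σ → (σ ∈c c) × (Chart.point C σ ≡ Chart.point D τ)) → Chart.set C c ≡ Chart.set D d
    set-≡ C D c d fwd bwd = SubP.⊆-antisym
      (λ x → let σ , m , y = Chart.∈-set C c x
                 τ , m′ , y′ = fwd σ m in subst (_∈ Chart.set D d) (trans y′ y) (Chart.set-∈ D d m′))
      (λ x → let σ , m , y = Chart.∈-set D d x
                 τ , m′ , y′ = bwd σ m in subst (_∈ Chart.set C c) (trans y′ y) (Chart.set-∈ C c m′))

    bottom-set : ∀ τ → CapM.setM zero (fix0 ∷ τ) ≡ BaseM.setM (embP τ)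
    bottom-set τ = set-≡ (CapM.chart zero) BaseM.chart (fix0 ∷ τ) (embP τ)
      (λ { (false ∷ σ) (_ ∷ m) → embB σ , embB-∈ m , refl })
      (λ σ m → let τ′ , m′ , x = ∈-embP m in false ∷ τ′ , tt ∷ m′ , cong (from ∘ inj₁) (sym x))

    shift-set : ∀ i τ → CapM.setM (suc i) (fix0 ∷ τ) ≡ CapM.setM (inject₁ i) (fix1 ∷ τ)
    shift-set i τ = set-≡ (CapM.chart (suc i)) (CapM.chart (inject₁ i)) (fix0 ∷ τ) (fix1 ∷ τ)
      (λ { (false ∷ σ) (_ ∷ m) → true ∷ σ , tt ∷ m , refl })
      (λ { (true ∷ σ) (_ ∷ m) → false ∷ σ , tt ∷ m , refl })

    rank-of-embP : rank (embP allFree) ≡ p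
    rank-of-embP = trans (embP-rank allFree) (rank-allFree p)

    -- Flat functionals keep their maximal face. For a steep one the maximal face of the base lies
    -- in F, and being different from F it is a bottom face of the first cap, exposed by a
    -- functional suited to that cap.
    base-face : ∀ a → rank (pattern-of a) ℕ.≤ p → pattern-of a ≢ embP allFree → IsFace V (BaseM.setM (pattern-of a))
    base-face (α ∷ a) hr ne with α <? ρ * weight a
    ... | yes h = BaseM.Top-exposes (α ∷ a) _ _ (flat-top α a h)
    ... | no h = subst (λ c → IsFace V (BaseM.setM c)) (sym (proj₂ shape)) (subst (IsFace V) (bottom-set (proj₁ shape)) (cap-subface zero fix0 (proj₁ shape) τ≢))
      where
      c = pattern-of (α ∷ a)
      a≢0 : α ∷ a ≢ 𝟎
      a≢0 z = ℕP.<⇒≱ p<N (subst (ℕ._≤ p) (trans (cong rank full) (rank-allFree N)) hr)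
        where
        zero-dot : ∀ σ → dot (α ∷ a) (P σ) ≡ 0ℚ
        zero-dot σ = trans (cong (λ b → dot b (P σ)) z) (dot-𝟎ˡ (P σ))
        top0 : 0ℚ ≡ top (α ∷ a)
        top0 = trans (sym (zero-dot (pick c))) (proj₁ (maxBase (α ∷ a) (pick c) (∈-allFree _)) (pick-∈ c))
        full : c ≡ allFree
        full = ≼-antisym (≼-allFree c) (incl-≼ allFree c λ σ _ → all σ)
          where
          all : ∀ σ → σ ∈c c
          all σ with σ ∈c? c
          ... | inj₁ x = x
          ... | inj₂ x = ⊥-elim (<-irrefl (trans (zero-dot σ) top0) (proj₂ (maxBase (α ∷ a) σ (∈-allFree σ)) x))
      hs = ≮⇒≥ h
      hα = positive-slope α a a≢0 hs
      inside : ∀ σ → σ ∈c c → σ ∈c embP allFree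
      inside σ x with σ ∈c? embP allFree
      ... | inj₁ y = y
      ... | inj₂ y = ⊥-elim (<≤⊥ (steep α a σ hα hs y) (subst₂ _≤_ (value-0 α (weight a)) (sym (proj₁ (maxBase (α ∷ a) σ (∈-allFree σ)) x)) (value-0≤top α a)))
      shape = ≼-embP (incl-≼ c (embP allFree) inside)
      τ≢ : proj₁ shape ≢ allFree
      τ≢ x = ne (trans (proj₂ shape) (cong embP x))

    tabulate-zero : ∀ {n} (a : Point n) → tabulate a ≡ 𝟎 → ∀ x → a · x ≡ 0ℚ
    tabulate-zero {n} a z x = trans (sumℚ-cong (λ i → trans (cong (_* x i) (trans (sym (VecP.lookup∘tabulate a i)) (trans (cong (λ v → lookup v i) z) (VecP.lookup-replicate i 0ℚ)))) (*-zeroˡ (x i)))) (sumℚ-0 n)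

    data Label (S : Subset m) (k : ℕ) : Set where
      base-label : ∀ c → BaseM.setM c ≡ S → rank c ≡ k → Label S k
      cap-label : ∀ j c → CapM.setM j c ≡ S → rank c ≡ k → Label S k

    one-free-less : Vec Tri p
    one-free-less = fix1 ∷ allFree

    whole-dim : HasDim V Sub.⊤ (suc p)
    whole-dim = dim-extend {S} {Sub.⊤} {p} {proj₁ f} {proj₁ (proj₂ f)} {outer} (λ _ → SubP.∈⊤) (proj₁ (proj₂ (proj₂ f)) , proj₁ (proj₂ (proj₂ (proj₂ f)))) SubP.∈⊤ outer∉
        (CapG.dim-lower zero p c (cong suc (rank-allFree q)) (ℕP.n≤1+n p) f) ,
      dim-upper (suc p) (λ i j → V j i) (λ ι _ l _ z i → z i)
      where
      c = free ∷ one-free-less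
      S = CapM.setM zero c
      f : IsFace V S
      f = cap-face zero one-free-less λ ()
      outer = CapM.pointM zero (true ∷ false ∷ Vec.replicate q true)
      outer∉ : outer ∉ S
      outer∉ x = PW.head (PW.tail (CapG.point-∈ zero c {true ∷ false ∷ Vec.replicate q true} x))

    classify : ∀ S k → k ℕ.≤ p → IsFace V S → HasDim V S k → Label S k
    classify S k hk f@(a , w , le , ex , (j₀ , j₀∈)) hd with isZero? (tabulate a)
    ... | inj₁ z = ⊥-elim (ℕP.<⇒≢ (s≤s hk) (dim-unique hd (subst (λ T → HasDim V T (suc p)) (SubP.⊆-antisym all (λ _ → SubP.∈⊤)) whole-dim)))
      where
      all : Sub.⊤ ⊆ S
      all {j} _ = proj₂ (ex j) (trans (tabulate-zero a z (V j)) (trans (sym (tabulate-zero a z (V j₀))) (proj₁ (ex j₀) j₀∈)))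
    ... | inj₂ ne with locate (tabulate a) ne
    ... | inj₁ (v , tp) = base-label c eq (dim-unique (subst (λ T → HasDim V T (rank c)) eq (BaseG.dim-exact c (ℕP.m≤n⇒m≤1+n (pattern-rank (tabulate a) ne)) (subst (IsFace V) (sym eq) f))) hd)
      where
      c = pattern-of (tabulate a)
      eq : BaseM.setM c ≡ S
      eq = BaseM.identify a c v S tp f refl
    ... | inj₂ (j , c , v , tp) = cap-label j c eq (dim-unique (subst (λ T → HasDim V T (rank c)) eq (CapG.dim-exact j c (rank≤ c) (subst (IsFace V) (sym eq) f))) hd)
      where
      eq : CapM.setM j c ≡ S
      eq = CapM.identify j a c v S tp f refl

    cubical : Cubical V (suc p)
    cubical S f hd with classify S p ℕP.≤-refl f hd
    ... | base-label c refl r = subst (CubeEquiv V (BaseM.setM c)) r (BaseG.facet-cube c (ℕP.≤-trans (ℕP.≤-reflexive r) (ℕP.n≤1+n p)) f)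
    ... | cap-label j c refl r = subst (CubeEquiv V (CapM.setM j c)) r (CapG.facet-cube j c (rank≤ c) f)

    -- The pair (j , b , τ) names the pattern τ of level j + 1, or its product with the edge between levels j and j + 1.
    Name : Set
    Name = Vec Tri N ⊎ (Fin K × Bool × Vec Tri p)

    -- Bottom patterns get no name: they are top patterns of the preceding cap or, for the first
    -- cap, patterns of F. This makes naming injective.
    capTri : Bool → Tri
    capTri true = free
    capTri false = fix1

    named : Name → Subset m
    named (inj₁ c) = BaseM.setM c
    named (inj₂ (j , b , τ)) = CapM.setM j (capTri b ∷ τ)

    nameRank : Name → ℕ
    nameRank (inj₁ c) = rank c
    nameRank (inj₂ (j , b , τ)) = rank (capTri b ∷ τ)

    capNames : ℕ → List (Bool × Vec Tri p)
    capNames zero = map (false ,_) (ranked 0 p)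
    capNames (suc k) = map (false ,_) (ranked (suc k) p) ++ map (true ,_) (ranked k p)

    names : ℕ → List Name
    names k = map inj₁ (ranked k N) ++ map inj₂ (cartesianProduct (allFin K) (capNames k))

    in-cap : ∀ j b τ → CapM.pointM j (true ∷ pick τ) ∈ named (inj₂ (j , b , τ))
    in-cap j true τ = Chart.set-∈ (CapM.chart j) (free ∷ τ) {true ∷ pick τ} (tt ∷ pick-∈ τ)
    in-cap j false τ = Chart.set-∈ (CapM.chart j) (fix1 ∷ τ) {true ∷ pick τ} (tt ∷ pick-∈ τ)

    from-inj : ∀ {x y} → from x ≡ from y → x ≡ y
    from-inj {x} {y} h = trans (sym (to-from x)) (trans (cong to h) (to-from y))

    index-of : ∀ j {b τ} → j ∈ named (inj₂ (b , τ)) → Σ Bool λ b′ → Σ (Vec Bool p) λ σ → from (lev (rung b b′) σ) ≡ j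
    index-of j {b} {τ} x with Chart.∈-set (CapM.chart b) _ x
    ... | (b′ ∷ σ) , _ , y = b′ , σ , y

    cap-level : ∀ j b τ j′ b′ τ′ → named (inj₂ (j , b , τ)) ≡ named (inj₂ (j′ , b′ , τ′)) → toℕ j ℕ.≤ toℕ j′
    cap-level j b τ j′ b′ τ′ x with index-of _ (subst (CapM.pointM j (true ∷ pick τ) ∈_) x (in-cap j b τ))
    ... | true , σ , y = ℕP.≤-reflexive (sym (ℕP.suc-injective (cong toℕ (proj₁ (lev-inj {rung j′ true} {suc j} (from-inj y))))))
    ... | false , σ , y = ℕP.≤-trans (ℕP.n≤1+n (toℕ j)) (ℕP.≤-reflexive (trans (sym (cong toℕ (proj₁ (lev-inj {rung j′ false} {suc j} (from-inj y))))) (FinP.toℕ-inject₁ j′)))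

    base≢cap : ∀ c j b τ → BaseM.setM c ≡ named (inj₂ (j , b , τ)) → ⊥
    base≢cap c j b τ x with Chart.∈-set BaseM.chart c (subst (CapM.pointM j (true ∷ pick τ) ∈_) (sym x) (in-cap j b τ))
    ... | σ , _ , y = clash (from-inj y)
      where
      clash : ∀ {σ i τ} → inj₁ σ ≡ lev (suc i) τ → ⊥
      clash ()

    named-inj : ∀ {x y} → named x ≡ named y → x ≡ y
    named-inj {inj₁ c} {inj₁ d} h = cong inj₁ (≼-antisym (BaseG.set-cancel c d (subst (_ ∈_) h)) (BaseG.set-cancel d c (subst (_ ∈_) (sym h))))
    named-inj {inj₁ c} {inj₂ (j , b , τ)} h = ⊥-elim (base≢cap c j b τ h)
    named-inj {inj₂ (j , b , τ)} {inj₁ c} h = ⊥-elim (base≢cap c j b τ (sym h))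
    named-inj {inj₂ (j , b , τ)} {inj₂ (j′ , b′ , τ′)} h with FinP.toℕ-injective {i = j} {j = j′} (ℕP.≤-antisym (cap-level j b τ j′ b′ τ′ h) (cap-level j′ b′ τ′ j b τ (sym h)))
    ... | refl = cong (λ z → inj₂ (j , z)) (decode b b′ (≼-antisym (CapG.set-cancel j (capTri b ∷ τ) (capTri b′ ∷ τ′) (subst (_ ∈_) h)) (CapG.set-cancel j (capTri b′ ∷ τ′) (capTri b ∷ τ) (subst (_ ∈_) (sym h)))))
      where
      decode : ∀ b b′ → capTri b ∷ τ ≡ capTri b′ ∷ τ′ → (b , τ) ≡ (b′ , τ′)
      decode true true refl = refl
      decode false false refl = refl

    -- Not every name is a face: cube faces may be lost in the projection, and F and the boxes
    -- between consecutive caps end up in the interior.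
    faceList : ℕ → List (Subset m)
    faceList k = filter (λ S → Decide.face? V S) (map named (names k))

    capNames-unique : ∀ k → Unique (capNames k)
    capNames-unique zero = Uniq.map⁺ (λ { refl → refl }) (ranked-unique 0 p)
    capNames-unique (suc k) = Uniq.++⁺ (Uniq.map⁺ (λ { refl → refl }) (ranked-unique (suc k) p)) (Uniq.map⁺ (λ { refl → refl }) (ranked-unique k p)) disjoint
      where
      disjoint : ∀ {x} → x ∈ˡ map (false ,_) (ranked (suc k) p) × x ∈ˡ map (true ,_) (ranked k p) → ⊥
      disjoint (x , y) with Mem.∈-map⁻ (false ,_) x
      ... | _ , _ , refl with Mem.∈-map⁻ (true ,_) y
      ... | _ , _ , ()

    sum-unique : ∀ {A C : Set} {xs : List A} {ys : List C} → Unique xs → Unique ys → Unique (map inj₁ xs ++ map inj₂ ys)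
    sum-unique {xs = xs} u u′ = Uniq.++⁺ (Uniq.map⁺ (λ { refl → refl }) u) (Uniq.map⁺ (λ { refl → refl }) u′) disjoint
      where
      disjoint : ∀ {x} → x ∈ˡ map inj₁ _ × x ∈ˡ map inj₂ _ → ⊥
      disjoint (x , y) with Mem.∈-map⁻ inj₁ x
      ... | _ , _ , refl with Mem.∈-map⁻ inj₂ y
      ... | _ , _ , ()

    capList-unique : ∀ k → Unique (cartesianProduct (allFin K) (capNames k))
    capList-unique k = Uniq.cartesianProduct⁺ (Uniq.allFin⁺ K) (capNames-unique k)

    faceList-unique : ∀ k → Unique (faceList k)
    faceList-unique k = Uniq.filter⁺ (λ S → Decide.face? V S) (Uniq.map⁺ named-inj (sum-unique (ranked-unique k N) (capList-unique k)))

    capNames-∈ : ∀ b τ → (b , τ) ∈ˡ capNames (rank (capTri b ∷ τ))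
    capNames-∈ true τ = Mem.∈-++⁺ʳ (map (false ,_) (ranked (suc (rank τ)) p)) (Mem.∈-map⁺ (true ,_) (∈-ranked τ))
    capNames-∈ false τ with rank τ | ∈-ranked τ
    ... | zero | x = Mem.∈-map⁺ (false ,_) x
    ... | suc k | x = Mem.∈-++⁺ˡ (Mem.∈-map⁺ (false ,_) x)

    names-∈ : ∀ x → x ∈ˡ names (nameRank x)
    names-∈ (inj₁ c) = Mem.∈-++⁺ˡ (Mem.∈-map⁺ inj₁ (∈-ranked c))
    names-∈ (inj₂ (j , b , τ)) = Mem.∈-++⁺ʳ (map inj₁ (ranked _ N)) (Mem.∈-map⁺ inj₂ (Mem.∈-cartesianProduct⁺ (Mem.∈-allFin j) (capNames-∈ b τ)))

    capNames-rank : ∀ k {b τ} → (b , τ) ∈ˡ capNames k → rank (capTri b ∷ τ) ≡ k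
    capNames-rank zero x with Mem.∈-map⁻ (false ,_) x
    ... | _ , y , refl = ranked-rank 0 p y
    capNames-rank (suc k) x with Mem.∈-++⁻ (map (false ,_) (ranked (suc k) p)) x
    ... | inj₁ y with Mem.∈-map⁻ (false ,_) y
    ... | _ , z , refl = ranked-rank (suc k) p z
    capNames-rank (suc k) x | inj₂ y with Mem.∈-map⁻ (true ,_) y
    ... | _ , z , refl = cong suc (ranked-rank k p z)

    names-rank : ∀ k {x} → x ∈ˡ names k → nameRank x ≡ k
    names-rank k x with Mem.∈-++⁻ (map inj₁ (ranked k N)) x
    ... | inj₁ y with Mem.∈-map⁻ inj₁ y
    ... | _ , z , refl = ranked-rank k N z
    names-rank k x | inj₂ y with Mem.∈-map⁻ inj₂ y
    ... | _ , z , refl = capNames-rank k (proj₂ (Mem.∈-cartesianProduct⁻ (allFin K) (capNames k) z))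

    named-dim : ∀ x → nameRank x ℕ.≤ p → IsFace V (named x) → HasDim V (named x) (nameRank x)
    named-dim (inj₁ c) hr f = BaseG.dim-exact c (ℕP.m≤n⇒m≤1+n hr) f
    named-dim (inj₂ (j , b , τ)) hr f = CapG.dim-exact j (capTri b ∷ τ) (ℕP.m≤n⇒m≤1+n hr) f

    label-name : ∀ {S k} → Label S k → Σ Name λ x → (named x ≡ S) × (nameRank x ≡ k)
    label-name (base-label c e r) = inj₁ c , e , r
    label-name (cap-label j (free ∷ τ) e r) = inj₂ (j , true , τ) , e , r
    label-name (cap-label j (fix1 ∷ τ) e r) = inj₂ (j , false , τ) , e , r
    label-name (cap-label zero (fix0 ∷ τ) e r) = inj₁ (embP τ) , trans (sym (bottom-set τ)) e , trans (embP-rank τ) r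
    label-name (cap-label (suc i) (fix0 ∷ τ) e r) = inj₂ (inject₁ i , false , τ) , trans (sym (shift-set i τ)) e , r

    faceCount : ∀ k → k ℕ.≤ p → FaceCount V k (length (faceList k))
    faceCount k hk = faceList k , refl , faceList-unique k , λ S → fwd S , bwd S
      where
      fwd : ∀ S → S ∈ˡ faceList k → IsFace V S × HasDim V S k
      fwd S x with Mem.∈-filter⁻ (λ S → Decide.face? V S) {xs = map named (names k)} x
      ... | y , f with Mem.∈-map⁻ named y
      ... | z , z∈ , refl = f , subst (HasDim V (named z)) r (named-dim z (subst (ℕ._≤ p) (sym r) hk) f)
        where r = names-rank k z∈
      bwd : ∀ S → IsFace V S × HasDim V S k → S ∈ˡ faceList k
      bwd S (f , hd) with label-name (classify S k hk f hd)
      ... | x , refl , refl = Mem.∈-filter⁺ (λ S → Decide.face? V S) (Mem.∈-map⁺ named (names-∈ x)) f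

    #caps : ℕ → ℕ
    #caps k = K ℕ.* length (capNames k)

    length-caps : ∀ k → length (cartesianProduct (allFin K) (capNames k)) ≡ #caps k
    length-caps k = trans (length-product (allFin K) (capNames k)) (cong (ℕ._* length (capNames k)) (ListP.length-tabulate {n = K} (λ i → i)))

    length-sum : ∀ {A C : Set} (xs : List A) (ys : List C) → length (map {B = A ⊎ C} inj₁ xs ++ map inj₂ ys) ≡ length xs ℕ.+ length ys
    length-sum xs ys = trans (ListP.length-++ (map inj₁ xs)) (cong₂ ℕ._+_ (ListP.length-map inj₁ xs) (ListP.length-map inj₂ ys))

    cap-name-face : ∀ k → k ℕ.< p → ∀ {x} → x ∈ˡ map inj₂ (cartesianProduct (allFin K) (capNames k)) → IsFace V (named x)
    cap-name-face k hk x∈ with Mem.∈-map⁻ inj₂ x∈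
    ... | (j , b , τ) , y , refl = cap-subface j (capTri b) τ λ z → ℕP.<⇒≱ hk (ℕP.≤-trans (ℕP.≤-reflexive (trans (sym (rank-allFree p)) (cong rank (sym z))))
        (ℕP.≤-trans (tail-rank b) (ℕP.≤-reflexive (capNames-rank k (proj₂ (Mem.∈-cartesianProduct⁻ (allFin K) (capNames k) y))))))
      where
      tail-rank : ∀ b → rank τ ℕ.≤ rank (capTri b ∷ τ)
      tail-rank true = ℕP.n≤1+n (rank τ)
      tail-rank false = ℕP.≤-refl

    real-face : ∀ c → rank c ℕ.< p → (Σ (Vec ℚ (suc p)) λ a → pattern-of a ≡ c) → IsFace V (BaseM.setM c)
    real-face c hr (a , refl) = base-face a (ℕP.<⇒≤ hr) λ z → ℕP.<-irrefl (trans (cong rank z) rank-of-embP) hr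

    low-count : ∀ k → k ℕ.≤ suc h → k ℕ.< p → length (faceList k) ≡ length (ranked k N) ℕ.+ #caps k
    low-count k hk hp = trans (cong length (ListP.filter-all (λ S → Decide.face? V S) all-faces)) (trans (ListP.length-map named (names k))
        (trans (length-sum (ranked k N) _) (cong (length (ranked k N) ℕ.+_) (length-caps k))))
      where
      face : ∀ {x} → x ∈ˡ names k → IsFace V (named x)
      face x∈ with Mem.∈-++⁻ (map inj₁ (ranked k N)) x∈
      ... | inj₂ y = cap-name-face k hp y
      ... | inj₁ y with Mem.∈-map⁻ inj₁ y
      ... | c , z , refl = real-face c (subst (ℕ._< p) (sym r) hp) (low-rank c (subst (ℕ._≤ suc h) (sym r) hk))
        where r = ranked-rank k N z
      all-faces : LAll.All (IsFace V) (map named (names k))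
      all-faces = LAll.tabulate λ x → let z , z∈ , e = Mem.∈-map⁻ named x in subst (IsFace V) (sym e) (face z∈)

    -- Only an inequality, because `good` is not claimed to contain every surviving pattern of this
    -- dimension.
    good-count : ∀ k → k ℕ.< p → Unique good → (∀ {c} → c ∈ˡ good → rank c ≡ k) → length good ℕ.+ #caps k ℕ.≤ length (faceList k)
    good-count k hp ug rg = ℕP.≤-trans (ℕP.≤-reflexive (sym (trans (ListP.length-map named G) (trans (length-sum good _) (cong (length good ℕ.+_) (length-caps k))))))
        (unique-⊆-length (Uniq.map⁺ named-inj (sum-unique ug (capList-unique k))) sub)
      where
      G : List Name
      G = map inj₁ good ++ map inj₂ (cartesianProduct (allFin K) (capNames k))
      sub : ∀ {S} → S ∈ˡ map named G → S ∈ˡ faceList k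
      sub x with Mem.∈-map⁻ named x
      ... | z , z∈ , refl with Mem.∈-++⁻ (map inj₁ good) z∈
      ... | inj₂ y = Mem.∈-filter⁺ (λ S → Decide.face? V S) (Mem.∈-map⁺ named (Mem.∈-++⁺ʳ (map inj₁ (ranked k N)) y)) (cap-name-face k hp y)
      ... | inj₁ y with Mem.∈-map⁻ inj₁ y
      ... | c , c∈ , refl = Mem.∈-filter⁺ (λ S → Decide.face? V S) (Mem.∈-map⁺ named (subst (λ r → inj₁ c ∈ˡ names r) (rg c∈) (names-∈ (inj₁ c))))
          (real-face c (subst (ℕ._< p) (sym (rg c∈)) hp) (good-real c∈))

open import Defs
open import Data.Nat as ℕ using (ℕ; zero; suc; z≤n; s≤s; _+_; _*_; _^_; _≤_; _<_; _>_)
import Data.Nat.Properties as ℕP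
open import Data.Bool using (Bool; true; false; T)
open import Data.Unit using (tt)
open import Data.Fin as Fin using (Fin; zero; suc; toℕ; #_)
import Data.Fin.Subset
import Data.Fin.Properties as FinP
open import Data.List as List using (List; []; length; map)
import Data.List.Properties as ListP
open import Data.Vec as Vec using (Vec; []; _∷_; lookup)
open import Data.Product using (Σ; _×_; _,_; proj₁; proj₂)
open import Data.Product.Function.NonDependent.Propositional using (_×-↔_)
open import Data.Sum using (inj₁; inj₂)
open import Data.Sum.Function.Propositional using (_⊎-↔_)
open import Function using (_↔_; mk↔ₛ′)
open import Function.Properties.Inverse using (↔-trans; ↔-refl)
open import Relation.Nullary using (¬_)
open import Relation.Binary.PropositionalEquality
open CappedPolytopes using (cons3; cons3-length; nil; ranked; even; odd; start; module Lists; CubicalBase; cubicalBase; module Tower; module Global)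

private variable
  n : ℕ
  A B C : Set

-- Counting

tab : (ℕ → A) → ∀ n → Vec A n
tab f zero = []
tab f (suc n) = f 0 ∷ tab (λ i → f (suc i)) n

pre : A → (ℕ → A) → ℕ → A
pre a f zero = a
pre a f (suc i) = f i

-- The index shift z ↦ z - 1 on a truncated row. Dropping the last entry is harmless, as the
-- recursions refer only to equal or smaller indices.
push : A → Vec A n → Vec A n
push a [] = []
push a (x ∷ v) = a ∷ push x v

tab-cong : ∀ {f g : ℕ → A} n → (∀ i → f i ≡ g i) → tab f n ≡ tab g n
tab-cong zero h = refl
tab-cong (suc n) h = cong₂ _∷_ (h 0) (tab-cong n (λ i → h (suc i)))

push-tab : ∀ (a : A) f n → push a (tab f n) ≡ tab (pre a f) n
push-tab a f zero = refl
push-tab a f (suc n) = cong (a ∷_) (trans (push-tab (f 0) (λ i → f (suc i)) n) (tab-cong n λ { zero → refl ; (suc i) → refl }))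

map-tab : ∀ (g : A → B) f n → Vec.map g (tab f n) ≡ tab (λ i → g (f i)) n
map-tab g f zero = refl
map-tab g f (suc n) = cong (_ ∷_) (map-tab g _ n)

zip-tab : ∀ (g : A → B → C) f f′ n → Vec.zipWith g (tab f n) (tab f′ n) ≡ tab (λ i → g (f i) (f′ i)) n
zip-tab g f f′ zero = refl
zip-tab g f f′ (suc n) = cong (_ ∷_) (zip-tab g _ _ n)

step : ℕ → ℕ → ℕ
step a b = a + (a + b)

-- Abstract, so that comparing counts never unfolds the lists.
abstract
  #ranked : ℕ → ℕ → ℕ
  #ranked n k = length (ranked k n)

  #even #odd #start : ℕ → ℕ → ℕ → ℕ
  #even n s z = length (even s z n)
  #odd n s z = length (odd s z n)
  #start n s z = length (start s z n)

  #ranked-suc : ∀ n k → #ranked (suc n) k ≡ step (#ranked n k) (pre 0 (#ranked n) k)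
  #ranked-suc n zero = cons3-length (ranked 0 n) (ranked 0 n) []
  #ranked-suc n (suc k) = cons3-length (ranked (suc k) n) (ranked (suc k) n) (ranked k n)

  #even-suc : ∀ n s z → #even (suc n) s z ≡ step (#even n s z) (pre 0 (#odd n s) z)
  #even-suc n s zero = cons3-length (even s 0 n) (even s 0 n) []
  #even-suc n s (suc z) = cons3-length (even s (suc z) n) (even s (suc z) n) (odd s z n)

  #odd-suc : ∀ n s z → #odd (suc n) s z ≡ step (pre (λ _ → 0) (#even n) s z) (pre 0 (#even n s) z)
  #odd-suc n zero zero = refl
  #odd-suc n (suc s) zero = cons3-length (even s 0 n) (even s 0 n) []
  #odd-suc n zero (suc z) = cons3-length [] [] (even 0 z n)
  #odd-suc n (suc s) (suc z) = cons3-length (even s (suc z) n) (even s (suc z) n) (even (suc s) z n)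

  #start-suc : ∀ n s z → #start (suc n) s z ≡ step (#even n s z) (pre 0 (#start n s) z)
  #start-suc n s zero = cons3-length (even s 0 n) (even s 0 n) []
  #start-suc n s (suc z) = cons3-length (even s (suc z) n) (even s (suc z) n) (start s z n)

  #ranked-length : ∀ n k → length (ranked k n) ≡ #ranked n k
  #ranked-length n k = refl

  #even-length : ∀ n s z → length (even s z n) ≡ #even n s z
  #even-length n s z = refl

  #start-length : ∀ n s z → length (start s z n) ≡ #start n s z
  #start-length n s z = refl

  #ranked-0 : ∀ k → #ranked 0 k ≡ length (nil k)
  #ranked-0 zero = refl
  #ranked-0 (suc k) = refl

  #tables-0 : ∀ s z → (#even 0 s z ≡ length (nil z)) × (#odd 0 s z ≡ length (nil z)) × (#start 0 s z ≡ length (nil z))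
  #tables-0 s z = refl , odd-0 s z , refl
    where
    odd-0 : ∀ s z → #odd 0 s z ≡ length (nil z)
    odd-0 zero zero = refl
    odd-0 zero (suc z) = refl
    odd-0 (suc s) zero = refl
    odd-0 (suc s) (suc z) = refl

-- Tabulating the recursions

Row : ℕ → Set
Row Z = Vec ℕ Z

Table : ℕ → ℕ → Set
Table S Z = Vec (Row Z) S

rankedRow : ∀ Z n → Row Z
rankedRow Z n = tab (#ranked n) Z

evenTable oddTable startTable : ∀ S Z n → Table S Z
evenTable S Z n = tab (λ s → tab (#even n s) Z) S
oddTable S Z n = tab (λ s → tab (#odd n s) Z) S
startTable S Z n = tab (λ s → tab (#start n s) Z) S

module _ {S Z : ℕ} where

  nextRanked : Row Z → Row Z
  nextRanked r = Vec.zipWith step r (push 0 r)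

  next : Table S Z → Table S Z → Table S Z
  next e o = Vec.zipWith (Vec.zipWith step) e (Vec.map (push 0) o)

  rankedRow-suc : ∀ n → rankedRow Z (suc n) ≡ nextRanked (rankedRow Z n)
  rankedRow-suc n = sym (trans (cong (Vec.zipWith step (rankedRow Z n)) (push-tab 0 (#ranked n) Z))
    (trans (zip-tab step (#ranked n) _ Z) (tab-cong Z (λ k → sym (#ranked-suc n k)))))

  next-tab : ∀ (a b c : ℕ → ℕ → ℕ) → (∀ s z → c s z ≡ step (a s z) (pre 0 (b s) z)) →
    next (tab (λ s → tab (a s) Z) S) (tab (λ s → tab (b s) Z) S) ≡ tab (λ s → tab (c s) Z) S
  next-tab a b c h = trans (cong (Vec.zipWith (Vec.zipWith step) _) (map-tab (push 0) (λ s → tab (b s) Z) S))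
    (trans (zip-tab (Vec.zipWith step) _ _ S) (tab-cong S (λ s → trans (cong (Vec.zipWith step (tab (a s) Z)) (push-tab 0 (b s) Z))
      (trans (zip-tab step (a s) _ Z) (tab-cong Z (λ z → sym (h s z)))))))

  evenTable-suc : ∀ n → evenTable S Z (suc n) ≡ next (evenTable S Z n) (oddTable S Z n)
  evenTable-suc n = sym (next-tab _ _ _ (#even-suc n))

  startTable-suc : ∀ n → startTable S Z (suc n) ≡ next (evenTable S Z n) (startTable S Z n)
  startTable-suc n = sym (next-tab _ _ _ (#start-suc n))

  pushRow : Table S Z → Table S Z
  pushRow = push (Vec.replicate Z 0)

  oddTable-suc : ∀ n → oddTable S Z (suc n) ≡ next (pushRow (evenTable S Z n)) (evenTable S Z n)
  oddTable-suc n = sym (trans (cong (λ t → next t (evenTable S Z n)) eq) (next-tab (pre (λ _ → 0) (#even n)) (#even n) (#odd (suc n)) (#odd-suc n)))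
    where
    zeros : ∀ Z → Vec.replicate Z 0 ≡ tab (λ _ → 0) Z
    zeros zero = refl
    zeros (suc Z) = cong (0 ∷_) (zeros Z)
    eq : pushRow (evenTable S Z n) ≡ tab (λ s → tab (pre (λ _ → 0) (#even n) s) Z) S
    eq = trans (push-tab (Vec.replicate Z 0) (λ s → tab (#even n s) Z) S) (tab-cong S λ { zero → zeros Z ; (suc s) → refl })

tab-lookup : ∀ (f : ℕ → A) {n} (i : Fin n) → Vec.lookup (tab f n) i ≡ f (toℕ i)
tab-lookup f zero = refl
tab-lookup f (suc i) = tab-lookup (λ i → f (suc i)) i

cube-size : ∀ n → Σ ℕ λ m → Fin m ↔ Vec Bool n
cube-size zero = 1 , mk↔ₛ′ (λ _ → []) (λ _ → zero) (λ { [] → refl }) (λ { zero → refl })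
cube-size (suc n) = let m , e = cube-size n in
  2 * m , ↔-trans FinP.*↔× (↔-trans (FinP.2↔Bool ×-↔ e) (mk↔ₛ′ (λ { (b , v) → b ∷ v }) (λ { (b ∷ v) → b , v }) (λ { (b ∷ v) → refl }) (λ { (b , v) → refl })))

-- The k-faces of a (p + 1)-cube outside its bottom facet: those of the top facet, and the products
-- of a (k - 1)-face with the vertical edge.
#cap : ℕ → ℕ → ℕ
#cap p k = #ranked p k + pre 0 (#ranked p) k

abstract
  #neg #pos #realized : ℕ → ℕ → ℕ → ℕ
  #neg p h r = length (Lists.negHead p h r)
  #pos p h r = length (Lists.posHead p h r)
  #realized p h r = length (Lists.realized p h r)

  #neg-0 : ∀ p h → #neg p h 0 ≡ 0
  #neg-0 p h = refl

  #pos-0 : ∀ p h → #pos p h 0 ≡ 0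
  #pos-0 p h = refl

  #neg-suc : ∀ p h r → #neg p h (suc r) ≡ step (#even (suc (r + p)) h (suc (suc h))) (#ranked (suc (r + p)) (suc h))
  #neg-suc p h r = trans (cons3-length (even h (suc (suc h)) (suc (r + p))) (even h (suc (suc h)) (suc (r + p))) (ranked (suc h) (suc (r + p))))
    (cong₂ step (#even-length (suc (r + p)) h (suc (suc h))) (#ranked-length (suc (r + p)) (suc h)))

  #pos-suc : ∀ p h r → #pos p h (suc r) ≡ #neg p h r + (#pos p h r + #start (suc (r + p)) h (suc h))
  #pos-suc p h r = trans (cons3-length (Lists.negHead p h r) (Lists.posHead p h r) (start h (suc h) (suc (r + p))))
    (cong (λ x → #neg p h r + (#pos p h r + x)) (#start-length (suc (r + p)) h (suc h)))

  #realized-split : ∀ p h r → #realized p h r ≡ #neg p h r + (#pos p h r + #ranked (suc (r + p)) (suc h))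
  #realized-split p h r = trans (cons3-length (Lists.negHead p h r) (Lists.posHead p h r) (ranked (suc h) (suc (r + p))))
    (cong (λ x → #neg p h r + (#pos p h r + x)) (#ranked-length (suc (r + p)) (suc h)))

  #realized-length : ∀ p h r → length (Lists.realized p h r) ≡ #realized p h r
  #realized-length p h r = refl

opaque
  capped-polytope : ∀ q h r K′ → suc h + suc h < suc q → suc (suc h) < suc q →
    Σ ℕ λ m → Σ (Config (suc (suc q)) m) λ V →
      HasDim V Data.Fin.Subset.⊤ (suc (suc q)) × Cubical V (suc (suc q)) × Σ (ℕ → ℕ) λ f →
        (∀ k → k ≤ suc q → FaceCount V k (f k)) ×
        (∀ k → k ≤ suc h → f k ≡ #ranked (suc (suc r + suc q)) k + suc K′ * #cap (suc q) k) ×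
        (#realized (suc q) h r + suc K′ * #cap (suc q) (suc (suc h)) ≤ f (suc (suc h)))
  capped-polytope q h r K′ hp hp′ = proj₁ index , G.V , G.whole-dim , G.cubical , (λ k → length (G.faceList k)) , G.faceCount ,
      (λ k hk → trans (G.low-count k hk (ℕP.≤-<-trans hk (ℕP.<-trans ℕP.≤-refl hp′))) (cong₂ (λ x y → x + suc K′ * y) (#ranked-length (suc (suc r + suc q)) k) (caps k))) ,
      subst₂ (λ x y → x + suc K′ * y ≤ length (G.faceList (suc (suc h)))) (#realized-length (suc q) h r) (caps (suc (suc h)))
        (G.good-count (suc (suc h)) hp′ (Lists.realized-unique (suc q) h r) (Lists.realized-rank (suc q) h r))
    where
    base : CubicalBase (suc q) h (suc (suc r + suc q)) (Lists.realized (suc q) h r)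
    base = cubicalBase (suc q) h r hp
    index : Σ ℕ λ m → Fin m ↔ Tower.Index base (suc K′)
    index = proj₁ (cube-size (suc (suc r + suc q))) + suc K′ * proj₁ (cube-size (suc q)) ,
      ↔-trans FinP.+↔⊎ (proj₂ (cube-size (suc (suc r + suc q))) ⊎-↔ ↔-trans FinP.*↔× (↔-refl ×-↔ proj₂ (cube-size (suc q))))
    module G = Global base K′ (proj₂ index)
    caps : ∀ k → length (G.capNames k) ≡ #cap (suc q) k
    pairWith : Bool → Vec Tri (suc q) → Bool × Vec Tri (suc q)
    pairWith b τ = b , τ
    caps zero = trans (ListP.length-map (pairWith false) (ranked 0 (suc q)))
      (trans (#ranked-length (suc q) 0) (sym (ℕP.+-identityʳ (#ranked (suc q) 0))))
    caps (suc k) = trans (ListP.length-++ (map (pairWith false) (ranked (suc k) (suc q))) {map (pairWith true) (ranked k (suc q))})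
      (cong₂ _+_ (trans (ListP.length-map (pairWith false) (ranked (suc k) (suc q))) (#ranked-length (suc q) (suc k)))
        (trans (ListP.length-map (pairWith true) (ranked k (suc q))) (#ranked-length (suc q) k)))

iterate : ∀ {A : Set} → (A → A) → ℕ → A → A
iterate f zero x = x
iterate f (suc n) x = f (iterate f n x)

entry : ∀ {S Z} → Table S Z → Fin S → Fin Z → ℕ
entry t i j = lookup (lookup t i) j

entry-tab : ∀ (f : ℕ → ℕ → ℕ) {S Z} (i : Fin S) (j : Fin Z) → entry (tab (λ s → tab (f s) Z) S) i j ≡ f (toℕ i) (toℕ j)
entry-tab f {S} {Z} i j = trans (cong (λ v → lookup v j) (tab-lookup (λ s → tab (f s) Z) i)) (tab-lookup (f (toℕ i)) j)

-- The recursion for the counts, tabulated for fewer than S double zeros and fewer than Z zeros.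
module Evaluate (S Z : ℕ) where

  Tables : Set
  Tables = Row Z × Table S Z × Table S Z × Table S Z

  tables : ℕ → Tables
  tables n = rankedRow Z n , evenTable S Z n , oddTable S Z n , startTable S Z n

  next-tables : Tables → Tables
  next-tables (r , e , o , s) = nextRanked {S} r , next e o , next (pushRow e) e , next e s

  tables-suc : ∀ n → tables (suc n) ≡ next-tables (tables n)
  tables-suc n = cong₂ _,_ (rankedRow-suc {S} n) (cong₂ _,_ (evenTable-suc n) (cong₂ _,_ (oddTable-suc n) (startTable-suc n)))

  table₀ : Table S Z
  table₀ = tab (λ _ → tab (λ z → length (nil z)) Z) S

  tables₀ : Tables
  tables₀ = tab (λ k → length (nil k)) Z , table₀ , table₀ , table₀

  tables-iterate : ∀ n → tables n ≡ iterate next-tables n tables₀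
  tables-iterate zero = cong₂ _,_ (tab-cong Z #ranked-0) (cong₂ _,_ (table (#even 0) (λ s z → proj₁ (#tables-0 s z)))
    (cong₂ _,_ (table (#odd 0) (λ s z → proj₁ (proj₂ (#tables-0 s z)))) (table (#start 0) (λ s z → proj₂ (proj₂ (#tables-0 s z))))))
    where
    table : ∀ (f : ℕ → ℕ → ℕ) → (∀ s z → f s z ≡ length (nil z)) → tab (λ s → tab (f s) Z) S ≡ table₀
    table f eq = tab-cong S (λ s → tab-cong Z (eq s))
  tables-iterate (suc n) = trans (tables-suc n) (cong next-tables (tables-iterate n))

  module Realized (p : ℕ) (h : Fin S) (z : Fin Z) (z′ : Fin Z) (z≡ : toℕ z ≡ suc (toℕ h)) (z′≡ : toℕ z′ ≡ suc (suc (toℕ h))) where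

    Counts : Set
    Counts = Tables × ℕ × ℕ

    counts : ℕ → Counts
    counts r = tables (suc (r + p)) , #neg p (toℕ h) r , #pos p (toℕ h) r

    next-counts : Counts → Counts
    next-counts ((r , e , o , s) , a , b) = next-tables (r , e , o , s) , step (entry e h z′) (lookup r z) , a + (b + entry s h z)

    counts-suc : ∀ r → counts (suc r) ≡ next-counts (counts r)
    counts-suc r = cong₂ _,_ (tables-suc l) (cong₂ _,_
      (trans (#neg-suc p (toℕ h) r) (sym (cong₂ step (trans (entry-tab (#even l) h z′) (cong (#even l (toℕ h)) z′≡)) (trans (tab-lookup (#ranked l) z) (cong (#ranked l) z≡)))))
      (trans (#pos-suc p (toℕ h) r) (cong (λ x → #neg p (toℕ h) r + (#pos p (toℕ h) r + x)) (sym (trans (entry-tab (#start l) h z) (cong (#start l (toℕ h)) z≡))))))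
      where l = suc (r + p)

    final : ℕ → Counts
    final r = iterate next-counts r (iterate next-tables (suc p) tables₀ , 0 , 0)

    final-counts : ∀ r → counts r ≡ final r
    final-counts zero = cong₂ _,_ (tables-iterate (suc p)) (cong₂ _,_ (#neg-0 p (toℕ h)) (#pos-0 p (toℕ h)))
    final-counts (suc r) = trans (counts-suc r) (cong next-counts (final-counts r))

    rankedTop : ℕ → Fin Z → ℕ
    rankedTop r k = lookup (proj₁ (proj₁ (final r))) k

    rankedFacet : ℕ → Fin Z → ℕ
    rankedFacet n k = lookup (proj₁ (iterate next-tables n tables₀)) k

    realizedTop : ℕ → ℕ
    realizedTop r = proj₁ (proj₂ (final r)) + (proj₂ (proj₂ (final r)) + rankedTop r z)

    rankedTop-correct : ∀ r k → #ranked (suc (r + p)) (toℕ k) ≡ rankedTop r k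
    rankedTop-correct r k = trans (sym (tab-lookup (#ranked (suc (r + p))) k)) (cong (λ c → lookup (proj₁ (proj₁ c)) k) (final-counts r))

    rankedFacet-correct : ∀ n k → #ranked n (toℕ k) ≡ rankedFacet n k
    rankedFacet-correct n k = trans (sym (tab-lookup (#ranked n) k)) (cong (λ c → lookup (proj₁ c) k) (tables-iterate n))

    realizedTop-correct : ∀ r → #realized p (toℕ h) r ≡ realizedTop r
    realizedTop-correct r = trans (#realized-split p (toℕ h) r) (cong₂ _+_ (cong (λ c → proj₁ (proj₂ c)) (final-counts r))
      (cong₂ _+_ (cong (λ c → proj₂ (proj₂ c)) (final-counts r)) (trans (cong (#ranked (suc (r + p))) (sym z≡)) (rankedTop-correct r z))))

-- Opaque, so that these numbers are evaluated only in the comparisons below.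
opaque
  rankedAt rankedFacet : ℕ → Fin 7 → ℕ
  -- The 5 rows are s = 0, ..., 4 = h, and the 7 columns are z = 0, ..., 6 = h + 2; here p = 11.
  rankedAt = Evaluate.Realized.rankedTop 5 7 11 (# 4) (# 5) (# 6) refl refl
  rankedFacet = Evaluate.Realized.rankedFacet 5 7 11 (# 4) (# 5) (# 6) refl refl

  realizedAt : ℕ → ℕ
  realizedAt = Evaluate.Realized.realizedTop 5 7 11 (# 4) (# 5) (# 6) refl refl

  rankedAt-correct : ∀ r k → #ranked (suc (r + 11)) (toℕ k) ≡ rankedAt r k
  rankedAt-correct = Evaluate.Realized.rankedTop-correct 5 7 11 (# 4) (# 5) (# 6) refl refl

  rankedFacet-correct : ∀ n k → #ranked n (toℕ k) ≡ rankedFacet n k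
  rankedFacet-correct = Evaluate.Realized.rankedFacet-correct 5 7 11 (# 4) (# 5) (# 6) refl refl

  realizedAt-correct : ∀ r → #realized 11 4 r ≡ realizedAt r
  realizedAt-correct = Evaluate.Realized.realizedTop-correct 5 7 11 (# 4) (# 5) (# 6) refl refl

  -- One less than the least number of caps for which 2^131 + 2^11 · caps reaches the required range.
  K₀ : ℕ
  K₀ = 1840999999629426090084127096192939719655423

count₀ : ℕ
count₀ = rankedAt 119 (# 0) + suc K₀ * (rankedFacet 11 (# 0) + 0)

count : Fin 7 → Fin 7 → ℕ
count k j = rankedAt 119 k + suc K₀ * (rankedFacet 11 k + rankedFacet 11 j)

count₆ : ℕ
count₆ = realizedAt 118 + suc K₀ * (rankedFacet 11 (# 6) + rankedFacet 11 (# 5))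

opaque
  unfolding rankedAt rankedFacet realizedAt K₀

  by-evaluation : ∀ a b → T (a ℕ.<ᵇ b) → a < b
  by-evaluation = ℕP.<ᵇ⇒<

  count₀-lower : 37703707215 * 10 ^ 35 < suc count₀
  count₀-lower = by-evaluation (37703707215 * 10 ^ 35) (suc count₀) tt

  count₀-upper : count₀ < 37703707225 * 10 ^ 35
  count₀-upper = by-evaluation count₀ (37703707225 * 10 ^ 35) tt

  -- The caps contribute 12672 each, and their total outweighs the difference C(131,5) · 2¹²⁶ -
  -- C(131,4) · 2¹²⁷ of the face numbers of the 131-cube.
  count₅<count₄ : count (# 5) (# 4) < count (# 4) (# 3)
  count₅<count₄ = by-evaluation (count (# 5) (# 4)) (count (# 4) (# 3)) tt

  count₅<count₆ : count (# 5) (# 4) < count₆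
  count₅<count₆ = by-evaluation (count (# 5) (# 4)) count₆ tt

module _ (f : ℕ → ℕ) (low : ∀ k → k ≤ 5 → f k ≡ #ranked 131 k + suc K₀ * #cap 11 k)
  (high : #realized 11 4 118 + suc K₀ * #cap 11 6 ≤ f 6) where

  #ranked131 : ∀ k → #ranked 131 (toℕ k) ≡ rankedAt 119 k
  #ranked131 = rankedAt-correct 119

  #ranked11 : ∀ k → #ranked 11 (toℕ k) ≡ rankedFacet 11 k
  #ranked11 = rankedFacet-correct 11

  f₀ : f 0 ≡ count₀
  f₀ = trans (low 0 z≤n) (cong₂ (λ x y → x + suc K₀ * (y + 0)) (#ranked131 (# 0)) (#ranked11 (# 0)))

  f₄ : f 4 ≡ count (# 4) (# 3)
  f₄ = trans (low 4 (ℕP.m≤m+n 4 1)) (cong₂ (λ x y → x + suc K₀ * y) (#ranked131 (# 4)) (cong₂ _+_ (#ranked11 (# 4)) (#ranked11 (# 3))))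

  f₅ : f 5 ≡ count (# 5) (# 4)
  f₅ = trans (low 5 ℕP.≤-refl) (cong₂ (λ x y → x + suc K₀ * y) (#ranked131 (# 5)) (cong₂ _+_ (#ranked11 (# 5)) (#ranked11 (# 4))))

  f₆ : count₆ ≤ f 6
  f₆ = subst (_≤ f 6) (cong₂ (λ x y → x + suc K₀ * y) (realizedAt-correct 118) (cong₂ _+_ (#ranked11 (# 6)) (#ranked11 (# 5)))) high

  f₀-lower : 37703707215 * 10 ^ 35 ≤ f 0
  f₀-lower = subst (37703707215 * 10 ^ 35 ≤_) (sym f₀) (ℕP.≤-pred count₀-lower)

  f₀-upper : f 0 < 37703707225 * 10 ^ 35
  f₀-upper = subst (_< 37703707225 * 10 ^ 35) (sym f₀) count₀-upper

  f₅<f₄ : f 5 < f 4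
  f₅<f₄ = subst₂ _<_ (sym f₅) (sym f₄) count₅<count₄

  f₅<f₆ : f 5 < f 6
  f₅<f₆ = ℕP.<-≤-trans (subst (_< count₆) (sym f₅) count₅<count₆) f₆

valley-not-unimodal : ∀ {n} (f : Fin n → ℕ) i j k → i Fin.≤ j → j Fin.≤ k → f i > f j → f j < f k → ¬ Unimodal f
valley-not-unimodal f i j k i≤j j≤k fi>fj fj<fk (l , up , down) with ℕP.≤-total (toℕ l) (toℕ j)
... | inj₁ l≤j = ℕP.<⇒≱ fj<fk (down j k l≤j j≤k)
... | inj₂ j≤l = ℕP.<⇒≱ fi>fj (up i j i≤j j≤l)

theorem2 : Σ ℕ λ m → Σ (Config 12 m) λ V →
    IsPolytopeOfDim V 12 × Cubical V 12 ×
    Σ (Fin 12 → ℕ) λ f →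
    (∀ i → FaceCount V (toℕ i) (f i)) ×
    (37703707215 * 10 ^ 35 ≤ f (# 0)) × (f (# 0) < 37703707225 * 10 ^ 35) ×
    (f (# 4) > f (# 5)) × (f (# 5) < f (# 6)) ×
    ¬ Unimodal f
theorem2 =
  -- The dimension is q + 2 = 12 and that of the large cube is r + q + 3 = 131. Since 2(h + 1) = 10
  -- < 11, the face numbers are exact up to h + 1 = 5.
  let m , V , dim , cub , f , faces , low , high = capped-polytope 10 4 118 K₀ (ℕP.m≤m+n 11 0) (ℕP.m≤m+n 7 4)
  in m , V , dim , cub , (λ i → f (toℕ i)) , (λ i → faces (toℕ i) (ℕP.≤-pred (FinP.toℕ<n i))) ,
     f₀-lower f low high , f₀-upper f low high , f₅<f₄ f low high , f₅<f₆ f low high ,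
     valley-not-unimodal (λ i → f (toℕ i)) (# 4) (# 5) (# 6) (ℕP.m≤m+n 4 1) (ℕP.m≤m+n 5 1) (f₅<f₄ f low high) (f₅<f₆ f low high)
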